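{- For each $n\in\{7,13,19\}$, there is a balanced triangle design in $\mathbb{F}_{2^n}$ (viewed as an $n$-dimensional vector space over $\mathbb{F}_2$) that is invariant under the action of the multiplicative group $\mathbb{F}_{2^n}^*$ (by multiplication) and under the action of the automorphism group $\mathrm{Aut}(\mathbb{F}_{2^n})$ of the field.
   Context: For a vector space $V$ over $\mathbb{F}_2$, a triangle is a set $\{\langle a,b\rangle,\langle b,c\rangle,\langle c,a\rangle\}$ of three $2$-dimensional subspaces, with $a,b,c$ linearly independent. A triangle design in $V$ is a set of triangles such that every $2$-dimensional subspace of $V$ belongs to exactly one triangle of the set. A triangle covers a nonzero vector $x$ if $x$ lies in one of its three subspaces; a triangle design is balanced if every nonzero vector is covered by the same number of its triangles. Invariance under a group of $\mathbb{F}_2$-linear maps means each map sends the set of triangles onto itself. -}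

module Defs where

open import Data.Bool using (Bool; true; false; _xor_; if_then_else_)
open import Data.Bool.Properties using () renaming (_≟_ to _≟ᵇ_)
open import Data.Nat using (ℕ; zero; suc)
open import Data.Fin using (Fin)
open import Data.Vec using (Vec; []; _∷_; replicate; zipWith)
open import Data.Vec.Properties using (≡-dec)
open import Data.List using (List; length; filter; lookup)
open import Data.List.Relation.Unary.All using (All)
open import Data.Product using (Σ; ∃; _×_; _,_)
open import Data.Sum using (_⊎_)
open import Function.Definitions using (Bijective)
open import Relation.Binary.PropositionalEquality using (_≡_; _≢_)
open import Relation.Nullary using (Dec)
open import Relation.Nullary.Decidable using (_⊎-dec_)

-- The field F_{2^n}, modelled as F_2[x]/(p(x)) with p = x^n + r(x),
-- elements = coefficient vectors (c_0, ..., c_{n-1}) of polynomials of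
-- degree < n.  The vector r : Vec Bool n holds the low coefficients of p
-- (so x^n ≡ r(x) modulo p).  For irreducible p this is F_{2^n}.

oneVec : (m : ℕ) → Vec Bool m
oneVec zero = []
oneVec (suc m) = true ∷ replicate m false

module GF (n : ℕ) (r : Vec Bool n) where

  V : Set
  V = Vec Bool n

  infixl 6 _+_
  _+_ : V → V → V
  _+_ = zipWith _xor_

  𝟘 : V
  𝟘 = replicate n false

  _≟_ : (x y : V) → Dec (x ≡ y)
  _≟_ = ≡-dec _≟ᵇ_

  private
    shiftUp : ∀ {m} → Bool → Vec Bool m → Vec Bool m × Bool
    shiftUp c [] = [] , c
    shiftUp c (y ∷ ys) with shiftUp y ys
    ... | zs , t = (c ∷ zs) , t

  mulX : V → V
  mulX v with shiftUp false v
  ... | w , t = if t then w + r else w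

  private
    mulPoly : ∀ {m} → Vec Bool m → V → V
    mulPoly [] v = 𝟘
    mulPoly (b ∷ bs) v = (if b then v else 𝟘) + mulX (mulPoly bs v)

  infixl 7 _*_
  _*_ : V → V → V
  u * v = mulPoly u v

  𝟙 : V
  𝟙 = oneVec n

  Indep2 : V → V → Set
  Indep2 a b = a ≢ 𝟘 × b ≢ 𝟘 × a + b ≢ 𝟘

  Indep3 : V → V → V → Set
  Indep3 a b c = a ≢ 𝟘 × b ≢ 𝟘 × c ≢ 𝟘 × a + b ≢ 𝟘 × b + c ≢ 𝟘
               × c + a ≢ 𝟘 × a + b + c ≢ 𝟘

  InSpan : V → V → V → Set
  InSpan a b x = x ≡ 𝟘 ⊎ x ≡ a ⊎ x ≡ b ⊎ x ≡ a + b

  inSpan? : ∀ a b x → Dec (InSpan a b x)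
  inSpan? a b x = (x ≟ 𝟘) ⊎-dec ((x ≟ a) ⊎-dec ((x ≟ b) ⊎-dec (x ≟ (a + b))))

  SameSpan : V → V → V → V → Set
  SameSpan a b a' b' = ∀ x → (InSpan a b x → InSpan a' b' x) × (InSpan a' b' x → InSpan a b x)

  -- a triangle is presented by a triple (a,b,c) of independent vectors;
  -- it is the set {⟨a,b⟩, ⟨b,c⟩, ⟨c,a⟩}
  Triple : Set
  Triple = V × V × V

  SpanIn : V → V → Triple → Set
  SpanIn a' b' (a , b , c) = SameSpan a' b' a b ⊎ SameSpan a' b' b c ⊎ SameSpan a' b' c a

  SameTriangle : Triple → Triple → Set
  SameTriangle (a , b , c) (a' , b' , c') =
    (SpanIn a b (a' , b' , c') × SpanIn b c (a' , b' , c') × SpanIn c a (a' , b' , c')) ×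
    (SpanIn a' b' (a , b , c) × SpanIn b' c' (a , b , c) × SpanIn c' a' (a , b , c))

  Covers : Triple → V → Set
  Covers (a , b , c) x = InSpan a b x ⊎ InSpan b c x ⊎ InSpan c a x

  covers? : ∀ T x → Dec (Covers T x)
  covers? (a , b , c) x = inSpan? a b x ⊎-dec (inSpan? b c x ⊎-dec inSpan? c a x)

  -- every entry is a triangle and every 2-dimensional subspace lies in
  -- exactly one entry of the list (in particular the entries are distinct
  -- triangles, so the list is a set of triangles)
  IsTriangleDesign : List Triple → Set
  IsTriangleDesign L =
    All (λ { (a , b , c) → Indep3 a b c }) L ×
    (∀ a b → Indep2 a b →
       Σ (Fin (length L)) λ i → SpanIn a b (lookup L i) ×
         (∀ j → SpanIn a b (lookup L j) → j ≡ i))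

  coverCount : List Triple → V → ℕ
  coverCount L x = length (filter (λ T → covers? T x) L)

  IsBalanced : List Triple → Set
  IsBalanced L = ∃ λ k → ∀ x → x ≢ 𝟘 → coverCount L x ≡ k

  mapTriple : (V → V) → Triple → Triple
  mapTriple f (a , b , c) = f a , f b , f c

  Invariant : (V → V) → List Triple → Set
  Invariant f L =
    (∀ i → Σ (Fin (length L)) λ j → SameTriangle (mapTriple f (lookup L i)) (lookup L j)) ×
    (∀ j → Σ (Fin (length L)) λ i → SameTriangle (mapTriple f (lookup L i)) (lookup L j))

  IsFieldAut : (V → V) → Set
  IsFieldAut σ =
    (∀ x y → σ (x + y) ≡ σ x + σ y) ×
    (∀ x y → σ (x * y) ≡ σ x * σ y) ×
    σ 𝟙 ≡ 𝟙 ×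
    Bijective _≡_ _≡_ σ

  BalancedInvariantDesignExists : Set
  BalancedInvariantDesignExists =
    Σ (List Triple) λ L →
      IsTriangleDesign L ×
      IsBalanced L ×
      (∀ a → a ≢ 𝟘 → Invariant (a *_) L) ×
      (∀ σ → IsFieldAut σ → Invariant σ L)

-- Irreducible moduli: x^7+x+1, x^13+x^4+x^3+x+1, x^19+x^5+x^2+x+1
-- (given by their low coefficients c_0 ... c_{n-1})

r7 : Vec Bool 7
r7 = true ∷ true ∷ replicate 5 false

r13 : Vec Bool 13
r13 = true ∷ true ∷ false ∷ true ∷ true ∷ replicate 8 false

r19 : Vec Bool 19
r19 = true ∷ true ∷ true ∷ false ∷ false ∷ true ∷ replicate 13 false

{-# OPTIONS --safe #-}

-- Multiplication by scalars acts freely on the planes ⟨a,b⟩, and with Λ = ab(a+b) and Q = a² + ab + b² the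
-- orbit of ⟨a,b⟩ is determined by the class Q³/Λ² + 1, on which the Frobenius map φ acts by squaring. A design
-- invariant under scalars and φ thus amounts to a partition of the classes modulo φ into triples that are realised
-- by triangles ⟨1,u⟩, ⟨u,uv⟩, ⟨uv,1⟩, i.e. the classes of ⟨1,t⟩ for t = u, v, uv. Such triples are given explicitly.
-- For ⟨1,t⟩ and z = 1/(t² + t) the class is (t+z)² + (t+z), so the inverses z make it cheap to compute. The vector
-- of x-coefficients of c, φ c, φ² c, … is rotated when φ is applied to c, hence comparing all rotations shows that
-- all classes differ. Disjointness and a count then give existence: each plane c·⟨a,b⟩ of the design yields six
-- slopes b/a, pairwise distinct, and together with 0 and 1 they number 2ⁿ.
-- Balance follows since the scalars act transitively on the nonzero vectors, and every field automorphism is a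
-- power of φ because the modulus splits as ∏ (Y + φʲ x).

module Submission where

open import Defs
open import Algebra.Bundles using (CommutativeRing; RawRing)
import Algebra.Solver.Ring
open import Algebra.Solver.Ring.AlmostCommutativeRing
  using (AlmostCommutativeRing; fromCommutativeRing; _-Raw-AlmostCommutative⟶_)
open import Data.Bool using (Bool; true; false; _xor_; _∧_; not; if_then_else_)
open import Data.Bool.Properties as Boolₚ using () renaming (_≟_ to _≟ᵇ_)
open import Data.Fin as Fin using (Fin; zero; suc)
open import Data.Fin.Patterns using (0F; 1F; 2F)
open import Data.List as List
  using (List; []; _∷_; _++_; map; length; filter; cartesianProduct; concatMap; upTo; allFin)
open import Data.List.Membership.Propositional using (_∈_)
open import Data.List.Membership.Propositional.Properties
open import Data.List.Membership.Propositional.Properties.WithK using (unique∧set⇒bag)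
import Data.List.Properties as Listₚ
open import Data.List.Relation.Binary.BagAndSetEquality using (∼bag⇒↭)
open import Data.List.Relation.Binary.Permutation.Propositional using (_↭_)
open import Data.List.Relation.Binary.Permutation.Propositional.Properties using (↭-length; filter-↭)
open import Data.List.Relation.Unary.All as All using (All; []; _∷_)
import Data.List.Relation.Unary.All.Properties as Allₚ
open import Data.List.Relation.Unary.AllPairs using ([]; _∷_)
open import Data.List.Relation.Unary.Any as Any using (here; there)
open import Data.List.Relation.Unary.Any.Properties using (lookup-index)
open import Data.List.Relation.Unary.Unique.Propositional using (Unique)
import Data.List.Relation.Unary.Unique.Propositional.Properties as Uniqueₚ
open import Data.Maybe using (Maybe; nothing; just)
open import Data.Nat as ℕ using (ℕ; zero; suc; _≡ᵇ_; _/_; _%_)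
import Data.Nat.DivMod as ℕₚ
open import Data.Nat.GeneralisedArithmetic using (iterate)
import Data.Nat.Properties as ℕₚ
open import Data.Product using (Σ; ∃; ∃₂; _×_; _,_; proj₁; proj₂)
open import Data.Sum using (_⊎_; inj₁; inj₂; [_,_]′)
open import Data.Vec as Vec using (Vec; []; _∷_; _∷ʳ_; replicate; zipWith; tail; toList)
import Data.Vec.Properties as Vecₚ
open import Function using (_∘_; id; const; case_of_; mk⇔)
open import Relation.Binary.PropositionalEquality
  using (_≡_; _≢_; refl; sym; trans; cong; cong₂; subst; subst₂; isEquivalence; module ≡-Reasoning)
open import Relation.Nullary using (Dec; does; yes; no; contradiction)
open import Relation.Nullary.Decidable using (_×-dec_; ¬?)
open import Relation.Unary using (Pred; Decidable)

open ≡-Reasoning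

-- The numbers have to fit: the 2ⁿ - 2 slopes give (2ⁿ - 2)/6 classes, which must split into
-- φ-orbits of length n and these into triples, so 18n has to divide 2ⁿ - 2. For n = 7, 13, 19 the
-- quotients are 1, 35 and 1533, the numbers of base triangles. That planes of equal class lie in
-- one scalar orbit is never proved. Only the invariance of the class is used: different classes
-- mean different orbits, and counting does the rest. The form of the development is dictated by
-- evaluation during type checking: for n = 19 there are 87381 keys to compare. Hence addition and
-- multiplication have a second version made for evaluation, identities between linear maps are
-- tested on a basis, and distinctness is tested by splitting on bits. Irreducibility of the modulus
-- is not tested directly: the quotient ring is a field because v^(2ⁿ) = v holds in it and its only
-- idempotents are 0 and 1.

-- Vectors over 𝔽₂ and their linear maps.

infixl 6 _⊕_
-- At length n this unfolds to `_+_` of `GF`, so what is proved here for all lengths applies to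
-- field elements by conversion.
_⊕_ : ∀ {k} → Vec Bool k → Vec Bool k → Vec Bool k
_⊕_ = zipWith _xor_

𝟎 : ∀ {k} → Vec Bool k
𝟎 {k} = replicate k false

module _ {k : ℕ} where

  ⊕-assoc : (u v w : Vec Bool k) → (u ⊕ v) ⊕ w ≡ u ⊕ (v ⊕ w)
  ⊕-assoc = Vecₚ.zipWith-assoc Boolₚ.xor-assoc

  ⊕-comm : (u v : Vec Bool k) → u ⊕ v ≡ v ⊕ u
  ⊕-comm = Vecₚ.zipWith-comm Boolₚ.xor-comm

  ⊕-identityˡ : (v : Vec Bool k) → 𝟎 ⊕ v ≡ v
  ⊕-identityˡ = Vecₚ.zipWith-identityˡ Boolₚ.xor-identityˡ

  ⊕-identityʳ : (v : Vec Bool k) → v ⊕ 𝟎 ≡ v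
  ⊕-identityʳ = Vecₚ.zipWith-identityʳ Boolₚ.xor-identityʳ

⊕-self : ∀ {k} (v : Vec Bool k) → v ⊕ v ≡ 𝟎
⊕-self []      = refl
⊕-self (b ∷ v) = cong₂ _∷_ (Boolₚ.xor-same b) (⊕-self v)

⊕-interchange : ∀ {k} (u v w x : Vec Bool k) → (u ⊕ v) ⊕ (w ⊕ x) ≡ (u ⊕ w) ⊕ (v ⊕ x)
⊕-interchange u v w x = begin
  (u ⊕ v) ⊕ (w ⊕ x)  ≡⟨ ⊕-assoc u v (w ⊕ x) ⟩
  u ⊕ (v ⊕ (w ⊕ x))  ≡⟨ cong (u ⊕_) (⊕-assoc v w x) ⟨
  u ⊕ ((v ⊕ w) ⊕ x)  ≡⟨ cong (λ z → u ⊕ (z ⊕ x)) (⊕-comm v w) ⟩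
  u ⊕ ((w ⊕ v) ⊕ x)  ≡⟨ cong (u ⊕_) (⊕-assoc w v x) ⟩
  u ⊕ (w ⊕ (v ⊕ x))  ≡⟨ ⊕-assoc u w (v ⊕ x) ⟨
  (u ⊕ w) ⊕ (v ⊕ x)  ∎

⊕-cancel : ∀ {k} (u v : Vec Bool k) → u ⊕ v ≡ 𝟎 → u ≡ v
⊕-cancel u v eq = begin
  u            ≡⟨ ⊕-identityʳ u ⟨
  u ⊕ 𝟎        ≡⟨ cong (u ⊕_) (⊕-self v) ⟨
  u ⊕ (v ⊕ v)  ≡⟨ ⊕-assoc u v v ⟨
  (u ⊕ v) ⊕ v  ≡⟨ cong (_⊕ v) eq ⟩
  𝟎 ⊕ v        ≡⟨ ⊕-identityˡ v ⟩
  v            ∎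

-- Over 𝔽₂ the additive maps are exactly the linear ones.
Additive : ∀ {k l} → (Vec Bool k → Vec Bool l) → Set
Additive f = ∀ u v → f (u ⊕ v) ≡ f u ⊕ f v

additive-𝟎 : ∀ {k l} {f : Vec Bool k → Vec Bool l} → Additive f → f 𝟎 ≡ 𝟎
additive-𝟎 {f = f} f-+ = begin
  f 𝟎          ≡⟨ cong f (⊕-self 𝟎) ⟨
  f (𝟎 ⊕ 𝟎)    ≡⟨ f-+ 𝟎 𝟎 ⟩
  f 𝟎 ⊕ f 𝟎    ≡⟨ ⊕-self (f 𝟎) ⟩
  𝟎            ∎

∘-additive : ∀ {k l m} {f : Vec Bool l → Vec Bool m} {g : Vec Bool k → Vec Bool l} →
             Additive f → Additive g → Additive (f ∘ g)
∘-additive {f = f} f-+ g-+ u v = trans (cong f (g-+ u v)) (f-+ _ _)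

∷-additive : ∀ {k} → Additive {k} (false ∷_)
∷-additive u v = refl

-- Matching on the left bit first makes this much cheaper to evaluate than zipWith _xor_.
infixl 6 _⊞_
_⊞_ : ∀ {k} → Vec Bool k → Vec Bool k → Vec Bool k
[]          ⊞ []      = []
(false ∷ u) ⊞ (b ∷ v) = b ∷ (u ⊞ v)
(true ∷ u)  ⊞ (b ∷ v) = not b ∷ (u ⊞ v)

⊞-⊕ : ∀ {k} (u v : Vec Bool k) → u ⊞ v ≡ u ⊕ v
⊞-⊕ []          []      = refl
⊞-⊕ (false ∷ u) (b ∷ v) = cong (b ∷_) (⊞-⊕ u v)
⊞-⊕ (true ∷ u)  (b ∷ v) = cong (not b ∷_) (⊞-⊕ u v)

-- For a linear map this is its matrix, and `combine` is the product of a vector with a matrix.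
columns : ∀ {a} {A : Set a} {k} → (Vec Bool k → A) → Vec A k
columns {k = zero}  f = []
columns {k = suc k} f = f (true ∷ 𝟎) ∷ columns (f ∘ (false ∷_))

combine : ∀ {k l} → Vec Bool k → Vec (Vec Bool l) k → Vec Bool l
combine []          []       = 𝟎
combine (true ∷ v)  (c ∷ cs) = c ⊞ combine v cs
combine (false ∷ v) (c ∷ cs) = combine v cs

combine-columns : ∀ {k l} {f : Vec Bool k → Vec Bool l} → Additive f →
                  ∀ v → combine v (columns f) ≡ f v
combine-columns f-+ []          = sym (additive-𝟎 f-+)
combine-columns f-+ (false ∷ v) = combine-columns (∘-additive f-+ ∷-additive) v
combine-columns {f = f} f-+ (true ∷ v) = begin
  f (true ∷ 𝟎) ⊞ combine v (columns (f ∘ (false ∷_)))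
    ≡⟨ ⊞-⊕ (f (true ∷ 𝟎)) _ ⟩
  f (true ∷ 𝟎) ⊕ combine v (columns (f ∘ (false ∷_)))
    ≡⟨ cong (f (true ∷ 𝟎) ⊕_) (combine-columns (∘-additive f-+ ∷-additive) v) ⟩
  f (true ∷ 𝟎) ⊕ f (false ∷ v)
    ≡⟨ f-+ (true ∷ 𝟎) (false ∷ v) ⟨
  f (true ∷ 𝟎 ⊕ v)
    ≡⟨ cong (f ∘ (true ∷_)) (⊕-identityˡ v) ⟩
  f (true ∷ v) ∎

-- Reduces an identity on 2ᵏ vectors to k equations that evaluation can decide. The checks
-- `unit-spec`, `frob-spec` and `trace-spec` are exploited through it.
columns-injective : ∀ {k l} {f g : Vec Bool k → Vec Bool l} → Additive f → Additive g →
                    columns f ≡ columns g → ∀ v → f v ≡ g v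
columns-injective {f = f} {g} f-+ g-+ eq v = begin
  f v                    ≡⟨ combine-columns f-+ v ⟨
  combine v (columns f)  ≡⟨ cong (combine v) eq ⟩
  combine v (columns g)  ≡⟨ combine-columns g-+ v ⟩
  g v                    ∎

-- Multiplication by x before reduction, and multiplication by bits.

-- `shift` and `top` are the two components of the private `shiftUp` of `GF`: the shifted
-- coefficients, and the coefficient that overflows.
shift : ∀ {k} → Bool → Vec Bool k → Vec Bool k
shift c []      = []
shift c (b ∷ v) = c ∷ shift b v

top : ∀ {k} → Bool → Vec Bool k → Bool
top c []      = c
top c (b ∷ v) = top b v

shift-xor : ∀ {k} c d (u v : Vec Bool k) → shift (c xor d) (u ⊕ v) ≡ shift c u ⊕ shift d v
shift-xor c d []      []      = refl
shift-xor c d (a ∷ u) (b ∷ v) = cong (_ ∷_) (shift-xor a b u v)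

top-xor : ∀ {k} c d (u v : Vec Bool k) → top (c xor d) (u ⊕ v) ≡ top c u xor top d v
top-xor c d []      []      = refl
top-xor c d (a ∷ u) (b ∷ v) = top-xor a b u v

infixr 7 _·_
_·_ : ∀ {k} → Bool → Vec Bool k → Vec Bool k
b · v = if b then v else 𝟎

·-xor : ∀ {k} b c (v : Vec Bool k) → (b xor c) · v ≡ b · v ⊕ c · v
·-xor false c     v = sym (⊕-identityˡ (c · v))
·-xor true  false v = sym (⊕-identityʳ v)
·-xor true  true  v = sym (⊕-self v)

·-⊕ : ∀ {k} b (u v : Vec Bool k) → b · (u ⊕ v) ≡ b · u ⊕ b · v
·-⊕ true  u v = refl
·-⊕ false u v = sym (⊕-self 𝟎)

additive-· : ∀ {k l} {f : Vec Bool k → Vec Bool l} → Additive f → ∀ b v → f (b · v) ≡ b · f v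
additive-· f-+ true  v = refl
additive-· f-+ false v = additive-𝟎 f-+

-- Lists without repetitions.

iterate-map : ∀ {a} {A : Set a} (f : A → A) x n →
              List.iterate f x n ≡ List.map (iterate f x) (List.upTo n)
iterate-map f x n = trans (go x n) (sym (Listₚ.map-upTo (iterate f x) n))
  where
  go : ∀ x n → List.iterate f x n ≡ List.applyUpTo (iterate f x) n
  go x zero    = refl
  go x (suc n) = cong (x ∷_) (go (f x) n)

module _ {a b} {A : Set a} {B : Set b} where

  unique-map-injective : ∀ {f : A → B} {xs} → Unique (map f xs) →
                         ∀ {x y} → x ∈ xs → y ∈ xs → f x ≡ f y → x ≡ y
  unique-map-injective (_ ∷ _)   (here refl) (here refl) eq = refl
  unique-map-injective (f≢ ∷ _)  (here refl) (there y∈)  eq = contradiction eq (All.lookup f≢ (∈-map⁺ _ y∈))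
  unique-map-injective (f≢ ∷ _)  (there x∈)  (here refl) eq = contradiction (sym eq) (All.lookup f≢ (∈-map⁺ _ x∈))
  unique-map-injective (_ ∷ f!)  (there x∈)  (there y∈)  eq = unique-map-injective f! x∈ y∈ eq

  unique-map : ∀ {f : A → B} {xs} → (∀ {x y} → x ∈ xs → y ∈ xs → f x ≡ f y → x ≡ y) →
               Unique xs → Unique (map f xs)
  unique-map f-inj []         = []
  unique-map f-inj (x∉ ∷ xs!) =
    Allₚ.map⁺ (All.tabulate λ y∈ eq → All.lookup x∉ y∈ (f-inj (here refl) (there y∈) eq))
    ∷ unique-map (λ x∈ y∈ → f-inj (there x∈) (there y∈)) xs!

  map-cartesianProduct : ∀ {c} {C : Set c} (f : A × B → C) xs ys →
    map f (cartesianProduct xs ys) ≡ concatMap (λ x → map (λ y → f (x , y)) ys) xs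
  map-cartesianProduct f []       ys = refl
  map-cartesianProduct f (x ∷ xs) ys = begin
    map f (map (x ,_) ys ++ cartesianProduct xs ys)
      ≡⟨ Listₚ.map-++ f (map (x ,_) ys) _ ⟩
    map f (map (x ,_) ys) ++ map f (cartesianProduct xs ys)
      ≡⟨ cong₂ _++_ (sym (Listₚ.map-∘ ys)) (map-cartesianProduct f xs ys) ⟩
    concatMap (λ x → map (λ y → f (x , y)) ys) (x ∷ xs) ∎

  length-cartesianProduct : ∀ (xs : List A) (ys : List B) →
    length (cartesianProduct xs ys) ≡ length xs ℕ.* length ys
  length-cartesianProduct []       ys = refl
  length-cartesianProduct (x ∷ xs) ys = begin
    length (map (x ,_) ys ++ cartesianProduct xs ys)
      ≡⟨ Listₚ.length-++ (map (x ,_) ys) ⟩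
    length (map (x ,_) ys) ℕ.+ length (cartesianProduct xs ys)
      ≡⟨ cong₂ ℕ._+_ (Listₚ.length-map (x ,_) ys) (length-cartesianProduct xs ys) ⟩
    length ys ℕ.+ length xs ℕ.* length ys ∎

length-filter-map : ∀ {a b p q} {A : Set a} {B : Set b} {P : Pred B p} {Q : Pred A q}
                    (P? : Decidable P) (Q? : Decidable Q) {f : A → B} →
                    (∀ {x} → P (f x) → Q x) → (∀ {x} → Q x → P (f x)) →
                    ∀ xs → length (filter P? (map f xs)) ≡ length (filter Q? xs)
length-filter-map P? Q?     P⇒Q Q⇒P []       = refl
length-filter-map P? Q? {f} P⇒Q Q⇒P (x ∷ xs) with P? (f x) | Q? x
... | yes _ | yes _ = cong suc (length-filter-map P? Q? P⇒Q Q⇒P xs)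
... | no _  | no _  = length-filter-map P? Q? P⇒Q Q⇒P xs
... | yes p | no ¬q = contradiction (P⇒Q p) ¬q
... | no ¬p | yes q = contradiction (Q⇒P q) ¬p

unique-++⁻ : ∀ {a} {A : Set a} (xs : List A) {ys} → Unique (xs ++ ys) →
             Unique ys × (∀ {x y} → x ∈ xs → y ∈ ys → x ≢ y)
unique-++⁻ []       u         = u , λ ()
unique-++⁻ (x ∷ xs) (x∉ ∷ u) =
  let ys! , disjoint = unique-++⁻ xs u
  in ys! , λ { (here refl) y∈ refl → All.lookup x∉ (∈-++⁺ʳ xs y∈) refl
             ; (there x∈)  y∈ eq   → disjoint x∈ y∈ eq }

-- Serves to read off the distinctness of the base triangles from that of the classes, which are
-- indexed by a product.
unique-cartesianProduct⁻ : ∀ {a b} {A : Set a} {B : Set b} {y : B} {ys} → y ∈ ys →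
                           (xs : List A) → Unique (cartesianProduct xs ys) → Unique xs
unique-cartesianProduct⁻ y∈ []       _ = []
unique-cartesianProduct⁻ {ys = ys} y∈ (x ∷ xs) u =
  let u′ , disjoint = unique-++⁻ (map (x ,_) ys) u
  in All.tabulate (λ { x∈ refl → disjoint (∈-map⁺ (x ,_) y∈) (∈-cartesianProduct⁺ x∈ y∈) refl })
     ∷ unique-cartesianProduct⁻ y∈ xs u′

unique⇒lookup-injective : ∀ {a} {A : Set a} {xs : List A} → Unique xs →
                          ∀ i j → List.lookup xs i ≡ List.lookup xs j → i ≡ j
unique⇒lookup-injective (_ ∷ _)  zero    zero    eq = refl
unique⇒lookup-injective (x∉ ∷ _) zero    (suc j) eq = contradiction eq (All.lookup x∉ (∈-lookup j))
unique⇒lookup-injective (x∉ ∷ _) (suc i) zero    eq = contradiction (sym eq) (All.lookup x∉ (∈-lookup i))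
unique⇒lookup-injective (_ ∷ u)  (suc i) (suc j) eq = cong suc (unique⇒lookup-injective u i j eq)

-- Comparing and counting bit vectors by their leading bit.

tails : ∀ {k} → Bool → List (Vec Bool (suc k)) → List (Vec Bool k)
tails b     []                 = []
tails false ((false ∷ v) ∷ vs) = v ∷ tails false vs
tails false ((true ∷ v) ∷ vs)  = tails false vs
tails true  ((false ∷ v) ∷ vs) = tails true vs
tails true  ((true ∷ v) ∷ vs)  = v ∷ tails true vs

∈-tails : ∀ {k} {b} {v : Vec Bool k} {vs} → (b ∷ v) ∈ vs → v ∈ tails b vs
∈-tails {b = false} {vs = (false ∷ _) ∷ _} (here refl) = here refl
∈-tails {b = false} {vs = (false ∷ _) ∷ _} (there v∈)  = there (∈-tails v∈)
∈-tails {b = false} {vs = (true ∷ _) ∷ _}  (there v∈)  = ∈-tails v∈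
∈-tails {b = true}  {vs = (false ∷ _) ∷ _} (there v∈)  = ∈-tails v∈
∈-tails {b = true}  {vs = (true ∷ _) ∷ _}  (here refl) = here refl
∈-tails {b = true}  {vs = (true ∷ _) ∷ _}  (there v∈)  = there (∈-tails v∈)

∈-tails⁻ : ∀ {k} b {v : Vec Bool k} {vs} → v ∈ tails b vs → (b ∷ v) ∈ vs
∈-tails⁻ false {vs = (false ∷ _) ∷ _} (here refl) = here refl
∈-tails⁻ false {vs = (false ∷ _) ∷ _} (there v∈)  = there (∈-tails⁻ false v∈)
∈-tails⁻ false {vs = (true ∷ _) ∷ _}  v∈          = there (∈-tails⁻ false v∈)
∈-tails⁻ true  {vs = (false ∷ _) ∷ _} v∈          = there (∈-tails⁻ true v∈)
∈-tails⁻ true  {vs = (true ∷ _) ∷ _}  (here refl) = here refl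
∈-tails⁻ true  {vs = (true ∷ _) ∷ _}  (there v∈)  = there (∈-tails⁻ true v∈)

-- Pairwise comparison would be quadratic in the number of keys. Splitting by the leading bit, as in
-- a radix sort, costs about one pass over the list for each bit; at length 0 all vectors coincide,
-- so at most one may remain.
distinct : ∀ {k} → List (Vec Bool k) → Bool
distinct         []          = true
distinct {zero}  (_ ∷ [])    = true
distinct {zero}  (_ ∷ _ ∷ _) = false
distinct {suc k} (v ∷ vs)    = distinct (tails false (v ∷ vs)) ∧ distinct (tails true (v ∷ vs))

unique-tails⁻ : ∀ {k} (vs : List (Vec Bool (suc k))) →
                Unique (tails false vs) → Unique (tails true vs) → Unique vs
unique-tails⁻ []                 _         _         = []
unique-tails⁻ ((false ∷ v) ∷ vs) (v∉ ∷ f!) t!        =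
  All.tabulate (λ { w∈ refl → All.lookup v∉ (∈-tails w∈) refl }) ∷ unique-tails⁻ vs f! t!
unique-tails⁻ ((true ∷ v) ∷ vs)  f!        (v∉ ∷ t!) =
  All.tabulate (λ { w∈ refl → All.lookup v∉ (∈-tails w∈) refl }) ∷ unique-tails⁻ vs f! t!

distinct⇒unique : ∀ {k} (vs : List (Vec Bool k)) → distinct vs ≡ true → Unique vs
distinct⇒unique         []        _  = []
distinct⇒unique {zero}  (v ∷ [])  _  = [] ∷ []
distinct⇒unique {suc k} (v ∷ vs)  eq =
  unique-tails⁻ (v ∷ vs) (distinct⇒unique _ (Boolₚ.∧-conicalˡ _ _ eq)) (distinct⇒unique _ (Boolₚ.∧-conicalʳ _ _ eq))

unique-tails⁺ : ∀ {k} b (vs : List (Vec Bool (suc k))) → Unique vs → Unique (tails b vs)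
unique-tails⁺ b     []                 _         = []
unique-tails⁺ false ((false ∷ v) ∷ vs) (v∉ ∷ u) =
  All.tabulate (λ { w∈ refl → All.lookup v∉ (∈-tails⁻ false w∈) refl }) ∷ unique-tails⁺ false vs u
unique-tails⁺ false ((true ∷ v) ∷ vs)  (_ ∷ u)  = unique-tails⁺ false vs u
unique-tails⁺ true  ((false ∷ v) ∷ vs) (_ ∷ u)  = unique-tails⁺ true vs u
unique-tails⁺ true  ((true ∷ v) ∷ vs)  (v∉ ∷ u) =
  All.tabulate (λ { w∈ refl → All.lookup v∉ (∈-tails⁻ true w∈) refl }) ∷ unique-tails⁺ true vs u

length-tails : ∀ {k} (vs : List (Vec Bool (suc k))) →
               length vs ≡ length (tails false vs) ℕ.+ length (tails true vs)
length-tails []                 = refl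
length-tails ((false ∷ v) ∷ vs) = cong suc (length-tails vs)
length-tails ((true ∷ v) ∷ vs)  = trans (cong suc (length-tails vs)) (sym (ℕₚ.+-suc _ _))

-- The pigeonhole principle by induction on the length: the vectors with a given leading bit have
-- distinct tails, so each half has at most 2ᵏ elements.
unique⇒length≤ : ∀ {k} (vs : List (Vec Bool k)) → Unique vs → length vs ℕ.≤ 2 ℕ.^ k
unique⇒length≤         []             _               = ℕ.z≤n
unique⇒length≤ {zero}  (v ∷ [])       _               = ℕₚ.≤-refl
unique⇒length≤ {zero}  ([] ∷ [] ∷ vs) ((v≢ ∷ _) ∷ _)  = contradiction refl v≢
unique⇒length≤ {suc k} vs@(_ ∷ _)     u               = ℕₚ.≤-trans
  (ℕₚ.≤-reflexive (length-tails vs))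
  (ℕₚ.+-mono-≤ (half false) (ℕₚ.≤-trans (half true) (ℕₚ.≤-reflexive (sym (ℕₚ.+-identityʳ (2 ℕ.^ k))))))
  where
  half : ∀ b → length (tails b vs) ℕ.≤ 2 ℕ.^ k
  half b = unique⇒length≤ (tails b vs) (unique-tails⁺ b vs u)

-- If `v` were missing, `v ∷ vs` would consist of 2ᵏ + 1 distinct vectors. This takes the place of a
-- search for the triangle that contains a given plane.
unique⇒complete : ∀ {k} {vs : List (Vec Bool k)} → Unique vs → length vs ≡ 2 ℕ.^ k → ∀ v → v ∈ vs
unique⇒complete {vs = vs} u len v with Any.any? (Vecₚ.≡-dec _≟ᵇ_ v) vs
... | yes v∈ = v∈
... | no  v∉ = contradiction
  (ℕₚ.≤-trans (unique⇒length≤ (v ∷ vs) (Allₚ.¬Any⇒All¬ vs v∉ ∷ u)) (ℕₚ.≤-reflexive (sym len))) ℕₚ.1+n≰n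

allVecs : ∀ k → List (Vec Bool k)
allVecs zero    = [] ∷ []
allVecs (suc k) = map (false ∷_) (allVecs k) ++ map (true ∷_) (allVecs k)

∈-allVecs : ∀ {k} (v : Vec Bool k) → v ∈ allVecs k
∈-allVecs []          = here refl
∈-allVecs (false ∷ v) = ∈-++⁺ˡ (∈-map⁺ (false ∷_) (∈-allVecs v))
∈-allVecs (true ∷ v)  = ∈-++⁺ʳ _ (∈-map⁺ (true ∷_) (∈-allVecs v))

allVecs-unique : ∀ k → Unique (allVecs k)
allVecs-unique zero    = [] ∷ []
allVecs-unique (suc k) = Uniqueₚ.++⁺
  (Uniqueₚ.map⁺ Vecₚ.∷-injectiveʳ (allVecs-unique k))
  (Uniqueₚ.map⁺ Vecₚ.∷-injectiveʳ (allVecs-unique k))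
  λ (v∈f , v∈t) → case ∈-map⁻ _ v∈f , ∈-map⁻ _ v∈t of λ { ((_ , _ , refl) , (_ , _ , ())) }

rotate : ∀ {a} {A : Set a} {k} → Vec A k → Vec A k
rotate []      = []
rotate (x ∷ v) = v ∷ʳ x

-- The quotient ring 𝔽₂[x]/(p) and the facts about it left to evaluation.

module Field (h : ℕ) (r : Vec Bool (3 ℕ.+ h ℕ.* 2)) where

  -- The form 3 + 2h makes oddness available by computation: `φ-fixed` needs it to see that a fixed
  -- element is its own trace.
  n : ℕ
  n = 3 ℕ.+ h ℕ.* 2

  open GF n r

  -- `timesX` and `horner` restate `mulX` and the private `mulPoly` in a form suited to induction,
  -- with a first factor of any length. The fields `mulX-spec` and `mul-spec` record the agreement.
  timesX : V → V
  timesX v = if top false v then shift false v ⊕ r else shift false v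

  horner : ∀ {k} → Vec Bool k → V → V
  horner []       v = 𝟘
  horner (b ∷ bs) v = b · v + mulX (horner bs v)

  timesX⁺ : V → V
  timesX⁺ v = if top false v then r ⊞ shift false v else shift false v

  -- Shift-and-add multiplication: at the i-th bit the second argument has become xⁱ·v, and the
  -- accumulator holds the sum over the bits already read. Additions are made for set bits only.
  mulAcc : ∀ {k} → Vec Bool k → V → V → V
  mulAcc []           v a = a
  mulAcc (false ∷ bs) v a = mulAcc bs (timesX⁺ v) a
  mulAcc (true ∷ bs)  v a = mulAcc bs (timesX⁺ v) (v ⊞ a)

  infixl 7 _⊛_
  _⊛_ : V → V → V
  u ⊛ v = mulAcc u v 𝟘

  φ : V → V
  φ v = v ⊛ v

  frob : ℕ → V → V
  frob j v = iterate φ v j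

  -- The sum v + v² + v⁴ + ... with k terms; for k = n it is the absolute trace.
  trace : ℕ → V → V
  trace zero    v = 𝟘
  trace (suc k) v = v + trace k (φ v)

  X : V
  X = mulX 𝟙

  poly : ∀ {k} → Vec Bool k → V → V
  poly []       y = 𝟘
  poly (b ∷ bs) y = b · 𝟙 + y * poly bs y

  polyⱽ : List V → V → V
  polyⱽ []       y = 𝟘
  polyⱽ (c ∷ cs) y = c + y * polyⱽ cs y

  -- the coefficients of d + (Y + c) · p(Y), lowest first
  timesLinear : V → V → List V → List V
  timesLinear c d []       = d ∷ []
  timesLinear c d (p ∷ ps) = (d + c ⊛ p) ∷ timesLinear c p ps

  fromRoots : List V → List V
  fromRoots []       = 𝟙 ∷ []
  fromRoots (c ∷ cs) = timesLinear c 𝟘 (fromRoots cs)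

  -- `frob-spec` and `trace-spec` are what makes the ring a field, by way of `*-inverseʳ`.
  -- `root-spec` and `split-spec` say that X is a root of the modulus and that its conjugates are
  -- all the roots; they serve to determine the automorphisms.
  record FieldChecks : Set where
    field
      mulX-spec  : ∀ v → mulX v ≡ timesX v
      mul-spec   : ∀ u v → u * v ≡ horner u v
      unit-spec  : columns (_* 𝟙) ≡ columns id
      frob-spec  : columns (frob n) ≡ columns id
      trace-spec : columns (tail ∘ trace n) ≡ columns (const 𝟎)
      root-spec  : poly (r ∷ʳ true) X ≡ 𝟘
      split-spec : fromRoots (List.iterate φ X n) ≡ List.map (_· 𝟙) (toList (r ∷ʳ true))

  -- Ring laws.

  module Laws (fc : FieldChecks) where
    open FieldChecks fc

    timesX-additive : Additive timesX
    timesX-additive u v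
      rewrite shift-xor false false u v | top-xor false false u v
      with top false u | top false v
    ... | false | false = refl
    ... | false | true  = ⊕-assoc (shift false u) (shift false v) r
    ... | true  | false = begin
      (shift false u ⊕ shift false v) ⊕ r  ≡⟨ ⊕-assoc (shift false u) (shift false v) r ⟩
      shift false u ⊕ (shift false v ⊕ r)  ≡⟨ cong (shift false u ⊕_) (⊕-comm (shift false v) r) ⟩
      shift false u ⊕ (r ⊕ shift false v)  ≡⟨ ⊕-assoc (shift false u) r (shift false v) ⟨
      (shift false u ⊕ r) ⊕ shift false v  ∎
    -- Both summands overflow, so their sum does not; the two copies of `r` cancel.
    ... | true  | true  = begin
      shift false u ⊕ shift false v              ≡⟨ ⊕-identityʳ _ ⟨
      (shift false u ⊕ shift false v) ⊕ 𝟘        ≡⟨ cong ((shift false u ⊕ shift false v) ⊕_) (⊕-self r) ⟨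
      (shift false u ⊕ shift false v) ⊕ (r ⊕ r)  ≡⟨ ⊕-interchange (shift false u) (shift false v) r r ⟩
      (shift false u ⊕ r) ⊕ (shift false v ⊕ r)  ∎

    mulX-additive : Additive mulX
    mulX-additive u v
      rewrite mulX-spec (u + v) | mulX-spec u | mulX-spec v = timesX-additive u v

    horner-additiveʳ : ∀ {k} (bs : Vec Bool k) → Additive (horner bs)
    horner-additiveʳ []       u v = sym (⊕-self 𝟘)
    horner-additiveʳ (b ∷ bs) u v = begin
      b · (u + v) + mulX (horner bs (u + v))
        ≡⟨ cong₂ _+_ (·-⊕ b u v) (trans (cong mulX (horner-additiveʳ bs u v)) (mulX-additive (horner bs u) (horner bs v))) ⟩
      (b · u + b · v) + (mulX (horner bs u) + mulX (horner bs v))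
        ≡⟨ ⊕-interchange (b · u) (b · v) _ _ ⟩
      (b · u + mulX (horner bs u)) + (b · v + mulX (horner bs v)) ∎

    horner-mulX : ∀ {k} (bs : Vec Bool k) v → horner bs (mulX v) ≡ mulX (horner bs v)
    horner-mulX []       v = sym (additive-𝟎 mulX-additive)
    horner-mulX (b ∷ bs) v = begin
      b · mulX v + mulX (horner bs (mulX v))
        ≡⟨ cong₂ _+_ (sym (additive-· mulX-additive b v)) (cong mulX (horner-mulX bs v)) ⟩
      mulX (b · v) + mulX (mulX (horner bs v))
        ≡⟨ mulX-additive (b · v) (mulX (horner bs v)) ⟨
      mulX (b · v + mulX (horner bs v)) ∎

    -- Both operators are polynomials in the single operator `mulX`, so they commute. Commutativity
    -- and associativity of `*` both follow from this.
    horner-comm : ∀ {k l} (bs : Vec Bool k) (cs : Vec Bool l) v →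
                  horner bs (horner cs v) ≡ horner cs (horner bs v)
    horner-comm []       cs v = sym (additive-𝟎 (horner-additiveʳ cs))
    horner-comm (b ∷ bs) cs v = begin
      b · horner cs v + mulX (horner bs (horner cs v))
        ≡⟨ cong₂ _+_ (sym (additive-· (horner-additiveʳ cs) b v))
                     (trans (cong mulX (horner-comm bs cs v)) (sym (horner-mulX cs _))) ⟩
      horner cs (b · v) + horner cs (mulX (horner bs v))
        ≡⟨ horner-additiveʳ cs _ _ ⟨
      horner cs (b · v + mulX (horner bs v)) ∎

    horner-𝟙-additive : ∀ {k} → Additive {k} (λ bs → horner bs 𝟙)
    horner-𝟙-additive []       []       = sym (⊕-self 𝟘)
    horner-𝟙-additive (b ∷ bs) (c ∷ cs) = begin
      (b xor c) · 𝟙 + mulX (horner (bs ⊕ cs) 𝟙)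
        ≡⟨ cong₂ _+_ (·-xor b c 𝟙) (trans (cong mulX (horner-𝟙-additive bs cs)) (mulX-additive (horner bs 𝟙) (horner cs 𝟙))) ⟩
      (b · 𝟙 + c · 𝟙) + (mulX (horner bs 𝟙) + mulX (horner cs 𝟙))
        ≡⟨ ⊕-interchange (b · 𝟙) (c · 𝟙) _ _ ⟩
      (b · 𝟙 + mulX (horner bs 𝟙)) + (c · 𝟙 + mulX (horner cs 𝟙)) ∎

    -- This says Σ vᵢ xⁱ = v. Both sides are linear in `v`, so the unit vectors decide.
    *-identityʳ : ∀ v → v * 𝟙 ≡ v
    *-identityʳ = columns-injective
      (λ u v → trans (mul-spec (u + v) 𝟙)
        (trans (horner-𝟙-additive u v) (sym (cong₂ _+_ (mul-spec u 𝟙) (mul-spec v 𝟙)))))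
      (λ u v → refl) unit-spec

    horner-𝟙 : ∀ v → horner v 𝟙 ≡ v
    horner-𝟙 v = trans (sym (mul-spec v 𝟙)) (*-identityʳ v)

    *-comm : ∀ u v → u * v ≡ v * u
    *-comm u v = begin
      u * v                  ≡⟨ mul-spec u v ⟩
      horner u v             ≡⟨ cong (horner u) (horner-𝟙 v) ⟨
      horner u (horner v 𝟙)  ≡⟨ horner-comm u v 𝟙 ⟩
      horner v (horner u 𝟙)  ≡⟨ cong (horner v) (horner-𝟙 u) ⟩
      horner v u             ≡⟨ mul-spec v u ⟨
      v * u                  ∎

    *-assoc : ∀ u v w → (u * v) * w ≡ u * (v * w)
    *-assoc u v w = begin
      (u * v) * w            ≡⟨ *-comm (u * v) w ⟩
      w * (u * v)            ≡⟨ trans (mul-spec w (u * v)) (cong (horner w) (mul-spec u v)) ⟩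
      horner w (horner u v)  ≡⟨ horner-comm w u v ⟩
      horner u (horner w v)  ≡⟨ trans (mul-spec u (w * v)) (cong (horner u) (mul-spec w v)) ⟨
      u * (w * v)            ≡⟨ cong (u *_) (*-comm w v) ⟩
      u * (v * w)            ∎

    *-distribˡ-+ : ∀ u v w → u * (v + w) ≡ u * v + u * w
    *-distribˡ-+ u v w = begin
      u * (v + w)              ≡⟨ mul-spec u (v + w) ⟩
      horner u (v + w)         ≡⟨ horner-additiveʳ u v w ⟩
      horner u v + horner u w  ≡⟨ cong₂ _+_ (mul-spec u v) (mul-spec u w) ⟨
      u * v + u * w            ∎

    *-distribʳ-+ : ∀ w u v → (u + v) * w ≡ u * w + v * w
    *-distribʳ-+ w u v = begin
      (u + v) * w    ≡⟨ *-comm (u + v) w ⟩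
      w * (u + v)    ≡⟨ *-distribˡ-+ w u v ⟩
      w * u + w * v  ≡⟨ cong₂ _+_ (*-comm w u) (*-comm w v) ⟩
      u * w + v * w  ∎

    +-*-commutativeRing : CommutativeRing _ _
    +-*-commutativeRing = record
      { Carrier = V ; _≈_ = _≡_ ; _+_ = _+_ ; _*_ = _*_ ; -_ = id ; 0# = 𝟘 ; 1# = 𝟙
      ; isCommutativeRing = record
        { isRing = record
          { +-isAbelianGroup = record
            { isGroup = record
              { isMonoid = record
                { isSemigroup = record
                  { isMagma = record { isEquivalence = isEquivalence ; ∙-cong = cong₂ _+_ }
                  ; assoc = ⊕-assoc }
                ; identity = ⊕-identityˡ , ⊕-identityʳ }
              ; inverse = ⊕-self , ⊕-self
              ; ⁻¹-cong = id }
            ; comm = ⊕-comm }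
          ; *-cong = cong₂ _*_
          ; *-assoc = *-assoc
          ; *-identity = (λ v → trans (*-comm 𝟙 v) (*-identityʳ v)) , *-identityʳ
          ; distrib = *-distribˡ-+ , *-distribʳ-+ }
        ; *-comm = *-comm } }

    private
      𝔽₂ : RawRing _ _
      𝔽₂ = record { Carrier = Bool ; _≈_ = _≡_ ; _+_ = _xor_ ; _*_ = _∧_ ; -_ = id ; 0# = false ; 1# = true }

      almostRing : AlmostCommutativeRing _ _
      almostRing = fromCommutativeRing +-*-commutativeRing

      𝔽₂⟶V : 𝔽₂ -Raw-AlmostCommutative⟶ almostRing
      𝔽₂⟶V = record
        { ⟦_⟧ = _· 𝟙
        ; +-homo = λ b c → ·-xor b c 𝟙
        ; *-homo = λ { true c → sym (CommutativeRing.*-identityˡ +-*-commutativeRing (c · 𝟙))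
                     ; false c → sym (CommutativeRing.zeroˡ +-*-commutativeRing (c · 𝟙)) }
        ; -‿homo = λ _ → refl
        ; 0-homo = refl
        ; 1-homo = refl }

      coeff≟ : ∀ b c → Maybe (b · 𝟙 ≡ c · 𝟙)
      coeff≟ true  true  = just refl
      coeff≟ false false = just refl
      coeff≟ _     _     = nothing

    -- With coefficients in 𝔽₂ the solver proves identities that hold only in characteristic 2.
    open Algebra.Solver.Ring 𝔽₂ almostRing 𝔽₂⟶V coeff≟
      using (solve; con; _:=_; _:+_; _:*_) public

    open CommutativeRing +-*-commutativeRing using (*-identityˡ; zeroˡ; zeroʳ) public

    timesX⁺-mulX : ∀ v → timesX⁺ v ≡ mulX v
    timesX⁺-mulX v rewrite mulX-spec v with top false v
    ... | false = refl
    ... | true  = trans (⊞-⊕ r (shift false v)) (⊕-comm r (shift false v))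

    mulAcc-horner : ∀ {k} (bs : Vec Bool k) v a → mulAcc bs v a ≡ a + horner bs v
    mulAcc-horner []           v a = sym (⊕-identityʳ a)
    mulAcc-horner (false ∷ bs) v a = begin
      mulAcc bs (timesX⁺ v) a      ≡⟨ mulAcc-horner bs (timesX⁺ v) a ⟩
      a + horner bs (timesX⁺ v)    ≡⟨ cong (λ w → a + horner bs w) (timesX⁺-mulX v) ⟩
      a + horner bs (mulX v)       ≡⟨ cong (a +_) (horner-mulX bs v) ⟩
      a + mulX (horner bs v)       ≡⟨ cong (a +_) (⊕-identityˡ _) ⟨
      a + (𝟘 + mulX (horner bs v)) ∎
    mulAcc-horner (true ∷ bs)  v a = begin
      mulAcc bs (timesX⁺ v) (v ⊞ a)   ≡⟨ mulAcc-horner bs (timesX⁺ v) (v ⊞ a) ⟩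
      v ⊞ a + horner bs (timesX⁺ v)   ≡⟨ cong₂ (λ w x → w + horner bs x) (trans (⊞-⊕ v a) (⊕-comm v a)) (timesX⁺-mulX v) ⟩
      a + v + horner bs (mulX v)      ≡⟨ cong (a + v +_) (horner-mulX bs v) ⟩
      a + v + mulX (horner bs v)      ≡⟨ ⊕-assoc a v _ ⟩
      a + (v + mulX (horner bs v))    ∎

    ⊛-* : ∀ u v → u ⊛ v ≡ u * v
    ⊛-* u v = begin
      mulAcc u v 𝟘    ≡⟨ mulAcc-horner u v 𝟘 ⟩
      𝟘 + horner u v  ≡⟨ ⊕-identityˡ (horner u v) ⟩
      horner u v      ≡⟨ mul-spec u v ⟨
      u * v           ∎

    -- The Frobenius map and the trace.

    φ-+ : Additive φ
    φ-+ u v = begin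
      φ (u + v)          ≡⟨ ⊛-* (u + v) (u + v) ⟩
      (u + v) * (u + v)  ≡⟨ solve 2 (λ u v → (u :+ v) :* (u :+ v) := u :* u :+ v :* v) refl u v ⟩
      u * u + v * v      ≡⟨ cong₂ _+_ (⊛-* u u) (⊛-* v v) ⟨
      φ u + φ v          ∎

    φ-* : ∀ u v → φ (u * v) ≡ φ u * φ v
    φ-* u v = begin
      φ (u * v)            ≡⟨ ⊛-* (u * v) (u * v) ⟩
      (u * v) * (u * v)    ≡⟨ solve 2 (λ u v → (u :* v) :* (u :* v) := (u :* u) :* (v :* v)) refl u v ⟩
      (u * u) * (v * v)    ≡⟨ cong₂ _*_ (⊛-* u u) (⊛-* v v) ⟨
      φ u * φ v            ∎

    φ-𝟙 : φ 𝟙 ≡ 𝟙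
    φ-𝟙 = trans (⊛-* 𝟙 𝟙) (*-identityˡ 𝟙)

    frob-+ : ∀ j → Additive (frob j)
    frob-+ zero    u v = refl
    frob-+ (suc j) u v = trans (cong (frob j) (φ-+ u v)) (frob-+ j (φ u) (φ v))

    frob-* : ∀ j u v → frob j (u * v) ≡ frob j u * frob j v
    frob-* zero    u v = refl
    frob-* (suc j) u v = trans (cong (frob j) (φ-* u v)) (frob-* j (φ u) (φ v))

    frob-𝟙 : ∀ j → frob j 𝟙 ≡ 𝟙
    frob-𝟙 zero    = refl
    frob-𝟙 (suc j) = trans (cong (frob j) φ-𝟙) (frob-𝟙 j)

    frob-ℕ+ : ∀ i j v → frob (i ℕ.+ j) v ≡ frob j (frob i v)
    frob-ℕ+ zero    j v = refl
    frob-ℕ+ (suc i) j v = frob-ℕ+ i j (φ v)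

    frob-n : ∀ v → frob n v ≡ v
    frob-n = columns-injective (frob-+ n) (λ u v → refl) frob-spec

    frob-multiple : ∀ k v → frob (k ℕ.* n) v ≡ v
    frob-multiple zero    v = refl
    frob-multiple (suc k) v = begin
      frob (n ℕ.+ k ℕ.* n) v     ≡⟨ frob-ℕ+ n (k ℕ.* n) v ⟩
      frob (k ℕ.* n) (frob n v)  ≡⟨ frob-multiple k (frob n v) ⟩
      frob n v                   ≡⟨ frob-n v ⟩
      v                          ∎

    frob-% : ∀ j v → frob (j ℕ.% n) v ≡ frob j v
    frob-% j v = begin
      frob (j ℕ.% n) v                            ≡⟨ frob-multiple (j ℕ./ n) _ ⟨
      frob (j ℕ./ n ℕ.* n) (frob (j ℕ.% n) v)     ≡⟨ frob-ℕ+ (j ℕ.% n) (j ℕ./ n ℕ.* n) v ⟨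
      frob (j ℕ.% n ℕ.+ j ℕ./ n ℕ.* n) v          ≡⟨ cong (λ i → frob i v) (ℕₚ.m≡m%n+[m/n]*n j n) ⟨
      frob j v                                    ∎

    trace-+ : ∀ k → Additive (trace k)
    trace-+ zero    u v = sym (⊕-self 𝟘)
    trace-+ (suc k) u v = begin
      (u + v) + trace k (φ (u + v))
        ≡⟨ cong (u + v +_) (trans (cong (trace k) (φ-+ u v)) (trace-+ k (φ u) (φ v))) ⟩
      (u + v) + (trace k (φ u) + trace k (φ v))
        ≡⟨ ⊕-interchange u v _ _ ⟩
      (u + trace k (φ u)) + (v + trace k (φ v)) ∎

    -- All 2k conjugates of a fixed element equal it, and they cancel in pairs.
    trace-even : ∀ k v → φ v ≡ v → trace (k ℕ.* 2) v ≡ 𝟘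
    trace-even zero    v φv≡v = refl
    trace-even (suc k) v φv≡v rewrite φv≡v | φv≡v | trace-even k v φv≡v =
      trans (cong (v +_) (⊕-identityʳ v)) (⊕-self v)

    tail-additive : ∀ {k} → Additive (tail {A = Bool} {n = k})
    tail-additive (_ ∷ u) (_ ∷ v) = refl

    -- As n is odd, an element fixed by φ equals its own trace, and traces lie in 𝔽₂.
    φ-fixed : ∀ v → φ v ≡ v → v ≡ 𝟘 ⊎ v ≡ 𝟙
    φ-fixed v φv≡v = bit v (begin
      tail v            ≡⟨ cong tail trace-v ⟨
      tail (trace n v)  ≡⟨ columns-injective (∘-additive tail-additive (trace-+ n))
                                             (λ _ _ → sym (⊕-self 𝟎)) trace-spec v ⟩
      𝟎                 ∎)
      where
      trace-v : trace n v ≡ v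
      trace-v = begin
        v + trace (suc h ℕ.* 2) (φ v)  ≡⟨ cong (λ w → v + trace (suc h ℕ.* 2) w) φv≡v ⟩
        v + trace (suc h ℕ.* 2) v      ≡⟨ cong (v +_) (trace-even (suc h) v φv≡v) ⟩
        v + 𝟘                          ≡⟨ ⊕-identityʳ v ⟩
        v                              ∎
      bit : ∀ v → tail v ≡ 𝟎 → v ≡ 𝟘 ⊎ v ≡ 𝟙
      bit (false ∷ _) refl = inj₁ refl
      bit (true ∷ _)  refl = inj₂ refl

    -- Inverses.

    -- The power v^(2ᵏ - 1), as the product of the conjugates v, v², v⁴, ...; for k = n it is the
    -- norm.
    norm : ℕ → V → V
    norm zero    v = 𝟙
    norm (suc k) v = v * norm k (φ v)

    norm-frob : ∀ k v → v * norm k v ≡ frob k v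
    norm-frob zero    v = *-identityʳ v
    norm-frob (suc k) v = begin
      v * (v * norm k (φ v))  ≡⟨ *-assoc v v _ ⟨
      v * v * norm k (φ v)    ≡⟨ cong (_* norm k (φ v)) (⊛-* v v) ⟨
      φ v * norm k (φ v)      ≡⟨ norm-frob k (φ v) ⟩
      frob k (φ v)            ∎

    φ-idempotent : ∀ v w → v * (v * w) ≡ v → φ (v * w) ≡ v * w
    φ-idempotent v w eq = begin
      φ (v * w)          ≡⟨ ⊛-* (v * w) (v * w) ⟩
      (v * w) * (v * w)  ≡⟨ solve 2 (λ v w → (v :* w) :* (v :* w) := (v :* (v :* w)) :* w) refl v w ⟩
      (v * (v * w)) * w  ≡⟨ cong (_* w) eq ⟩
      v * w              ∎

    -- The product `v * w` is idempotent, hence fixed by φ, hence 𝟘 or 𝟙 by `φ-fixed`; the value 𝟘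
    -- would force `v` to vanish.
    idempotent⇒unit : ∀ v w → v ≢ 𝟘 → v * (v * w) ≡ v → v * w ≡ 𝟙
    idempotent⇒unit v w v≢𝟘 eq = [ (λ e≡𝟘 → contradiction (v≡𝟘 e≡𝟘) v≢𝟘) , id ]′ (φ-fixed (v * w) (φ-idempotent v w eq))
      where
      v≡𝟘 : v * w ≡ 𝟘 → v ≡ 𝟘
      v≡𝟘 e≡𝟘 = trans (sym eq) (trans (cong (v *_) e≡𝟘) (zeroʳ v))

    infix 8 _⁻¹
    abstract
      -- The power v^(2ⁿ - 2). With this choice `v * v ⁻¹` is `norm n v` by definition, and
      -- `norm-frob` together with φⁿ = id gives the hypothesis of `idempotent⇒unit`.
      _⁻¹ : V → V
      v ⁻¹ = norm (2 ℕ.+ h ℕ.* 2) (φ v)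

      *-inverseʳ : ∀ {v} → v ≢ 𝟘 → v * v ⁻¹ ≡ 𝟙
      *-inverseʳ {v} v≢𝟘 = idempotent⇒unit v (v ⁻¹) v≢𝟘 (trans (norm-frob n v) (frob-n v))

    𝟙≢𝟘 : 𝟙 ≢ 𝟘
    𝟙≢𝟘 ()

    *-cancelˡ : ∀ {c} u v → c ≢ 𝟘 → c * u ≡ c * v → u ≡ v
    *-cancelˡ {c} u v c≢𝟘 eq = begin
      u                ≡⟨ strip u ⟨
      c ⁻¹ * (c * u)   ≡⟨ cong (c ⁻¹ *_) eq ⟩
      c ⁻¹ * (c * v)   ≡⟨ strip v ⟩
      v                ∎
      where
      strip : ∀ w → c ⁻¹ * (c * w) ≡ w
      strip w = begin
        c ⁻¹ * (c * w)  ≡⟨ solve 3 (λ i c w → i :* (c :* w) := (c :* i) :* w) refl (c ⁻¹) c w ⟩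
        (c * c ⁻¹) * w  ≡⟨ cong (_* w) (*-inverseʳ c≢𝟘) ⟩
        𝟙 * w           ≡⟨ *-identityˡ w ⟩
        w               ∎

    *-≢𝟘 : ∀ {u v} → u ≢ 𝟘 → v ≢ 𝟘 → u * v ≢ 𝟘
    *-≢𝟘 {u} {v} u≢𝟘 v≢𝟘 eq = v≢𝟘 (*-cancelˡ v 𝟘 u≢𝟘 (trans eq (sym (zeroʳ u))))

    integral : ∀ u v → u * v ≡ 𝟘 → u ≡ 𝟘 ⊎ v ≡ 𝟘
    integral u v eq with u ≟ 𝟘
    ... | yes u≡𝟘 = inj₁ u≡𝟘
    ... | no  u≢𝟘 = inj₂ (*-cancelˡ v 𝟘 u≢𝟘 (trans eq (sym (zeroʳ u))))

    frob-≢𝟘 : ∀ j {v} → v ≢ 𝟘 → frob j v ≢ 𝟘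
    frob-≢𝟘 j {v} v≢𝟘 eq = 𝟙≢𝟘 (begin
      𝟙                         ≡⟨ frob-𝟙 j ⟨
      frob j 𝟙                  ≡⟨ cong (frob j) (*-inverseʳ v≢𝟘) ⟨
      frob j (v * v ⁻¹)         ≡⟨ frob-* j v (v ⁻¹) ⟩
      frob j v * frob j (v ⁻¹)  ≡⟨ cong (_* frob j (v ⁻¹)) eq ⟩
      𝟘 * frob j (v ⁻¹)         ≡⟨ zeroˡ _ ⟩
      𝟘                         ∎)

    -- Field automorphisms.

    mulX-X* : ∀ w → mulX w ≡ X * w
    mulX-X* w = begin
      mulX w             ≡⟨ cong mulX (horner-𝟙 w) ⟨
      mulX (horner w 𝟙)  ≡⟨ horner-mulX w 𝟙 ⟨
      horner w X         ≡⟨ mul-spec w X ⟨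
      w * X              ≡⟨ *-comm w X ⟩
      X * w              ∎

    poly-horner : ∀ {k} (bs : Vec Bool k) → poly bs X ≡ horner bs 𝟙
    poly-horner []       = refl
    poly-horner (b ∷ bs) = cong (b · 𝟙 +_)
      (trans (cong (X *_) (poly-horner bs)) (sym (mulX-X* (horner bs 𝟙))))

    poly-X : ∀ v → poly v X ≡ v
    poly-X v = trans (poly-horner v) (horner-𝟙 v)

    module _ {σ : V → V} (σ-+ : Additive σ) (σ-* : ∀ u v → σ (u * v) ≡ σ u * σ v) (σ-𝟙 : σ 𝟙 ≡ 𝟙) where

      hom-poly : ∀ {k} (bs : Vec Bool k) y → σ (poly bs y) ≡ poly bs (σ y)
      hom-poly []       y = additive-𝟎 σ-+
      hom-poly (b ∷ bs) y = begin
        σ (b · 𝟙 + y * poly bs y)      ≡⟨ σ-+ _ _ ⟩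
        σ (b · 𝟙) + σ (y * poly bs y)  ≡⟨ cong₂ _+_ (trans (additive-· σ-+ b 𝟙) (cong (b ·_) σ-𝟙)) (trans (σ-* y _) (cong (σ y *_) (hom-poly bs y))) ⟩
        b · 𝟙 + σ y * poly bs (σ y)    ∎

      -- The powers of X span the field, so a ring endomorphism is determined by the image of X.
      hom-X : ∀ v → σ v ≡ poly v (σ X)
      hom-X v = trans (cong σ (sym (poly-X v))) (hom-poly v X)

    polyⱽ-timesLinear : ∀ c d ps y → polyⱽ (timesLinear c d ps) y ≡ d + (y + c) * polyⱽ ps y
    polyⱽ-timesLinear c d []       y = solve 3 (λ c d y → d :+ y :* con false := d :+ (y :+ c) :* con false) refl c d y
    polyⱽ-timesLinear c d (p ∷ ps) y = begin
      d + c ⊛ p + y * polyⱽ (timesLinear c p ps) y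
        ≡⟨ cong₂ (λ w x → d + w + y * x) (⊛-* c p) (polyⱽ-timesLinear c p ps y) ⟩
      d + c * p + y * (p + (y + c) * polyⱽ ps y)
        ≡⟨ solve 5 (λ c d p y q → d :+ c :* p :+ y :* (p :+ (y :+ c) :* q) := d :+ (y :+ c) :* (p :+ y :* q)) refl c d p y (polyⱽ ps y) ⟩
      d + (y + c) * (p + y * polyⱽ ps y) ∎

    -- The polynomial is ∏ (Y + c), and without zero divisors one of its factors must vanish at `y`.
    fromRoots-root : ∀ cs y → polyⱽ (fromRoots cs) y ≡ 𝟘 → y ∈ cs
    fromRoots-root []       y eq = contradiction (trans (solve 1 (λ y → con true := con true :+ y :* con false) refl y) eq) 𝟙≢𝟘
    fromRoots-root (c ∷ cs) y eq =
      [ here ∘ ⊕-cancel y c , there ∘ fromRoots-root cs y ]′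
      (integral (y + c) (polyⱽ (fromRoots cs) y)
        (trans (sym (⊕-identityˡ _)) (trans (sym (polyⱽ-timesLinear c 𝟘 (fromRoots cs) y)) eq)))

    polyⱽ-map : ∀ {k} (bs : Vec Bool k) y → polyⱽ (List.map (_· 𝟙) (toList bs)) y ≡ poly bs y
    polyⱽ-map []       y = refl
    polyⱽ-map (b ∷ bs) y = cong (λ z → b · 𝟙 + y * z) (polyⱽ-map bs y)

    automorphism-frob : ∀ σ → IsFieldAut σ → ∃ λ j → j ℕ.< n × (∀ v → σ v ≡ frob j v)
    automorphism-frob σ (σ-+ , σ-* , σ-𝟙 , _) =
      let j , j∈ , σX≡ = ∈-map⁻ (frob′ X) (subst (σ X ∈_) (iterate-map φ X n) σX∈)
      in j , ∈-upTo⁻ j∈ , λ v → begin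
        σ v              ≡⟨ hom-X σ-+ σ-* σ-𝟙 v ⟩
        poly v (σ X)     ≡⟨ cong (poly v) σX≡ ⟩
        poly v (frob j X) ≡⟨ hom-X (frob-+ j) (frob-* j) (frob-𝟙 j) v ⟨
        frob j v         ∎
      where
      frob′ : V → ℕ → V
      frob′ v j = frob j v
      -- The modulus has coefficients in 𝔽₂, which σ fixes, so σ takes its root X to another root.
      σX∈ : σ X ∈ List.iterate φ X n
      σX∈ = fromRoots-root (List.iterate φ X n) (σ X) (begin
        polyⱽ (fromRoots (List.iterate φ X n)) (σ X)           ≡⟨ cong (λ p → polyⱽ p (σ X)) split-spec ⟩
        polyⱽ (List.map (_· 𝟙) (toList (r ∷ʳ true))) (σ X)     ≡⟨ polyⱽ-map (r ∷ʳ true) (σ X) ⟩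
        poly (r ∷ʳ true) (σ X)                                 ≡⟨ hom-poly σ-+ σ-* σ-𝟙 (r ∷ʳ true) X ⟨
        σ (poly (r ∷ʳ true) X)                                 ≡⟨ cong σ root-spec ⟩
        σ 𝟘                                                    ≡⟨ additive-𝟎 σ-+ ⟩
        𝟘                                                      ∎)

-- Planes and their invariants.

module Geometry (h : ℕ) (r : Vec Bool (3 ℕ.+ h ℕ.* 2)) (fc : Field.FieldChecks h r) where

  open Field h r
  open Laws fc
  open GF n r

  -- Numbers the three nonzero vectors of a plane; its six ordered bases are then the pairs k ≠ l,
  -- and a change of basis becomes a case distinction.
  point : V → V → Fin 3 → V
  point a b 0F = a
  point a b 1F = b
  point a b 2F = a + b

  inSpan-combination : ∀ a b p q → InSpan a b (p · a + q · b)
  inSpan-combination a b false false = inj₁ (⊕-self 𝟘)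
  inSpan-combination a b true  false = inj₂ (inj₁ (⊕-identityʳ a))
  inSpan-combination a b false true  = inj₂ (inj₂ (inj₁ (⊕-identityˡ b)))
  inSpan-combination a b true  true  = inj₂ (inj₂ (inj₂ refl))

  combination-inSpan : ∀ {a b x} → InSpan a b x → ∃₂ λ p q → x ≡ p · a + q · b
  combination-inSpan (inj₁ refl)                      = false , false , sym (⊕-self 𝟘)
  combination-inSpan {a} (inj₂ (inj₁ refl))           = true , false , sym (⊕-identityʳ a)
  combination-inSpan {b = b} (inj₂ (inj₂ (inj₁ refl))) = false , true , sym (⊕-identityˡ b)
  combination-inSpan (inj₂ (inj₂ (inj₂ refl)))        = true , true , refl

  inSpan-+ : ∀ {a b x y} → InSpan a b x → InSpan a b y → InSpan a b (x + y)
  inSpan-+ {a} {b} x∈ y∈ with combination-inSpan x∈ | combination-inSpan y∈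
  ... | p , q , refl | p′ , q′ , refl = subst (InSpan a b)
    (trans (cong₂ _+_ (·-xor p p′ a) (·-xor q q′ b)) (⊕-interchange (p · a) (p′ · a) (q · b) (q′ · b)))
    (inSpan-combination a b (p xor p′) (q xor q′))

  inSpan-trans : ∀ {a b a′ b′ x} → InSpan a b a′ → InSpan a b b′ → InSpan a′ b′ x → InSpan a b x
  inSpan-trans a′∈ b′∈ (inj₁ refl)               = inj₁ refl
  inSpan-trans a′∈ b′∈ (inj₂ (inj₁ refl))        = a′∈
  inSpan-trans a′∈ b′∈ (inj₂ (inj₂ (inj₁ refl))) = b′∈
  inSpan-trans a′∈ b′∈ (inj₂ (inj₂ (inj₂ refl))) = inSpan-+ a′∈ b′∈

  inSpanˡ : ∀ {a b} → InSpan a b a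
  inSpanˡ = inj₂ (inj₁ refl)

  inSpanʳ : ∀ {a b} → InSpan a b b
  inSpanʳ = inj₂ (inj₂ (inj₁ refl))

  inSpan-point : ∀ {a b} k → InSpan a b (point a b k)
  inSpan-point 0F = inSpanˡ
  inSpan-point 1F = inSpanʳ
  inSpan-point 2F = inj₂ (inj₂ (inj₂ refl))

  point-inSpan : ∀ {a b x} → x ≢ 𝟘 → InSpan a b x → ∃ λ k → x ≡ point a b k
  point-inSpan x≢𝟘 (inj₁ x≡𝟘)               = contradiction x≡𝟘 x≢𝟘
  point-inSpan x≢𝟘 (inj₂ (inj₁ x≡a))        = 0F , x≡a
  point-inSpan x≢𝟘 (inj₂ (inj₂ (inj₁ x≡b))) = 1F , x≡b
  point-inSpan x≢𝟘 (inj₂ (inj₂ (inj₂ x≡c))) = 2F , x≡c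

  sameSpan-refl : ∀ {a b} → SameSpan a b a b
  sameSpan-refl x = id , id

  sameSpan-sym : ∀ {a b a′ b′} → SameSpan a b a′ b′ → SameSpan a′ b′ a b
  sameSpan-sym s x = proj₂ (s x) , proj₁ (s x)

  sameSpan-trans : ∀ {a b a′ b′ a″ b″} → SameSpan a b a′ b′ → SameSpan a′ b′ a″ b″ → SameSpan a b a″ b″
  sameSpan-trans s t x = proj₁ (t x) ∘ proj₁ (s x) , proj₂ (s x) ∘ proj₂ (t x)

  x+[x+y] : ∀ x y → x + (x + y) ≡ y
  x+[x+y] = solve 2 (λ x y → x :+ (x :+ y) := y) refl

  [x+y]+x : ∀ x y → (x + y) + x ≡ y
  [x+y]+x = solve 2 (λ x y → (x :+ y) :+ x := y) refl

  y+[x+y] : ∀ x y → y + (x + y) ≡ x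
  y+[x+y] = solve 2 (λ x y → y :+ (x :+ y) := x) refl

  [x+y]+y : ∀ x y → (x + y) + y ≡ x
  [x+y]+y = solve 2 (λ x y → (x :+ y) :+ y := x) refl

  -- Any two of the three points sum to the third.
  sameSpan-point : ∀ {a b} k l → k ≢ l → SameSpan (point a b k) (point a b l) a b
  sameSpan-point {a} {b} k l k≢l x =
    inSpan-trans (inSpan-point k) (inSpan-point l) , inSpan-trans (a∈ k l k≢l) (b∈ k l k≢l)
    where
    sum : ∀ {x y z} → x + y ≡ z → InSpan x y z
    sum eq = inj₂ (inj₂ (inj₂ (sym eq)))
    a∈ : ∀ k l → k ≢ l → InSpan (point a b k) (point a b l) a
    a∈ 0F _  _   = inSpanˡ
    a∈ 1F 0F _   = inSpanʳ
    a∈ 2F 0F _   = inSpanʳ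
    a∈ 1F 2F _   = sum (y+[x+y] a b)
    a∈ 2F 1F _   = sum ([x+y]+y a b)
    a∈ 1F 1F k≢l = contradiction refl k≢l
    a∈ 2F 2F k≢l = contradiction refl k≢l
    b∈ : ∀ k l → k ≢ l → InSpan (point a b k) (point a b l) b
    b∈ 1F _  _   = inSpanˡ
    b∈ 0F 1F _   = inSpanʳ
    b∈ 2F 1F _   = inSpanʳ
    b∈ 0F 2F _   = sum (x+[x+y] a b)
    b∈ 2F 0F _   = sum ([x+y]+x a b)
    b∈ 0F 0F k≢l = contradiction refl k≢l
    b∈ 2F 2F k≢l = contradiction refl k≢l

  +≢𝟘⇒≢ : ∀ {a b} → a + b ≢ 𝟘 → a ≢ b
  +≢𝟘⇒≢ {a} a+b≢𝟘 refl = a+b≢𝟘 (⊕-self a)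

  point-injective : ∀ {a b} → Indep2 a b → ∀ k l → point a b k ≡ point a b l → k ≡ l
  point-injective                _                0F 0F _ = refl
  point-injective                _                1F 1F _ = refl
  point-injective                _                2F 2F _ = refl
  point-injective                (_ , _ , a+b≢𝟘) 0F 1F eq = contradiction eq (+≢𝟘⇒≢ a+b≢𝟘)
  point-injective                (_ , _ , a+b≢𝟘) 1F 0F eq = contradiction (sym eq) (+≢𝟘⇒≢ a+b≢𝟘)
  point-injective {a} {b} (_ , b≢𝟘 , _)     0F 2F eq =
    contradiction (trans (sym (x+[x+y] a b)) (trans (cong (a +_) (sym eq)) (⊕-self a))) b≢𝟘
  point-injective {a} {b} (_ , b≢𝟘 , _)     2F 0F eq =
    contradiction (trans (sym (x+[x+y] a b)) (trans (cong (a +_) eq) (⊕-self a))) b≢𝟘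
  point-injective {a} {b} (a≢𝟘 , _ , _)     1F 2F eq =
    contradiction (trans (sym (y+[x+y] a b)) (trans (cong (b +_) (sym eq)) (⊕-self b))) a≢𝟘
  point-injective {a} {b} (a≢𝟘 , _ , _)     2F 1F eq =
    contradiction (trans (sym (y+[x+y] a b)) (trans (cong (b +_) eq) (⊕-self b))) a≢𝟘

  point-≢𝟘 : ∀ {a b} → Indep2 a b → ∀ k → point a b k ≢ 𝟘
  point-≢𝟘 (a≢𝟘 , _ , _)   0F = a≢𝟘
  point-≢𝟘 (_ , b≢𝟘 , _)   1F = b≢𝟘
  point-≢𝟘 (_ , _ , a+b≢𝟘) 2F = a+b≢𝟘

  -- The Dickson invariants of the plane W = ⟨a,b⟩: ∏_{w∈W} (Y + w) = Y⁴ + Q a b · Y² + Λ a b · Y.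
  Λ Q : V → V → V
  Λ a b = a * b * (a + b)
  Q a b = a * a + a * b + b * b

  -- Λ and Q are the elementary symmetric functions of degree 3 and 2 in the three points, so they
  -- do not depend on the ordered basis.
  Λ-point : ∀ {a b} k l → k ≢ l → Λ (point a b k) (point a b l) ≡ Λ a b
  Λ-point 0F 0F k≢l = contradiction refl k≢l
  Λ-point 1F 1F k≢l = contradiction refl k≢l
  Λ-point 2F 2F k≢l = contradiction refl k≢l
  Λ-point 0F 1F _ = refl
  Λ-point {a} {b} 1F 0F _ = solve 2 (λ a b → b :* a :* (b :+ a) := a :* b :* (a :+ b)) refl a b
  Λ-point {a} {b} 0F 2F _ = solve 2 (λ a b → a :* (a :+ b) :* (a :+ (a :+ b)) := a :* b :* (a :+ b)) refl a b
  Λ-point {a} {b} 2F 0F _ = solve 2 (λ a b → (a :+ b) :* a :* ((a :+ b) :+ a) := a :* b :* (a :+ b)) refl a b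
  Λ-point {a} {b} 1F 2F _ = solve 2 (λ a b → b :* (a :+ b) :* (b :+ (a :+ b)) := a :* b :* (a :+ b)) refl a b
  Λ-point {a} {b} 2F 1F _ = solve 2 (λ a b → (a :+ b) :* b :* ((a :+ b) :+ b) := a :* b :* (a :+ b)) refl a b

  Q-point : ∀ {a b} k l → k ≢ l → Q (point a b k) (point a b l) ≡ Q a b
  Q-point 0F 0F k≢l = contradiction refl k≢l
  Q-point 1F 1F k≢l = contradiction refl k≢l
  Q-point 2F 2F k≢l = contradiction refl k≢l
  Q-point 0F 1F _ = refl
  Q-point {a} {b} 1F 0F _ = solve 2 (λ a b → b :* b :+ b :* a :+ a :* a := a :* a :+ a :* b :+ b :* b) refl a b
  Q-point {a} {b} 0F 2F _ = solve 2 (λ a b → a :* a :+ a :* (a :+ b) :+ (a :+ b) :* (a :+ b) := a :* a :+ a :* b :+ b :* b) refl a b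
  Q-point {a} {b} 2F 0F _ = solve 2 (λ a b → (a :+ b) :* (a :+ b) :+ (a :+ b) :* a :+ a :* a := a :* a :+ a :* b :+ b :* b) refl a b
  Q-point {a} {b} 1F 2F _ = solve 2 (λ a b → b :* b :+ b :* (a :+ b) :+ (a :+ b) :* (a :+ b) := a :* a :+ a :* b :+ b :* b) refl a b
  Q-point {a} {b} 2F 1F _ = solve 2 (λ a b → (a :+ b) :* (a :+ b) :+ (a :+ b) :* b :+ b :* b := a :* a :+ a :* b :+ b :* b) refl a b

  -- Transfers the invariance from the six bases made of points to equality of spans: the vectors of
  -- a second basis must be two different points of the first.
  basis-points : ∀ {a b a′ b′} → Indep2 a′ b′ → SameSpan a b a′ b′ →
                 ∃₂ λ k l → k ≢ l × a′ ≡ point a b k × b′ ≡ point a b l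
  basis-points {a} {b} {a′} {b′} (a′≢𝟘 , b′≢𝟘 , a′+b′≢𝟘) same =
    let k , a′≡ = point-inSpan a′≢𝟘 (proj₂ (same a′) inSpanˡ)
        l , b′≡ = point-inSpan b′≢𝟘 (proj₂ (same b′) inSpanʳ)
    in k , l , (λ k≡l → +≢𝟘⇒≢ a′+b′≢𝟘 (trans a′≡ (trans (cong (point a b) k≡l) (sym b′≡)))) , a′≡ , b′≡

  Λ-sameSpan : ∀ {a b a′ b′} → Indep2 a′ b′ → SameSpan a b a′ b′ → Λ a′ b′ ≡ Λ a b
  Λ-sameSpan ind same =
    let k , l , k≢l , a′≡ , b′≡ = basis-points ind same
    in trans (cong₂ Λ a′≡ b′≡) (Λ-point k l k≢l)

  Q-sameSpan : ∀ {a b a′ b′} → Indep2 a′ b′ → SameSpan a b a′ b′ → Q a′ b′ ≡ Q a b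
  Q-sameSpan ind same =
    let k , l , k≢l , a′≡ , b′≡ = basis-points ind same
    in trans (cong₂ Q a′≡ b′≡) (Q-point k l k≢l)

  Λ-≢𝟘 : ∀ {a b} → Indep2 a b → Λ a b ≢ 𝟘
  Λ-≢𝟘 (a≢𝟘 , b≢𝟘 , a+b≢𝟘) = *-≢𝟘 (*-≢𝟘 a≢𝟘 b≢𝟘) a+b≢𝟘

  Λ-scale : ∀ c a b → Λ (c * a) (c * b) ≡ c * c * c * Λ a b
  Λ-scale = solve 3 (λ c a b → (c :* a) :* (c :* b) :* (c :* a :+ c :* b) := c :* c :* c :* (a :* b :* (a :+ b))) refl

  Q-scale : ∀ c a b → Q (c * a) (c * b) ≡ c * c * Q a b
  Q-scale = solve 3 (λ c a b → (c :* a) :* (c :* a) :+ (c :* a) :* (c :* b) :+ (c :* b) :* (c :* b)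
                            := c :* c :* (a :* a :+ a :* b :+ b :* b)) refl

  -- i = Q³/Λ² + 1, which classifies the planes up to multiplication by scalars.
  HasClass : V → V → V → Set
  HasClass a b i = i * (Λ a b * Λ a b) ≡ Q a b * Q a b * Q a b + Λ a b * Λ a b

  hasClass-sameSpan : ∀ {a b a′ b′ i} → Indep2 a′ b′ → SameSpan a b a′ b′ → HasClass a b i → HasClass a′ b′ i
  hasClass-sameSpan {i = i} ind same =
    subst₂ (λ l q → i * (l * l) ≡ q * q * q + l * l) (sym (Λ-sameSpan ind same)) (sym (Q-sameSpan ind same))

  -- Q³ and Λ² both have degree 6 in (a, b), so scaling multiplies the whole equation by c⁶.
  hasClass-scale : ∀ {a b i} c → HasClass a b i → HasClass (c * a) (c * b) i
  hasClass-scale {a} {b} {i} c has =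
    subst₂ (λ l q → i * (l * l) ≡ q * q * q + l * l) (sym (Λ-scale c a b)) (sym (Q-scale c a b))
      (scaled c i (Λ a b) (Q a b) has)
    where
    scaled : ∀ c i l q → i * (l * l) ≡ q * q * q + l * l →
             i * ((c * c * c * l) * (c * c * c * l)) ≡
             (c * c * q) * (c * c * q) * (c * c * q) + (c * c * c * l) * (c * c * c * l)
    scaled c i l q eq = begin
      i * ((c * c * c * l) * (c * c * c * l))
        ≡⟨ solve 3 (λ d i l → i :* ((d :* l) :* (d :* l)) := (d :* d) :* (i :* (l :* l))) refl (c * c * c) i l ⟩
      (c * c * c * (c * c * c)) * (i * (l * l))
        ≡⟨ cong (c * c * c * (c * c * c) *_) eq ⟩
      (c * c * c * (c * c * c)) * (q * q * q + l * l)
        ≡⟨ solve 3 (λ c l q → (c :* c :* c :* (c :* c :* c)) :* (q :* q :* q :+ l :* l)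
             := (c :* c :* q) :* (c :* c :* q) :* (c :* c :* q) :+ (c :* c :* c :* l) :* (c :* c :* c :* l)) refl c l q ⟩
      (c * c * q) * (c * c * q) * (c * c * q) + (c * c * c * l) * (c * c * c * l) ∎

  hasClass-unique : ∀ {a b i i′} → Indep2 a b → HasClass a b i → HasClass a b i′ → i ≡ i′
  hasClass-unique {a} {b} {i} {i′} ind has has′ =
    *-cancelˡ i i′ (*-≢𝟘 (Λ-≢𝟘 ind) (Λ-≢𝟘 ind))
      (trans (*-comm _ i) (trans has (trans (sym has′) (*-comm i′ _))))

  -- For the basis (1, t) and y = t² + t one has Λ = y and Q = y + 1, hence Q³/Λ² = y + 1 + 1/y +
  -- 1/y². The summand 1 in the definition of the class cancels the constant, and y + z + z² with z
  -- = 1/y remains, which is (t + z)² + (t + z).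
  hasClass-ratio : ∀ t z → (t * t + t) * z ≡ 𝟙 → HasClass 𝟙 t ((t + z) * (t + z) + (t + z))
  hasClass-ratio t z eq = subst₂ (λ l q → i * (l * l) ≡ q * q * q + l * l)
    (solve 1 (λ t → t :* t :+ t := con true :* t :* (con true :+ t)) refl t)
    (solve 1 (λ t → t :* t :+ t :+ con true := con true :* con true :+ con true :* t :+ t :* t) refl t)
    (begin
      i * (y * y)
        ≡⟨ solve 2 (λ t z → let y = t :* t :+ t in ((t :+ z) :* (t :+ z) :+ (t :+ z)) :* (y :* y)
             := y :* y :* y :+ ((y :* z) :* (y :* z) :+ y :* (y :* z))) refl t z ⟩
      y * y * y + ((y * z) * (y * z) + y * (y * z))
        ≡⟨ cong (λ w → y * y * y + (w * w + y * w)) eq ⟩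
      y * y * y + (𝟙 * 𝟙 + y * 𝟙)
        ≡⟨ solve 1 (λ y → y :* y :* y :+ (con true :* con true :+ y :* con true)
             := (y :+ con true) :* (y :+ con true) :* (y :+ con true) :+ y :* y) refl y ⟩
      (y + 𝟙) * (y + 𝟙) * (y + 𝟙) + y * y ∎)
    where
    i = (t + z) * (t + z) + (t + z)
    y = t * t + t

  module _ (j : ℕ) where

    -- Λ and Q have coefficients in 𝔽₂ and so commute with φ.
    frob-Λ : ∀ a b → frob j (Λ a b) ≡ Λ (frob j a) (frob j b)
    frob-Λ a b = trans (frob-* j (a * b) (a + b)) (cong₂ _*_ (frob-* j a b) (frob-+ j a b))

    frob-Q : ∀ a b → frob j (Q a b) ≡ Q (frob j a) (frob j b)
    frob-Q a b = trans (frob-+ j (a * a + a * b) (b * b))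
      (cong₂ _+_ (trans (frob-+ j (a * a) (a * b)) (cong₂ _+_ (frob-* j a a) (frob-* j a b))) (frob-* j b b))

    hasClass-frob : ∀ {a b i} → HasClass a b i → HasClass (frob j a) (frob j b) (frob j i)
    hasClass-frob {a} {b} {i} has =
      subst₂ (λ l q → frob j i * (l * l) ≡ q * q * q + l * l) (frob-Λ a b) (frob-Q a b)
        (transfer (Λ a b) (Q a b) has)
      where
      σ = frob j
      transfer : ∀ l q → i * (l * l) ≡ q * q * q + l * l → σ i * (σ l * σ l) ≡ σ q * σ q * σ q + σ l * σ l
      transfer l q eq = begin
        σ i * (σ l * σ l)            ≡⟨ trans (frob-* j i (l * l)) (cong (σ i *_) (frob-* j l l)) ⟨
        σ (i * (l * l))              ≡⟨ cong σ eq ⟩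
        σ (q * q * q + l * l)        ≡⟨ frob-+ j (q * q * q) (l * l) ⟩
        σ (q * q * q) + σ (l * l)    ≡⟨ cong₂ _+_ (trans (frob-* j (q * q) q) (cong (_* σ q) (frob-* j q q))) (frob-* j l l) ⟩
        σ q * σ q * σ q + σ l * σ l  ∎

  hom-indep2 : ∀ {g : V → V} → Additive g → (∀ {x} → x ≢ 𝟘 → g x ≢ 𝟘) → ∀ {a b} → Indep2 a b → Indep2 (g a) (g b)
  hom-indep2 g-+ g-≢𝟘 {a} {b} (a≢𝟘 , b≢𝟘 , a+b≢𝟘) =
    g-≢𝟘 a≢𝟘 , g-≢𝟘 b≢𝟘 , λ eq → g-≢𝟘 a+b≢𝟘 (trans (g-+ a b) eq)

  hom-indep3 : ∀ {g : V → V} → Additive g → (∀ {x} → x ≢ 𝟘 → g x ≢ 𝟘) →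
               ∀ {a b c} → Indep3 a b c → Indep3 (g a) (g b) (g c)
  hom-indep3 {g} g-+ g-≢𝟘 {a} {b} {c} (a≢ , b≢ , c≢ , ab≢ , bc≢ , ca≢ , abc≢) =
    g-≢𝟘 a≢ , g-≢𝟘 b≢ , g-≢𝟘 c≢ , sum a b ab≢ , sum b c bc≢ , sum c a ca≢ ,
    λ eq → g-≢𝟘 abc≢ (trans (trans (g-+ (a + b) c) (cong (_+ g c) (g-+ a b))) eq)
    where
    sum : ∀ x y → x + y ≢ 𝟘 → g x + g y ≢ 𝟘
    sum x y x+y≢𝟘 eq = g-≢𝟘 x+y≢𝟘 (trans (g-+ x y) eq)

  -- In characteristic 2 the hypothesis reads (c + d)² = 𝟘. It recovers a scalar from its effect on
  -- Q, which is multiplication by its square.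
  *-injective-square : ∀ c d → c * c ≡ d * d → c ≡ d
  *-injective-square c d eq = ⊕-cancel c d ([ id , id ]′ (integral (c + d) (c + d) (begin
    (c + d) * (c + d)  ≡⟨ solve 2 (λ c d → (c :+ d) :* (c :+ d) := c :* c :+ d :* d) refl c d ⟩
    c * c + d * d      ≡⟨ cong (_+ d * d) eq ⟩
    d * d + d * d      ≡⟨ ⊕-self (d * d) ⟩
    𝟘                  ∎)))

-- What a certificate consists of and how it is tested.

module Certificate (h : ℕ) (r : Vec Bool (3 ℕ.+ h ℕ.* 2)) where

  open Field h r
  open GF n r

  -- (u, v) stands for the triangle (1, u, uv); the other entries are the inverses of t² + t for t = u, v, uv.
  Base : Set
  Base = Vec V 5

  ratio : Base → Fin 3 → V
  ratio (u ∷ v ∷ _) 0F = u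
  ratio (u ∷ v ∷ _) 1F = v
  ratio (u ∷ v ∷ _) 2F = u ⊛ v

  inverse : Base → Fin 3 → V
  inverse (_ ∷ _ ∷ zs) = Vec.lookup zs

  -- Besides certifying the inverse this forces t² + t ≠ 𝟘, so `t` is neither 𝟘 nor 𝟙 and ⟨1,t⟩ is a
  -- plane.
  ValidRatio : V → V → Set
  ValidRatio t z = (t ⊛ t ⊞ t) ⊛ z ≡ 𝟙

  -- The last condition excludes 1 + u + uv = 𝟘, in which case the three edges would be one and the
  -- same plane.
  Valid : Base → Set
  Valid e = ValidRatio (ratio e 0F) (inverse e 0F)
          × ValidRatio (ratio e 1F) (inverse e 1F)
          × ValidRatio (ratio e 2F) (inverse e 2F)
          × 𝟙 + ratio e 0F + ratio e 2F ≢ 𝟘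

  valid? : ∀ e → Dec (Valid e)
  valid? e = _ ≟ _ ×-dec _ ≟ _ ×-dec _ ≟ _ ×-dec ¬? (_ ≟ _)

  class : Base → Fin 3 → V
  class e s = let d = ratio e s ⊞ inverse e s in d ⊛ d ⊞ d

  -- The coefficient of x; for n = 7 the constant coefficient would not separate the classes.
  coeff₁ : V → Bool
  coeff₁ v = Vec.lookup v 1F

  coeffs : ∀ k → V → Vec Bool k
  coeffs k v = Vec.map coeff₁ (Vec.iterate φ v k)

  orbit : V → Vec Bool n
  orbit = coeffs n

  -- The matrix of `orbit` is passed as an argument so that it can be shared between all classes,
  -- instead of applying φ repeatedly to each of them. The n rotations of a vector stand for the n
  -- conjugates of its class.
  keys : List Base → List (Vec Bool n)
  keys = go (columns orbit)
    where
    go : Vec (Vec Bool n) n → List Base → List (Vec Bool n)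
    go cs = concatMap λ e → concatMap (λ s → List.iterate rotate (combine (class e s) cs) n) (allFin 3)

  record CertificateChecks (es : List Base) : Set where
    field
      valid-spec    : All Valid es
      distinct-spec : distinct (keys es) ≡ true
      length-spec   : 2 ℕ.+ 6 ℕ.* (length es ℕ.* (3 ℕ.* n)) ≡ 2 ℕ.^ n

-- Distinct keys separate the classes.

module Design (h : ℕ) (r : Vec Bool (3 ℕ.+ h ℕ.* 2)) (fc : Field.FieldChecks h r)
              (es : List (Certificate.Base h r)) (cc : Certificate.CertificateChecks h r es) where

  open Field h r
  open Laws fc
  open GF n r
  open Geometry h r fc
  open Certificate h r
  open CertificateChecks cc

  coeffs-additive : ∀ k → Additive (coeffs k)
  coeffs-additive zero    u v = refl
  coeffs-additive (suc k) u v = begin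
    coeff₁ (u + v) ∷ coeffs k (φ (u + v))
      ≡⟨ cong₂ (λ (b : Bool) w → b ∷ coeffs k w) (Vecₚ.lookup-zipWith _xor_ 1F u v) (φ-+ u v) ⟩
    (coeff₁ u xor coeff₁ v) ∷ coeffs k (φ u + φ v)
      ≡⟨ cong ((coeff₁ u xor coeff₁ v) ∷_) (coeffs-additive k (φ u) (φ v)) ⟩
    coeffs (suc k) u ⊕ coeffs (suc k) v ∎

  orbit-additive : Additive orbit
  orbit-additive = coeffs-additive n

  coeffs-∷ʳ : ∀ k v → coeffs k v ∷ʳ coeff₁ (frob k v) ≡ coeffs (suc k) v
  coeffs-∷ʳ zero    v = refl
  coeffs-∷ʳ (suc k) v = cong (coeff₁ v ∷_) (coeffs-∷ʳ k (φ v))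

  -- Applying φ drops the first coefficient and appends that of φⁿ v, which is the dropped one since
  -- φⁿ = id.
  orbit-φ : ∀ v → orbit (φ v) ≡ rotate (orbit v)
  orbit-φ v = begin
    orbit (φ v)                              ≡⟨ coeffs-∷ʳ n-1 (φ v) ⟨
    coeffs n-1 (φ v) ∷ʳ coeff₁ (frob n v)    ≡⟨ cong (λ w → coeffs n-1 (φ v) ∷ʳ coeff₁ w) (frob-n v) ⟩
    coeffs n-1 (φ v) ∷ʳ coeff₁ v             ∎
    where
    n-1 = 2 ℕ.+ h ℕ.* 2

  orbit-frob : ∀ j v → orbit (frob j v) ≡ iterate rotate (orbit v) j
  orbit-frob zero    v = refl
  orbit-frob (suc j) v = trans (orbit-frob j (φ v)) (cong (λ w → iterate rotate w j) (orbit-φ v))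

  -- (e , s , j) stands for the class `frob j (class e s)` of an edge after j applications of φ. By
  -- `length-spec` there are (2ⁿ - 2)/6 of these.
  classes : List (Base × (Fin 3 × ℕ))
  classes = cartesianProduct es (cartesianProduct (allFin 3) (upTo n))

  key : Base × (Fin 3 × ℕ) → Vec Bool n
  key (e , s , j) = iterate rotate (orbit (class e s)) j

  keys-classes : keys es ≡ map key classes
  keys-classes = sym (begin
    map key classes
      ≡⟨ map-cartesianProduct key es _ ⟩
    concatMap (λ e → map (λ sj → key (e , sj)) (cartesianProduct (allFin 3) (upTo n))) es
      ≡⟨ Listₚ.concatMap-cong (λ e → map-cartesianProduct (λ sj → key (e , sj)) (allFin 3) (upTo n)) es ⟩
    concatMap (λ e → concatMap (λ s → map (λ j → key (e , s , j)) (upTo n)) (allFin 3)) es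
      ≡⟨ Listₚ.concatMap-cong (λ e → Listₚ.concatMap-cong (rotations e) (allFin 3)) es ⟩
    keys es ∎)
    where
    rotations : ∀ e s → map (λ j → key (e , s , j)) (upTo n) ≡
                        List.iterate rotate (combine (class e s) (columns orbit)) n
    rotations e s = begin
      map (iterate rotate (orbit (class e s))) (upTo n)
        ≡⟨ iterate-map rotate (orbit (class e s)) n ⟨
      List.iterate rotate (orbit (class e s)) n
        ≡⟨ cong (λ w → List.iterate rotate w n) (combine-columns {f = orbit} orbit-additive (class e s)) ⟨
      List.iterate rotate (combine (class e s) (columns orbit)) n ∎

  keys-unique : Unique (map key classes)
  keys-unique = subst Unique keys-classes (distinct⇒unique (keys es) distinct-spec)

  classes-unique : Unique classes
  classes-unique = Uniqueₚ.map⁻ keys-unique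

  -- Equal classes have equal coefficient vectors, hence equal keys, and the keys are pairwise
  -- distinct.
  frob-class-injective : ∀ {e s j e′ s′ j′} → (e , s , j) ∈ classes → (e′ , s′ , j′) ∈ classes →
    frob j (class e s) ≡ frob j′ (class e′ s′) → (e , s , j) ≡ (e′ , s′ , j′)
  frob-class-injective {e} {s} {j} {e′} {s′} {j′} c∈ c∈′ eq = unique-map-injective keys-unique c∈ c∈′ (begin
    iterate rotate (orbit (class e s)) j    ≡⟨ orbit-frob j (class e s) ⟨
    orbit (frob j (class e s))              ≡⟨ cong orbit eq ⟩
    orbit (frob j′ (class e′ s′))           ≡⟨ orbit-frob j′ (class e′ s′) ⟩
    iterate rotate (orbit (class e′ s′)) j′ ∎)

  ∈-classes : ∀ {e} s {j} → e ∈ es → j ∈ upTo n → (e , s , j) ∈ classes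
  ∈-classes s e∈ j∈ = ∈-cartesianProduct⁺ e∈ (∈-cartesianProduct⁺ (∈-allFin s) j∈)

  classes-∈ : ∀ {e s j} → (e , s , j) ∈ classes → e ∈ es × j ∈ upTo n
  classes-∈ c∈ =
    let e∈ , sj∈ = ∈-cartesianProduct⁻ es _ c∈
    in e∈ , proj₂ (∈-cartesianProduct⁻ (allFin 3) (upTo n) sj∈)

  -- The edges of the base triangles and their scalar multiples.

  triangle : Base → Triple
  triangle (u ∷ v ∷ _) = 𝟙 , u , u * v

  edge : Triple → Fin 3 → V × V
  edge (a , b , c) 0F = a , b
  edge (a , b , c) 1F = b , c
  edge (a , b , c) 2F = c , a

  valid : ∀ {e} → e ∈ es → Valid e
  valid = All.lookup valid-spec

  ⊛-⊞ : ∀ t → t ⊛ t ⊞ t ≡ t * t + t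
  ⊛-⊞ t = trans (⊞-⊕ (t ⊛ t) t) (cong (_+ t) (⊛-* t t))

  validRatio-* : ∀ t z → ValidRatio t z → (t * t + t) * z ≡ 𝟙
  validRatio-* t z ok = begin
    (t * t + t) * z  ≡⟨ cong (_* z) (⊛-⊞ t) ⟨
    (t ⊛ t ⊞ t) * z  ≡⟨ ⊛-* (t ⊛ t ⊞ t) z ⟨
    (t ⊛ t ⊞ t) ⊛ z  ≡⟨ ok ⟩
    𝟙                ∎

  ratio-hasClass : ∀ t z → ValidRatio t z → HasClass 𝟙 t ((t ⊞ z) ⊛ (t ⊞ z) ⊞ (t ⊞ z))
  ratio-hasClass t z ok = subst (HasClass 𝟙 t)
    (sym (trans (⊛-⊞ (t ⊞ z)) (cong (λ d → d * d + d) (⊞-⊕ t z))))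
    (hasClass-ratio t z (validRatio-* t z ok))

  ratio-indep : ∀ t z → ValidRatio t z → Indep2 𝟙 t
  ratio-indep t z ok = 𝟙≢𝟘 , (λ t≡𝟘 → y≢𝟘 (trans (cong (λ t → t * t + t) t≡𝟘) (trans (⊕-identityʳ _) (zeroʳ 𝟘)))) ,
    (λ 𝟙+t≡𝟘 → y≢𝟘 (trans (cong (λ t → t * t + t) (sym (⊕-cancel 𝟙 t 𝟙+t≡𝟘))) (trans (cong (_+ 𝟙) (*-identityʳ 𝟙)) (⊕-self 𝟙))))
    where
    y≢𝟘 : t * t + t ≢ 𝟘
    y≢𝟘 y≡𝟘 = 𝟙≢𝟘 (trans (sym (validRatio-* t z ok)) (trans (cong (_* z) y≡𝟘) (zeroˡ z)))

  indep2-scale : ∀ {c a b} → c ≢ 𝟘 → Indep2 a b → Indep2 (c * a) (c * b)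
  indep2-scale {c} c≢𝟘 = hom-indep2 (*-distribˡ-+ c) (*-≢𝟘 c≢𝟘)

  edge-indep : ∀ e s → Valid e → let a , b = edge (triangle e) s in Indep2 a b
  edge-indep (u ∷ v ∷ x ∷ y ∷ z ∷ []) 0F (ok , _) = ratio-indep u x ok
  edge-indep (u ∷ v ∷ x ∷ y ∷ z ∷ []) 1F (okᵤ , okᵥ , _) =
    subst (λ w → Indep2 w (u * v)) (*-identityʳ u) (indep2-scale (proj₁ (proj₂ (ratio-indep u x okᵤ))) (ratio-indep v y okᵥ))
  edge-indep (u ∷ v ∷ x ∷ y ∷ z ∷ []) 2F (_ , _ , ok , _) =
    let 𝟙≢ , w≢ , +≢ = ratio-indep (u * v) z (subst (λ w → ValidRatio w z) (⊛-* u v) ok)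
    in w≢ , 𝟙≢ , λ eq → +≢ (trans (⊕-comm 𝟙 (u * v)) eq)

  -- The edge ⟨u,uv⟩ is u·⟨1,v⟩ and inherits the class of ⟨1,v⟩; the edge ⟨uv,1⟩ is ⟨1,uv⟩ with its
  -- basis exchanged.
  edge-hasClass : ∀ e s → Valid e → let a , b = edge (triangle e) s in HasClass a b (class e s)
  edge-hasClass (u ∷ v ∷ x ∷ y ∷ z ∷ []) 0F (ok , _) = ratio-hasClass u x ok
  edge-hasClass (u ∷ v ∷ x ∷ y ∷ z ∷ []) 1F (_ , ok , _) =
    subst (λ w → HasClass w (u * v) i) (*-identityʳ u) (hasClass-scale {𝟙} {v} {i} u (ratio-hasClass v y ok))
    where
    i = class (u ∷ v ∷ x ∷ y ∷ z ∷ []) 1F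
  edge-hasClass e@(u ∷ v ∷ x ∷ y ∷ z ∷ []) 2F ok@(_ , _ , okw , _) =
    hasClass-sameSpan {𝟙} {u * v} {u * v} {𝟙} {i} (edge-indep e 2F ok)
      (sameSpan-sym (sameSpan-point 1F 0F λ ()))
      (subst (λ w → HasClass 𝟙 w i) (⊛-* u v) (ratio-hasClass (u ⊛ v) z okw))
    where
    i = class e 2F

  -- If Q vanished, the class would be 𝟙, a fixed point of φ, against the distinctness of the keys.
  edge-Q≢𝟘 : ∀ {e} s → e ∈ es → let a , b = edge (triangle e) s in Q a b ≢ 𝟘
  edge-Q≢𝟘 {e} s e∈ Q≡𝟘 = 0≢1 (frob-class-injective
    (∈-classes s e∈ (∈-upTo⁺ (ℕ.s≤s ℕ.z≤n))) (∈-classes s e∈ (∈-upTo⁺ (ℕ.s≤s (ℕ.s≤s ℕ.z≤n))))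
    (trans i≡𝟙 (sym (trans (cong φ i≡𝟙) φ-𝟙))))
    where
    a = proj₁ (edge (triangle e) s)
    b = proj₂ (edge (triangle e) s)
    i≡𝟙 : class e s ≡ 𝟙
    i≡𝟙 = hasClass-unique {a} {b} (edge-indep e s (valid e∈)) (edge-hasClass e s (valid e∈)) (begin
      𝟙 * (Λ a b * Λ a b)      ≡⟨ *-identityˡ _ ⟩
      Λ a b * Λ a b            ≡⟨ ⊕-identityˡ _ ⟨
      𝟘 + Λ a b * Λ a b        ≡⟨ cong (_+ Λ a b * Λ a b) (trans (cong (_* Q a b) (trans (cong (_* Q a b) Q≡𝟘) (zeroˡ _))) (zeroˡ _)) ⟨
      Q a b * Q a b * Q a b + Λ a b * Λ a b ∎)
    0≢1 : (e , s , 0) ≢ (e , s , 1)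
    0≢1 ()

  endˡ endʳ : Base × (Fin 3 × ℕ) → V
  endˡ (e , s , j) = frob j (proj₁ (edge (triangle e) s))
  endʳ (e , s , j) = frob j (proj₂ (edge (triangle e) s))

  ends-indep : ∀ {x} → x ∈ classes → Indep2 (endˡ x) (endʳ x)
  ends-indep {e , s , j} x∈ =
    hom-indep2 (frob-+ j) (frob-≢𝟘 j) (edge-indep e s (valid (proj₁ (classes-∈ x∈))))

  ends-hasClass : ∀ {e s j} c → (e , s , j) ∈ classes →
                  HasClass (c * endˡ (e , s , j)) (c * endʳ (e , s , j)) (frob j (class e s))
  ends-hasClass {e} {s} {j} c x∈ =
    hasClass-scale {frob j a} {frob j b} {frob j i} c
      (hasClass-frob j {a} {b} {i} (edge-hasClass e s (valid (proj₁ (classes-∈ x∈)))))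
    where
    i = class e s
    a = proj₁ (edge (triangle e) s)
    b = proj₂ (edge (triangle e) s)

  ends-Q≢𝟘 : ∀ {x} → x ∈ classes → Q (endˡ x) (endʳ x) ≢ 𝟘
  ends-Q≢𝟘 {e , s , j} x∈ Q≡𝟘 =
    frob-≢𝟘 j (edge-Q≢𝟘 s (proj₁ (classes-∈ x∈)))
      (trans (frob-Q j (proj₁ (edge (triangle e) s)) (proj₂ (edge (triangle e) s))) Q≡𝟘)

  -- The class gives x = x′. As Q scales by squares, c² Q = c′² Q, and Q ≠ 𝟘 yields c = c′. A plane
  -- with Q = 𝟘 would be a multiple of 𝔽₄ and thus be stabilised by three scalars; this is the one
  -- way in which freeness could fail.
  plane-unique : ∀ {x x′ c c′} → x ∈ classes → x′ ∈ classes → c ≢ 𝟘 → c′ ≢ 𝟘 →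
    SameSpan (c * endˡ x) (c * endʳ x) (c′ * endˡ x′) (c′ * endʳ x′) → x ≡ x′ × c ≡ c′
  plane-unique {x@(e , s , j)} {x′@(e′ , s′ , j′)} {c} {c′} x∈ x∈′ c≢𝟘 c′≢𝟘 same =
    x≡x′ , *-injective-square c c′ (scalar x≡x′)
    where
    ind′ : Indep2 (c′ * endˡ x′) (c′ * endʳ x′)
    ind′ = indep2-scale c′≢𝟘 (ends-indep x∈′)
    x≡x′ : x ≡ x′
    x≡x′ = frob-class-injective x∈ x∈′
      (hasClass-unique {c′ * endˡ x′} {c′ * endʳ x′} ind′
        (hasClass-sameSpan {c * endˡ x} {c * endʳ x} {c′ * endˡ x′} {c′ * endʳ x′} {frob j (class e s)}
          ind′ same (ends-hasClass c x∈))
        (ends-hasClass c′ x∈′))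
    scalar : x ≡ x′ → c * c ≡ c′ * c′
    scalar x≡x′ = *-cancelˡ (c * c) (c′ * c′) (ends-Q≢𝟘 x∈) (begin
      q x * (c * c)                    ≡⟨ *-comm (q x) (c * c) ⟩
      c * c * q x                      ≡⟨ Q-scale c (endˡ x) (endʳ x) ⟨
      Q (c * endˡ x) (c * endʳ x)      ≡⟨ Q-sameSpan ind′ same ⟨
      Q (c′ * endˡ x′) (c′ * endʳ x′)  ≡⟨ Q-scale c′ (endˡ x′) (endʳ x′) ⟩
      c′ * c′ * q x′                   ≡⟨ *-comm (c′ * c′) (q x′) ⟩
      q x′ * (c′ * c′)                 ≡⟨ cong (λ y → q y * (c′ * c′)) x≡x′ ⟨
      q x * (c′ * c′)                  ∎)
      where
      q : Base × (Fin 3 × ℕ) → V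
      q y = Q (endˡ y) (endʳ y)

  -- Counting slopes: every plane occurs.

  apart? : (f : Fin 3 × Fin 3) → Dec (proj₁ f ≢ proj₂ f)
  apart? (k , l) = ¬? (k Fin.≟ l)

  -- The six ordered bases of a plane, in terms of the numbering by `point`.
  frames : List (Fin 3 × Fin 3)
  frames = filter apart? (cartesianProduct (allFin 3) (allFin 3))

  frames-unique : Unique frames
  frames-unique = Uniqueₚ.filter⁺ apart? (Uniqueₚ.cartesianProduct⁺ (Uniqueₚ.allFin⁺ 3) (Uniqueₚ.allFin⁺ 3))

  frames-≢ : ∀ {k l} → (k , l) ∈ frames → k ≢ l
  frames-≢ f∈ = proj₂ (∈-filter⁻ apart? {xs = cartesianProduct (allFin 3) (allFin 3)} f∈)

  pointOf : Base × (Fin 3 × ℕ) → Fin 3 → V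
  pointOf x = point (endˡ x) (endʳ x)

  point-scale : ∀ c a b k → c * point a b k ≡ point (c * a) (c * b) k
  point-scale c a b 0F = refl
  point-scale c a b 1F = refl
  point-scale c a b 2F = *-distribˡ-+ c a b

  *-inverseˡ : ∀ {v} → v ≢ 𝟘 → v ⁻¹ * v ≡ 𝟙
  *-inverseˡ {v} v≢𝟘 = trans (*-comm (v ⁻¹) v) (*-inverseʳ v≢𝟘)

  ⁻¹-≢𝟘 : ∀ {v} → v ≢ 𝟘 → v ⁻¹ ≢ 𝟘
  ⁻¹-≢𝟘 {v} v≢𝟘 eq = 𝟙≢𝟘 (trans (sym (*-inverseʳ v≢𝟘)) (trans (cong (v *_) eq) (zeroʳ v)))

  ⁻¹-injective : ∀ {v w} → v ≢ 𝟘 → w ≢ 𝟘 → v ⁻¹ ≡ w ⁻¹ → v ≡ w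
  ⁻¹-injective {v} {w} v≢𝟘 w≢𝟘 eq = *-cancelˡ v w (⁻¹-≢𝟘 v≢𝟘)
    (trans (*-inverseˡ v≢𝟘) (sym (trans (cong (_* w) eq) (*-inverseˡ w≢𝟘))))

  codes : List ((Fin 3 × Fin 3) × (Base × (Fin 3 × ℕ)))
  codes = cartesianProduct frames classes

  -- Dividing by the k-th point gives a plane through 𝟙, and this is its l-th point. A scalar orbit
  -- contains three planes through 𝟙, each of the form ⟨1,t⟩ for two values of t, whence six slopes.
  slope : (Fin 3 × Fin 3) × (Base × (Fin 3 × ℕ)) → V
  slope ((k , l) , x) = pointOf x k ⁻¹ * pointOf x l

  pointOf-≢𝟘 : ∀ {x} → x ∈ classes → ∀ k → pointOf x k ≢ 𝟘
  pointOf-≢𝟘 x∈ = point-≢𝟘 (ends-indep x∈)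

  slope-span : ∀ {x} k l → k ≢ l → x ∈ classes → let c = pointOf x k ⁻¹ in
               SameSpan 𝟙 (slope ((k , l) , x)) (c * endˡ x) (c * endʳ x)
  slope-span {x} k l k≢l x∈ = subst₂ (λ p q → SameSpan p q (c * endˡ x) (c * endʳ x))
    (trans (sym (point-scale c (endˡ x) (endʳ x) k)) (*-inverseˡ (pointOf-≢𝟘 x∈ k)))
    (sym (point-scale c (endˡ x) (endʳ x) l))
    (sameSpan-point k l k≢l)
    where
    c = pointOf x k ⁻¹

  -- Equal slopes span the same plane with 𝟙. By `plane-unique` the indices agree and so do the
  -- inverses of the k-th and k′-th points; this gives k = k′, and then the slopes give l = l′.
  slope-injective : ∀ {y y′} → y ∈ codes → y′ ∈ codes → slope y ≡ slope y′ → y ≡ y′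
  slope-injective {(k , l) , x} {(k′ , l′) , x′} y∈ y∈′ eq =
    conclude (proj₁ unique) (proj₂ unique)
    where
    f∈ = proj₁ (∈-cartesianProduct⁻ frames classes y∈)
    x∈ = proj₂ (∈-cartesianProduct⁻ frames classes y∈)
    f∈′ = proj₁ (∈-cartesianProduct⁻ frames classes y∈′)
    x∈′ = proj₂ (∈-cartesianProduct⁻ frames classes y∈′)
    unique : x ≡ x′ × pointOf x k ⁻¹ ≡ pointOf x′ k′ ⁻¹
    unique = plane-unique x∈ x∈′ (⁻¹-≢𝟘 (pointOf-≢𝟘 x∈ k)) (⁻¹-≢𝟘 (pointOf-≢𝟘 x∈′ k′))
      (sameSpan-trans (sameSpan-sym (slope-span k l (frames-≢ f∈) x∈))
        (subst (λ t → SameSpan 𝟙 t _ _) (sym eq) (slope-span k′ l′ (frames-≢ f∈′) x∈′)))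
    conclude : x ≡ x′ → pointOf x k ⁻¹ ≡ pointOf x′ k′ ⁻¹ → ((k , l) , x) ≡ ((k′ , l′) , x′)
    conclude refl c≡ = cong₂ (λ k l → (k , l) , x)
      (point-injective (ends-indep x∈) k k′ (⁻¹-injective (pointOf-≢𝟘 x∈ k) (pointOf-≢𝟘 x∈ k′) c≡))
      (point-injective (ends-indep x∈) l l′ (*-cancelˡ _ _ (⁻¹-≢𝟘 (pointOf-≢𝟘 x∈ k))
        (trans eq (cong (_* pointOf x l′) (sym c≡)))))

  slope-≢𝟘 : ∀ {y} → y ∈ codes → slope y ≢ 𝟘
  slope-≢𝟘 {(k , l) , x} y∈ = *-≢𝟘 (⁻¹-≢𝟘 (pointOf-≢𝟘 x∈ k)) (pointOf-≢𝟘 x∈ l)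
    where x∈ = proj₂ (∈-cartesianProduct⁻ frames classes y∈)

  slope-≢𝟙 : ∀ {y} → y ∈ codes → slope y ≢ 𝟙
  slope-≢𝟙 {(k , l) , x} y∈ eq = frames-≢ (proj₁ (∈-cartesianProduct⁻ frames classes y∈))
    (point-injective (ends-indep x∈) k l (*-cancelˡ _ _ (⁻¹-≢𝟘 (pointOf-≢𝟘 x∈ k))
      (trans (*-inverseˡ (pointOf-≢𝟘 x∈ k)) (sym eq))))
    where x∈ = proj₂ (∈-cartesianProduct⁻ frames classes y∈)

  slopes-unique : Unique (𝟘 ∷ 𝟙 ∷ map slope codes)
  slopes-unique =
    ((𝟙≢𝟘 ∘ sym) ∷ avoid λ y∈ → slope-≢𝟘 y∈ ∘ sym) ∷
    avoid (λ y∈ → slope-≢𝟙 y∈ ∘ sym) ∷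
    unique-map slope-injective (Uniqueₚ.cartesianProduct⁺ frames-unique classes-unique)
    where
    avoid : ∀ {v} → (∀ {y} → y ∈ codes → v ≢ slope y) → All (v ≢_) (map slope codes)
    avoid f = Allₚ.map⁺ (All.tabulate f)

  length-codes : length codes ≡ 6 ℕ.* (length es ℕ.* (3 ℕ.* n))
  length-codes = begin
    length codes
      ≡⟨ length-cartesianProduct frames classes ⟩
    6 ℕ.* length classes
      ≡⟨ cong (6 ℕ.*_) (length-cartesianProduct es _) ⟩
    6 ℕ.* (length es ℕ.* length (cartesianProduct (allFin 3) (upTo n)))
      ≡⟨ cong (λ m → 6 ℕ.* (length es ℕ.* m)) (length-cartesianProduct (allFin 3) (upTo n)) ⟩
    6 ℕ.* (length es ℕ.* (3 ℕ.* length (upTo n)))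
      ≡⟨ cong (λ m → 6 ℕ.* (length es ℕ.* (3 ℕ.* m))) (Listₚ.length-upTo n) ⟩
    6 ℕ.* (length es ℕ.* (3 ℕ.* n)) ∎

  -- The slopes are pairwise distinct, so the count in the certificate shows that they exhaust V ∖ {𝟘, 𝟙}.
  slopes-complete : ∀ t → t ∈ 𝟘 ∷ 𝟙 ∷ map slope codes
  slopes-complete = unique⇒complete slopes-unique
    (trans (cong (2 ℕ.+_) (trans (Listₚ.length-map slope codes) length-codes)) length-spec)

  -- Dividing by `a` turns the plane into ⟨1,t⟩ with t = b/a, and independence excludes the values 𝟘
  -- and 𝟙, so `t` is a slope.
  plane-exists : ∀ {a b} → Indep2 a b →
    ∃₂ λ c x → c ≢ 𝟘 × x ∈ classes × SameSpan a b (c * endˡ x) (c * endʳ x)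
  plane-exists {a} {b} (a≢𝟘 , b≢𝟘 , a+b≢𝟘) = cases (slopes-complete t)
    where
    t = a ⁻¹ * b
    a*t≡b : a * t ≡ b
    a*t≡b = begin
      a * (a ⁻¹ * b)  ≡⟨ *-assoc a (a ⁻¹) b ⟨
      a * a ⁻¹ * b    ≡⟨ cong (_* b) (*-inverseʳ a≢𝟘) ⟩
      𝟙 * b           ≡⟨ *-identityˡ b ⟩
      b               ∎
    fromSlope : (∃ λ y → y ∈ codes × t ≡ slope y) →
                ∃₂ λ c x → c ≢ 𝟘 × x ∈ classes × SameSpan a b (c * endˡ x) (c * endʳ x)
    fromSlope (((k , l) , x) , y∈ , t≡) = c , x , *-≢𝟘 a≢𝟘 (⁻¹-≢𝟘 P≢𝟘) , x∈ ,
      subst₂ (λ p q → SameSpan p q (c * endˡ x) (c * endʳ x)) k-point l-point (sameSpan-point k l k≢l)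
      where
      x∈ = proj₂ (∈-cartesianProduct⁻ frames classes y∈)
      k≢l = frames-≢ (proj₁ (∈-cartesianProduct⁻ frames classes y∈))
      P≢𝟘 = pointOf-≢𝟘 x∈ k
      -- This scalar moves the k-th point to `a`, and therefore the l-th point to a·t = b.
      c = a * pointOf x k ⁻¹
      k-point : point (c * endˡ x) (c * endʳ x) k ≡ a
      k-point = begin
        point (c * endˡ x) (c * endʳ x) k     ≡⟨ point-scale c (endˡ x) (endʳ x) k ⟨
        a * pointOf x k ⁻¹ * pointOf x k      ≡⟨ *-assoc a _ _ ⟩
        a * (pointOf x k ⁻¹ * pointOf x k)    ≡⟨ cong (a *_) (*-inverseˡ P≢𝟘) ⟩
        a * 𝟙                                 ≡⟨ *-identityʳ a ⟩
        a                                     ∎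
      l-point : point (c * endˡ x) (c * endʳ x) l ≡ b
      l-point = begin
        point (c * endˡ x) (c * endʳ x) l     ≡⟨ point-scale c (endˡ x) (endʳ x) l ⟨
        a * pointOf x k ⁻¹ * pointOf x l      ≡⟨ *-assoc a _ _ ⟩
        a * slope ((k , l) , x)               ≡⟨ cong (a *_) t≡ ⟨
        a * t                                 ≡⟨ a*t≡b ⟩
        b                                     ∎
    cases : t ∈ 𝟘 ∷ 𝟙 ∷ map slope codes →
            ∃₂ λ c x → c ≢ 𝟘 × x ∈ classes × SameSpan a b (c * endˡ x) (c * endʳ x)
    cases (here t≡𝟘)          = contradiction (trans (sym a*t≡b) (trans (cong (a *_) t≡𝟘) (zeroʳ a))) b≢𝟘
    cases (there (here t≡𝟙))  =
      contradiction (trans (sym (*-identityʳ a)) (trans (cong (a *_) (sym t≡𝟙)) a*t≡b)) (+≢𝟘⇒≢ a+b≢𝟘)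
    cases (there (there t∈))  = fromSlope (∈-map⁻ slope t∈)

  -- The design as a list of triangles.

  spanIn⇒edge : ∀ {a b} T → SpanIn a b T → ∃ λ s → SameSpan a b (proj₁ (edge T s)) (proj₂ (edge T s))
  spanIn⇒edge T (inj₁ same)        = 0F , same
  spanIn⇒edge T (inj₂ (inj₁ same)) = 1F , same
  spanIn⇒edge T (inj₂ (inj₂ same)) = 2F , same

  scalars : List V
  scalars = filter (λ v → ¬? (v ≟ 𝟘)) (allVecs n)

  ∈-scalars : ∀ {c} → c ≢ 𝟘 → c ∈ scalars
  ∈-scalars {c} = ∈-filter⁺ (λ v → ¬? (v ≟ 𝟘)) (∈-allVecs c)

  scalars-≢𝟘 : ∀ {c} → c ∈ scalars → c ≢ 𝟘
  scalars-≢𝟘 c∈ = proj₂ (∈-filter⁻ (λ v → ¬? (v ≟ 𝟘)) {xs = allVecs n} c∈)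

  indices : List (V × (Base × ℕ))
  indices = cartesianProduct scalars (cartesianProduct es (upTo n))

  ∈-indices : ∀ {c e j} → c ≢ 𝟘 → e ∈ es → j ∈ upTo n → (c , e , j) ∈ indices
  ∈-indices c≢𝟘 e∈ j∈ = ∈-cartesianProduct⁺ (∈-scalars c≢𝟘) (∈-cartesianProduct⁺ e∈ j∈)

  indices-∈ : ∀ {c e j} → (c , e , j) ∈ indices → c ≢ 𝟘 × e ∈ es × j ∈ upTo n
  indices-∈ i∈ =
    let c∈ , ej∈ = ∈-cartesianProduct⁻ scalars (cartesianProduct es (upTo n)) i∈
    in scalars-≢𝟘 c∈ , ∈-cartesianProduct⁻ es (upTo n) ej∈

  indices-unique : Unique indices
  indices-unique = Uniqueₚ.cartesianProduct⁺ (Uniqueₚ.filter⁺ _ (allVecs-unique n))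
    (Uniqueₚ.cartesianProduct⁺
      -- A repeated base triangle would repeat a class, because the other factor of `classes` is
      -- nonempty.
      (unique-cartesianProduct⁻ (∈-cartesianProduct⁺ (∈-allFin 0F) (∈-upTo⁺ {n} {0} (ℕ.s≤s ℕ.z≤n))) es classes-unique)
      (Uniqueₚ.upTo⁺ n))

  translate : V × (Base × ℕ) → Triple
  translate (c , e , j) = mapTriple (c *_) (mapTriple (frob j) (triangle e))

  design : List Triple
  design = map translate indices

  translate-spanIn : ∀ {a b} c e j → SpanIn a b (translate (c , e , j)) →
    ∃ λ s → SameSpan a b (c * endˡ (e , s , j)) (c * endʳ (e , s , j))
  translate-spanIn c e j sp with spanIn⇒edge (translate (c , e , j)) sp
  ... | 0F , same = 0F , same
  ... | 1F , same = 1F , same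
  ... | 2F , same = 2F , same

  spanIn-translate : ∀ {a b} c e s j → SameSpan a b (c * endˡ (e , s , j)) (c * endʳ (e , s , j)) →
                     SpanIn a b (translate (c , e , j))
  spanIn-translate c e 0F j same = inj₁ same
  spanIn-translate c e 1F j same = inj₂ (inj₁ same)
  spanIn-translate c e 2F j same = inj₂ (inj₂ same)

  -- A common plane already fixes the scalar, the base triangle, the edge and the power of φ, by
  -- `plane-unique`.
  translate-unique : ∀ {a b i i′} → i ∈ indices → i′ ∈ indices →
                     SpanIn a b (translate i) → SpanIn a b (translate i′) → i ≡ i′
  translate-unique {i = c , e , j} {c′ , e′ , j′} i∈ i∈′ sp sp′ =
    let c≢𝟘 , e∈ , j∈ = indices-∈ i∈
        c′≢𝟘 , e∈′ , j∈′ = indices-∈ i∈′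
        s , same = translate-spanIn c e j sp
        s′ , same′ = translate-spanIn c′ e′ j′ sp′
        x≡x′ , c≡c′ = plane-unique (∈-classes s e∈ j∈) (∈-classes s′ e∈′ j∈′) c≢𝟘 c′≢𝟘
                        (sameSpan-trans (sameSpan-sym same) same′)
    in cong₂ (λ c (e , s , j) → c , e , j) c≡c′ x≡x′

  -- Equal triples share their first edge, so `translate-unique` applies to that edge.
  design-unique : Unique design
  design-unique = unique-map
    (λ i∈ i∈′ eq → translate-unique i∈ i∈′ (inj₁ sameSpan-refl) (subst (SpanIn _ _) eq (inj₁ sameSpan-refl)))
    indices-unique

  triangle-indep : ∀ e → Valid e → let a , b , c = triangle e in Indep3 a b c
  triangle-indep e@(u ∷ v ∷ _) ok@(_ , _ , _ , third) =
    let 𝟙≢ , u≢ , 𝟙+u≢ = edge-indep e 0F ok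
        _ , w≢ , u+w≢ = edge-indep e 1F ok
        _ , _ , w+𝟙≢ = edge-indep e 2F ok
    in 𝟙≢ , u≢ , w≢ , 𝟙+u≢ , u+w≢ , w+𝟙≢ , subst (λ w → 𝟙 + u + w ≢ 𝟘) (⊛-* u v) third

  isTriangleDesign : IsTriangleDesign design
  isTriangleDesign = All.tabulate indep3 , covered
    where
    indep3 : ∀ {T} → T ∈ design → let a , b , c = T in Indep3 a b c
    indep3 T∈ with ∈-map⁻ translate T∈
    ... | (c , e , j) , i∈ , refl =
      let c≢𝟘 , e∈ , _ = indices-∈ i∈
      in hom-indep3 (*-distribˡ-+ c) (*-≢𝟘 c≢𝟘) (hom-indep3 (frob-+ j) (frob-≢𝟘 j) (triangle-indep e (valid e∈)))
    covered : ∀ a b → Indep2 a b →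
      Σ (Fin (length design)) λ i → SpanIn a b (List.lookup design i) ×
        (∀ j → SpanIn a b (List.lookup design j) → j ≡ i)
    covered a b ind =
      let c , (e , s , j) , c≢𝟘 , x∈ , same = plane-exists ind
          e∈ , j∈ = classes-∈ x∈
          T∈ = ∈-map⁺ translate (∈-indices c≢𝟘 e∈ j∈)
          sp = subst (SpanIn a b) (lookup-index T∈) (spanIn-translate c e s j same)
      -- Uniqueness concerns positions in the list: two positions holding the plane carry equal
      -- triples, and the list has no repetitions.
      in Any.index T∈ , sp , λ k sp′ → unique⇒lookup-injective design-unique k (Any.index T∈) (same-triangle k (Any.index T∈) sp′ sp)
      where
      same-triangle : ∀ k l → SpanIn a b (List.lookup design k) → SpanIn a b (List.lookup design l) →
                      List.lookup design k ≡ List.lookup design l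
      same-triangle k l sp sp′ =
        let i , i∈ , eq = ∈-map⁻ translate (∈-lookup {xs = design} k)
            i′ , i∈′ , eq′ = ∈-map⁻ translate (∈-lookup {xs = design} l)
        in trans eq (trans (cong translate (translate-unique i∈ i∈′ (subst (SpanIn a b) eq sp) (subst (SpanIn a b) eq′ sp′))) (sym eq′))

  -- Invariance under scalars and automorphisms.

  triple-≡ : ∀ {a b c a′ b′ c′ : V} → a ≡ a′ → b ≡ b′ → c ≡ c′ → (a , b , c) ≡ (a′ , b′ , c′)
  triple-≡ refl refl refl = refl

  design-scale : ∀ {x T} → x ≢ 𝟘 → T ∈ design → mapTriple (x *_) T ∈ design
  design-scale {x} x≢𝟘 T∈ with ∈-map⁻ translate T∈
  ... | (c , e , j) , i∈ , refl =
    let c≢𝟘 , e∈ , j∈ = indices-∈ i∈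
    in subst (_∈ design) (triple-≡ (*-assoc x c _) (*-assoc x c _) (*-assoc x c _))
         (∈-map⁺ translate (∈-indices (*-≢𝟘 x≢𝟘 c≢𝟘) e∈ j∈))

  -- φᵏ(c · φʲ T) = φᵏ(c) · φʲ⁺ᵏ T; the exponent is reduced modulo n to stay within the index range.
  design-frob : ∀ k {T} → T ∈ design → mapTriple (frob k) T ∈ design
  design-frob k T∈ with ∈-map⁻ translate T∈
  ... | (c , e , j) , i∈ , refl =
    let c≢𝟘 , e∈ , _ = indices-∈ i∈
    in subst (_∈ design) (triple-≡ (move _) (move _) (move _))
         (∈-map⁺ translate (∈-indices (frob-≢𝟘 k c≢𝟘) e∈ (∈-upTo⁺ (ℕₚ.m%n<n (j ℕ.+ k) n))))
    where
    move : ∀ v → frob k c * frob ((j ℕ.+ k) ℕ.% n) v ≡ frob k (c * frob j v)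
    move v = begin
      frob k c * frob ((j ℕ.+ k) ℕ.% n) v  ≡⟨ cong (frob k c *_) (frob-% (j ℕ.+ k) v) ⟩
      frob k c * frob (j ℕ.+ k) v          ≡⟨ cong (frob k c *_) (frob-ℕ+ j k v) ⟩
      frob k c * frob k (frob j v)         ≡⟨ frob-* k c (frob j v) ⟨
      frob k (c * frob j v)                ∎

  sameTriangle-refl : ∀ T → SameTriangle T T
  sameTriangle-refl T = self , self
    where
    self = inj₁ sameSpan-refl , inj₂ (inj₁ sameSpan-refl) , inj₂ (inj₂ sameSpan-refl)

  -- The maps in question permute the presenting triples themselves, so `SameTriangle` is applied
  -- only in its reflexive form. Closure under `g⁻¹` supplies the preimages.
  invariant : ∀ {g g⁻¹ : V → V} → (∀ v → g (g⁻¹ v) ≡ v) →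
    (∀ {T} → T ∈ design → mapTriple g T ∈ design) →
    (∀ {T} → T ∈ design → mapTriple g⁻¹ T ∈ design) → Invariant g design
  invariant {g} {g⁻¹} inverse g-closed g⁻¹-closed = forwards , backwards
    where
    at : ∀ {T} (T∈ : T ∈ design) → T ≡ List.lookup design (Any.index T∈)
    at = lookup-index
    forwards : ∀ i → Σ (Fin (length design)) λ j →
               SameTriangle (mapTriple g (List.lookup design i)) (List.lookup design j)
    forwards i =
      let T∈ = g-closed (∈-lookup {xs = design} i)
      in Any.index T∈ , subst (SameTriangle _) (at T∈) (sameTriangle-refl _)
    backwards : ∀ j → Σ (Fin (length design)) λ i →
                SameTriangle (mapTriple g (List.lookup design i)) (List.lookup design j)
    backwards j =
      let T∈ = g⁻¹-closed (∈-lookup {xs = design} j)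
      in Any.index T∈ , subst (λ T → SameTriangle (mapTriple g T) (List.lookup design j)) (at T∈)
           (subst (λ T → SameTriangle T (List.lookup design j))
             (sym (triple-≡ (inverse _) (inverse _) (inverse _))) (sameTriangle-refl _))

  *-⁻¹-cancel : ∀ {x} → x ≢ 𝟘 → ∀ v → x * (x ⁻¹ * v) ≡ v
  *-⁻¹-cancel {x} x≢𝟘 v = trans (sym (*-assoc x (x ⁻¹) v)) (trans (cong (_* v) (*-inverseʳ x≢𝟘)) (*-identityˡ v))

  scale-invariant : ∀ x → x ≢ 𝟘 → Invariant (x *_) design
  scale-invariant x x≢𝟘 = invariant {x *_} {x ⁻¹ *_} (*-⁻¹-cancel x≢𝟘) (design-scale x≢𝟘) (design-scale (⁻¹-≢𝟘 x≢𝟘))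

  automorphism-invariant : ∀ σ → IsFieldAut σ → Invariant σ design
  automorphism-invariant σ aut =
    let j , j<n , σ≡ = automorphism-frob σ aut
    -- Since φⁿ = id and j < n, the inverse of φʲ is φ to the power n - j.
    in invariant {σ} {frob (n ℕ.∸ j)}
         (λ v → begin
           σ (frob (n ℕ.∸ j) v)         ≡⟨ σ≡ _ ⟩
           frob j (frob (n ℕ.∸ j) v)    ≡⟨ frob-ℕ+ (n ℕ.∸ j) j v ⟨
           frob (n ℕ.∸ j ℕ.+ j) v       ≡⟨ cong (λ k → frob k v) (ℕₚ.m∸n+n≡m (ℕₚ.<⇒≤ j<n)) ⟩
           frob n v                     ≡⟨ frob-n v ⟩
           v                            ∎)
         (λ T∈ → subst (_∈ design) (sym (triple-≡ (σ≡ _) (σ≡ _) (σ≡ _))) (design-frob j T∈))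
         (design-frob (n ℕ.∸ j))

  -- Balance.

  -- Neither list has repetitions, as scaling is injective, and both have the same elements. A
  -- permutation is what preserves the number of covering triangles.
  scaled-↭ : ∀ {x} → x ≢ 𝟘 → map (mapTriple (x *_)) design ↭ design
  scaled-↭ {x} x≢𝟘 = ∼bag⇒↭ (unique∧set⇒bag
    (Uniqueₚ.map⁺ scale-injective design-unique) design-unique
    (mk⇔ (λ T∈ → case ∈-map⁻ (mapTriple (x *_)) T∈ of λ { (_ , T∈′ , refl) → design-scale x≢𝟘 T∈′ })
         (λ T∈ → subst (_∈ map (mapTriple (x *_)) design)
                   (triple-≡ (*-⁻¹-cancel x≢𝟘 _) (*-⁻¹-cancel x≢𝟘 _) (*-⁻¹-cancel x≢𝟘 _))
                   (∈-map⁺ (mapTriple (x *_)) (design-scale (⁻¹-≢𝟘 x≢𝟘) T∈)))))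
    where
    scale-injective : ∀ {T T′} → mapTriple (x *_) T ≡ mapTriple (x *_) T′ → T ≡ T′
    scale-injective eq = triple-≡ (*-cancelˡ _ _ x≢𝟘 (cong proj₁ eq))
      (*-cancelˡ _ _ x≢𝟘 (cong (proj₁ ∘ proj₂) eq)) (*-cancelˡ _ _ x≢𝟘 (cong (proj₂ ∘ proj₂) eq))

  inSpan-scale : ∀ x {a b y} → InSpan a b y → InSpan (x * a) (x * b) (x * y)
  inSpan-scale x (inj₁ refl)                           = inj₁ (zeroʳ x)
  inSpan-scale x (inj₂ (inj₁ refl))                    = inSpanˡ
  inSpan-scale x (inj₂ (inj₂ (inj₁ refl)))             = inSpanʳ
  inSpan-scale x {a} {b} (inj₂ (inj₂ (inj₂ refl)))     = inj₂ (inj₂ (inj₂ (*-distribˡ-+ x a b)))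

  covers-scale : ∀ x T {y} → Covers T y → Covers (mapTriple (x *_) T) (x * y)
  covers-scale x T (inj₁ y∈)        = inj₁ (inSpan-scale x y∈)
  covers-scale x T (inj₂ (inj₁ y∈)) = inj₂ (inj₁ (inSpan-scale x y∈))
  covers-scale x T (inj₂ (inj₂ y∈)) = inj₂ (inj₂ (inSpan-scale x y∈))

  coverCount-scale : ∀ {x} → x ≢ 𝟘 → ∀ L y → coverCount (map (mapTriple (x *_)) L) (x * y) ≡ coverCount L y
  coverCount-scale {x} x≢𝟘 L y =
    length-filter-map (λ T → covers? T (x * y)) (λ T → covers? T y) unscale (λ {T} → covers-scale x T) L
    where
    cancel : ∀ v → x ⁻¹ * (x * v) ≡ v
    cancel v = trans (sym (*-assoc (x ⁻¹) x v)) (trans (cong (_* v) (*-inverseˡ x≢𝟘)) (*-identityˡ v))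
    unscale : ∀ {T} → Covers (mapTriple (x *_) T) (x * y) → Covers T y
    unscale {T} cov = subst₂ Covers (triple-≡ (cancel _) (cancel _) (cancel _)) (cancel y)
      (covers-scale (x ⁻¹) (mapTriple (x *_) T) cov)

  isBalanced : IsBalanced design
  -- The count at 𝟙 serves as the common value: scaling by `x` carries 𝟙 to `x` and permutes the
  -- design.
  isBalanced = coverCount design 𝟙 , λ x x≢𝟘 → begin
    coverCount design x
      ≡⟨ ↭-length (filter-↭ (λ T → covers? T x) (scaled-↭ x≢𝟘)) ⟨
    coverCount (map (mapTriple (x *_)) design) x
      ≡⟨ cong (coverCount (map (mapTriple (x *_)) design)) (*-identityʳ x) ⟨
    coverCount (map (mapTriple (x *_)) design) (x * 𝟙)
      ≡⟨ coverCount-scale x≢𝟘 design 𝟙 ⟩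
    coverCount design 𝟙 ∎

  balancedInvariantDesign : BalancedInvariantDesignExists
  balancedInvariantDesign = design , isTriangleDesign , isBalanced , scale-invariant , automorphism-invariant

-- Running the checks on concrete data.

-- With the hypothesis proved by `refl`, evaluation has to produce only the Boolean and not the
-- proof that the decision carries.
from-does : ∀ {a} {A : Set a} (a? : Dec A) → does a? ≡ true → A
from-does (yes a) refl = a

-- A variable vector blocks evaluation, whereas for a numeral length `tabulate (lookup v)` is a
-- vector with explicit entries on which functions compute.
by-lookup : ∀ {a p} {A : Set a} {k} (P : Vec A k → Set p) → (∀ v → P (Vec.tabulate (Vec.lookup v))) → ∀ v → P v
by-lookup P p v = subst P (Vecₚ.tabulate∘lookup v) (p v)

bits : ∀ k → ℕ → Vec Bool k
bits zero    x = []
bits (suc k) x = (x % 2 ≡ᵇ 1) ∷ bits k (x / 2)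

-- five k-bit numbers, least significant first
decode : ∀ k → ℕ → Vec (Vec Bool k) 5
decode k x = proj₁ (Vec.group 5 k (bits (5 ℕ.* k) x))

module _ {n : ℕ} {r : Vec Bool n} where

  open GF n r

  -- For u = (b₀ ∷ … ∷ []), b₀ · v + mulX (b₁ · v + mulX …) is the unfolding of u * v, but comparing it with
  -- horner u v by refl alone takes time exponential in n. Applied bit by bit, _⟫_ lets unification name the
  -- inner values x, whose defining function is private to GF.
  infixr 5 _⟫_
  _⟫_ : ∀ b {v x y : V} → x ≡ y → mulX (b · v + x) ≡ mulX (b · v + y)
  b ⟫ refl = refl

infix 4 _≟ᵐ_
_≟ᵐ_ : ∀ {k l} (xs ys : Vec (Vec Bool l) k) → Dec (xs ≡ ys)
_≟ᵐ_ = Vecₚ.≡-dec (Vecₚ.≡-dec _≟ᵇ_)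

-- The agreement of `mulX` and `*` with their restatements enters as a parameter, since it is
-- obtained by computation once n is a numeral.
module Instance (h : ℕ) (r : Vec Bool (3 ℕ.+ h ℕ.* 2))
  (mulX-spec : ∀ v → GF.mulX _ r v ≡ Field.timesX h r v)
  (mul-spec : ∀ u v → GF._*_ _ r u v ≡ Field.horner h r u v)
  (codes : List ℕ) where

  open Field h r
  open GF n r using (V; _*_; 𝟙; 𝟘; _≟_; BalancedInvariantDesignExists)
  open Certificate h r

  bases : List Base
  bases = List.map (decode n) codes

  unit? : Dec (columns (_* 𝟙) ≡ columns id)
  unit? = _ ≟ᵐ _

  frob? : Dec (columns (frob n) ≡ columns id)
  frob? = _ ≟ᵐ _

  trace? : Dec (columns (Vec.tail ∘ trace n) ≡ columns (const 𝟎))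
  trace? = _ ≟ᵐ _

  root? : Dec (poly (r Vec.∷ʳ true) X ≡ 𝟘)
  root? = _ ≟ _

  split? : Dec (fromRoots (List.iterate φ X n) ≡ List.map (_· 𝟙) (Vec.toList (r Vec.∷ʳ true)))
  split? = Listₚ.≡-dec _≟_ _ _

  fieldChecks : does unit? ≡ true → does frob? ≡ true → does trace? ≡ true →
                does root? ≡ true → does split? ≡ true → FieldChecks
  fieldChecks u f t r s = record
    { mulX-spec  = mulX-spec
    ; mul-spec   = mul-spec
    ; unit-spec  = from-does unit? u
    ; frob-spec  = from-does frob? f
    ; trace-spec = from-does trace? t
    ; root-spec  = from-does root? r
    ; split-spec = from-does split? s }

  valids? : Dec (All Valid bases)
  valids? = All.all? valid? bases

  Distinct : Set
  Distinct = distinct (keys bases) ≡ true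

  certificateChecks : does valids? ≡ true → Distinct →
    2 ℕ.+ 6 ℕ.* (List.length codes ℕ.* (3 ℕ.* n)) ≡ 2 ℕ.^ n → CertificateChecks bases
  certificateChecks v d l = record
    { valid-spec = from-does valids? v
    ; distinct-spec = d
    ; length-spec = subst (λ m → 2 ℕ.+ 6 ℕ.* (m ℕ.* (3 ℕ.* n)) ≡ 2 ℕ.^ n) (sym (Listₚ.length-map (decode n) codes)) l }

  design : FieldChecks → CertificateChecks bases → BalancedInvariantDesignExists
  design fc cc = Design.balancedInvariantDesign h r fc bases cc

-- Found by a randomised greedy search with backtracking.
codes₇ : List ℕ
codes₇ =
  0x3fac4690d ∷
  []

codes₁₃ : List ℕ
codes₁₃ =
  0x1d339526bab9ec23f ∷ 0x12e9e4939ec3e4e11 ∷ 0x346c6dbe9f8837a4 ∷ 0x17e2c0295bb2079d6 ∷ 0xbf34d3ec879e6050 ∷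
  0x1784977c159bc3983 ∷ 0x460df1018499cacc ∷ 0x20ab1224187eab1e ∷ 0x7e4376bdf29138b ∷ 0x1ff0ac6b4644a5594 ∷
  0x8b51209df0caf79f ∷ 0x10a3f9e8919046525 ∷ 0x53645f6f3722918a ∷ 0x2ba4aa72f9ef2dd1 ∷ 0x3552a3a76518e6fc ∷
  0x103a8878c43bfe36a ∷ 0x1579f289364aa6037 ∷ 0x2a4af912541cf07e ∷ 0xf155b3e5492be04 ∷ 0x17bc6005f6797e9ce ∷
  0x223ad0ddad0959e5 ∷ 0x1dabe0bd04bde7767 ∷ 0x173dd5fc7ebc4760a ∷ 0x1cb544905140f7307 ∷ 0x1ad22f5ebfa4cdc6 ∷
  0x15a731fb2eeb9ef65 ∷ 0x9deb85776c8be906 ∷ 0xe9ec83230817072d ∷ 0xe2a96c4d9c4d2a39 ∷ 0x1acc7985e2a06e322 ∷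
  0x266fe69eb15812d2 ∷ 0x12882a6b842590dab ∷ 0x166a5d59579881b24 ∷ 0x67596661b2b8ecfa ∷ 0x44fa87948c56e62a ∷
  []

codes₁₉ : List ℕ
codes₁₉ =
  0x6857b782dbc7b1ada8778456 ∷ 0x227f4e7e9b11a7c879ee6c33 ∷ 0x124f6a339b6c93d3e6adcb33 ∷ 0x15d3a1bf4a39de2fbeb90c56 ∷
  0x7fed9df13b455dd47cc79e35 ∷ 0x8fd7755a08c548d0ec3e744 ∷ 0x1cae4d4b81a95b522f320300 ∷ 0x6d090536b62fef6db644c0d1 ∷
  0x500e11d38db122d3f0ed9647 ∷ 0x205c64c196e198fb52a7bfaa ∷ 0x3b844f86da0728ce2d3b2efd ∷ 0x6e42405f5796b0652c249dcb ∷
  0x3bdb54550da916efa84d1dcd ∷ 0x49c122e57cfa0bb2c221a7c3 ∷ 0xb723e4495d6da6be02b7d3a ∷ 0x58f1bc460ecfc02b1f9e486a ∷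
  0x2e1041ef8e8d053e4a8ff01a ∷ 0x3b62d58a4b2933e9b65928e ∷ 0x1ff327a2f3a10a2b52940a95 ∷ 0x3b5d3448ca426da1f0bfaefd ∷
  0x6110b09c5f40aed1d052ef85 ∷ 0x3f51fe4c890427447c20b30a ∷ 0xb0f02116286164cbfd37744 ∷ 0x5984531fb1ebc3f2ffd64857 ∷
  0x46b2c127bc3bb2aad45d2f28 ∷ 0x4feada6aa5091804a88e6005 ∷ 0x529776da56375e6bc2230bfd ∷ 0x46e04cd177ed183ae660c86a ∷
  0x4d652ac7e36df6b20acc1acd ∷ 0xb5473d7b40cfc7b8537049b ∷ 0x30ec50b145ca67d22c187415 ∷ 0x137cbbad9f9728f41cb19d81 ∷
  0x5c073b9785ca42988b8cceef ∷ 0x135a400bc4ac014c5f90f5f9 ∷ 0x7dc8ebef0ab9726ad3f7cf68 ∷ 0x114ae857b1b43069d468a66d ∷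
  0x6b398b9a7b516ed5ce439378 ∷ 0x74016a2edfc42b2ecdcb0205 ∷ 0xbc7ddd95e680dc7cda7196f ∷ 0x7edf467770ae4b982b8d918e ∷
  0x3062b78a9f2fa8579cdfb454 ∷ 0x7649d4abd88dbae823f4ba82 ∷ 0x584098f36ef34599d5ae688e ∷ 0x7a8adee43bdfec231c3fec12 ∷
  0x15a140aa5da6544b84af9b39 ∷ 0xd81a50d5617bec5c883dcc3 ∷ 0x696253994eebff4a659679d9 ∷ 0x6cacb23aae1c226ccf16beb4 ∷
  0x353126a0d5b8ab6afa67eb5b ∷ 0x4954bbedd51029c7c3c82a5c ∷ 0x7e421f45b93e7879e7ddbe1b ∷ 0x5307a825185c547507625518 ∷
  0x629b99d6d2b714e093cf4407 ∷ 0x67b6357e711d1fabc2895eb9 ∷ 0x1b5df4e4163db97ec5a9e481 ∷ 0xb0b4c481e2c5ce130fda827 ∷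
  0x4c9399f85ae9f42f2fafe57d ∷ 0x4edfd53d07ddf3d06f8e4125 ∷ 0x4338564f13e2839fed69fbba ∷ 0x52c53d160979fadc9f88191b ∷
  0x1d044186b657668cb3888d1c ∷ 0x6dbb538a3820caba58cd717b ∷ 0x1798a22eb0512acd9fe1542e ∷ 0x7ec14c1b7e90d247b4dfef80 ∷
  0x21910b9c5f2bf297b16e79d3 ∷ 0x18cad12ee7dad9cfbec94895 ∷ 0x16b0e29b5eb88833c890d422 ∷ 0x4ad8025871851427e2ca41b7 ∷
  0x614fc4c3a0935c987b44951 ∷ 0xd0e093021142798114f639c ∷ 0x32de9bbdfef526f1e4c3c859 ∷ 0x32993fafcfc3fcefaa61746b ∷
  0x172ccebb23868d30cdd30371 ∷ 0x7189025881ab6b067c9b246f ∷ 0x33c9becdac42552e29a59266 ∷ 0x5f674797bdafa67ba37d2e75 ∷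
  0x7d2c5ff786adc0f2929dd9dc ∷ 0x6f8c93d1ed39dc20420663ee ∷ 0x7e6e01b8fece6e09af011f5 ∷ 0x32a7c7fefe29988c346b82f3 ∷
  0x536c63f9c1c9df7ec11f115c ∷ 0x41a889b5c7429b262c7b0ca3 ∷ 0x34420b8de90ffb0cd66fa209 ∷ 0x5daf1f1edf7fbd97e95d30c6 ∷
  0xd363c4a1625f9127251bf9 ∷ 0x73031200ff771be627083cb6 ∷ 0x335da5615b60eabd841e84c7 ∷ 0x72a608e583f56e4230f40177 ∷
  0x2d22b20e121d5ed07205789c ∷ 0x1a5674b764531bfa736facb6 ∷ 0xd9bff2220c6b86ac2298996 ∷ 0x197e9a315e5f3c818e1ea8c9 ∷
  0x5c928511e3b3292eba00c088 ∷ 0x65145f21aa541e39d0bf1ecf ∷ 0x25681a056ae03d497d37d798 ∷ 0x38fd4b832641337c911f8f01 ∷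
  0x436fe77f67a4ec57b7febccf ∷ 0x2cd238e63bb439995601cb32 ∷ 0x6ca9eed82ddf8f5e6d66887f ∷ 0x60f2a7ba4bb20cd54e21077e ∷
  0x3396b702d14ffb5003f07421 ∷ 0xb9c9c87b548297f39c02802 ∷ 0x6323a752f516cbb2731d72e5 ∷ 0x5e091d4df52b26e7aa2b6451 ∷
  0x1ede57d8d5f581083be9708d ∷ 0x2d89aa49617069b1078fa7ce ∷ 0x7ebacb9392fb5a0d4a38d633 ∷ 0x6a0688166eab4544354646d9 ∷
  0x5e61551568454f07fb7604c ∷ 0x395658cad6d66a30bf53ed8e ∷ 0x4f690145714e3ac81bd51785 ∷ 0x3bdc979cf0338ecc65146f1e ∷
  0x326a334f39d76fc1be0543db ∷ 0x6ed41dcff2d74560bea6288 ∷ 0x2a8b15f5df307f08a73b4d5f ∷ 0x298a1b3fd3f5664bf27a6aeb ∷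
  0x71ff6abf0264ab37abf53c1 ∷ 0x61b7169c7e85403210cd8387 ∷ 0x2770a861ebe5ba578d347518 ∷ 0xe8c473e52a472e4a2b60965 ∷
  0x5874babddb890748fe40c9fa ∷ 0x12ea715289e54308aa27e35 ∷ 0x3ad9b8473e1f079a7ca68b91 ∷ 0x479be9dd289b2808db6e3717 ∷
  0x6f146e3756699a859b915241 ∷ 0x747f40ae1cc1c229c62f3afa ∷ 0x617f2082521ff8451888d7bd ∷ 0x7d8c012fe20d98b31381c81a ∷
  0x404878b25a3dcb3b7ab5b8f9 ∷ 0x3570e4d65b5718aac2d9c8f0 ∷ 0x5965daa1b458b2ea14cb7d7f ∷ 0x43b4cd128d2d6b0cba86eb23 ∷
  0x2816821f5b610dc9f6e2d712 ∷ 0x57df4c9c2348704e5f0354fc ∷ 0xbfdccefeb06183bee690bb7 ∷ 0x20126a631d43b15e9189819d ∷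
  0x36d841bdc838c849c8aae8b1 ∷ 0x3da7ec09c550fcafe3310b73 ∷ 0x4c11c9ff3fea40f28ed25dc3 ∷ 0x45a70069fcf11492a16f738b ∷
  0x38bf511ed820811a5eae2979 ∷ 0x2fb00ce8fc0172200200202 ∷ 0x5d619414a260614c31a64d9a ∷ 0x7a1304ea987b36f4c41b0103 ∷
  0x33d6091ce6c61d2c6bddc55c ∷ 0x224312c2181b00878afb75cf ∷ 0x4d76af6f353e0f1616b3813c ∷ 0x14ba074d86f81f7727375f8b ∷
  0x73ec763528adc1ac2e3e1b89 ∷ 0x2aa7f942bb31b9550db36088 ∷ 0x5d0679f427b3d969b7faa84 ∷ 0x5e6d15b8402a0476ba0e2cc ∷
  0x2807cdec624832661189211b ∷ 0x3fec663afb0ad1592ca823ca ∷ 0x3bdcb8c135e64c84a162df7 ∷ 0x57a3835358c4b500b903afb6 ∷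
  0x71f983e62ad1186eb117367a ∷ 0xf9cf5e839208d360f25050a ∷ 0x1fb6b51cba86c84217631416 ∷ 0xd2dbe81d8b8223337cb4405 ∷
  0x79b79da7892a1f142e1445c2 ∷ 0x5825185f1b82538028eebf01 ∷ 0x7ca194fe3cf14a0ed9ca32ca ∷ 0x166b6dda417892dbaa55bd16 ∷
  0x2c1cdff58806fa125379a511 ∷ 0x77ce9a0a4056212950a44f4c ∷ 0x2f2a21ca087f66828b476eb6 ∷ 0x1c9dd8e2c1be952da24d07d5 ∷
  0x1fb78aff63e6d3322bc5881d ∷ 0x1163e324f78647596c9b7849 ∷ 0xf76435b703cfc2151d0c3fb ∷ 0x10a6171718ca0ac63155e2c8 ∷
  0x7445442d4a93085cc255e33 ∷ 0x137af2ebe8ff58824cf707a1 ∷ 0x418db44ecf7b6d9a42a8702f ∷ 0x6b803ad7805ea7ef9004ddcf ∷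
  0x5fa258db51ed1ddf9a8af6d1 ∷ 0x3a8594f52d3427f3e8a1b97e ∷ 0x5da891c3c0d15615201be0d4 ∷ 0xd6783c26323fb8ed5cd61 ∷
  0x27229324ff6be4a98cec449 ∷ 0x282bd6e7c500d6731535a8db ∷ 0x5552e43b9db46f3daf1f2cc6 ∷ 0x21d2d5cd9741c787234b603f ∷
  0xeb883b0ac3e4ba049131860 ∷ 0x69238d9d9c5edeed703ffc29 ∷ 0x7507bb8695c5d4a3a119fba3 ∷ 0x75eec7d04d80badbc0a3e382 ∷
  0x3b0b898626f995d3175fec86 ∷ 0x6d11936574ec057f6524db23 ∷ 0x643d7db47dd2e4e01aca666c ∷ 0x91c6402d580debc0077a6f5 ∷
  0xb7faf0d3861971525389e51 ∷ 0x71a1a113930c40a8a6fdad5e ∷ 0x291e26ca087515a2781f4209 ∷ 0x5342a2376045e47c149b9a0 ∷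
  0x42c0ba82f8f3791e27f73287 ∷ 0x4da23f3ebead6ffc278e6ce7 ∷ 0x466342ab3e2d8de3894487f7 ∷ 0x6f4d856746435905a30fa9b ∷
  0x75978e9314f6d023b2f0148e ∷ 0x7c8051eeb3180c56455d408e ∷ 0x5443dabb763842fb7b7d951a ∷ 0x1ef4fe9ffb6d3b71521a4f68 ∷
  0x21169c7ca3bf7e036a22df47 ∷ 0x452f22a0c921cfb344d01854 ∷ 0x2036ad7cc084d2b574842af6 ∷ 0x6cc6417f726e6c19ed9786c6 ∷
  0x514d68c31cc1089469efefdb ∷ 0x2edc7bb90cc84717e6bf0bdd ∷ 0x48f5b07617770e0694335669 ∷ 0xc33f2df1819ad4bef9aef3e ∷
  0x26a65e782cb8d4e8e596a84d ∷ 0x566612d472d32150493283ef ∷ 0x68eda346513b2416b775d832 ∷ 0x5f5c5c5a57d4604408b95f28 ∷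
  0x29100b9be72929670f67cf48 ∷ 0x5c87f376c923b62f815d2b59 ∷ 0x1ea56af6a8964d44822aa0df ∷ 0x13de864d1cbe0262bf65d40d ∷
  0x726492a634cd34d6043ee0c8 ∷ 0x2c0048b823ff790a93b04522 ∷ 0x4e77e8da3a905753e529c42b ∷ 0x67e57b036433a8ff95975ae2 ∷
  0x582490a5aa4d51e03863d39d ∷ 0x3309b230f39fcf56a176d164 ∷ 0x224303699e60783957c0f1bc ∷ 0x6872175f6207f4964ec88b33 ∷
  0x61b179170719bf254a1e979b ∷ 0x1fc1989c177dd7f3134381e7 ∷ 0x13e50def99ffed016a5a618 ∷ 0x16d5d38337d2be2d8c579815 ∷
  0x279ddbc341bacb1a4127e4fc ∷ 0x3cb65007ee382a906e172577 ∷ 0x50dc13202deaccc35b05094d ∷ 0x602a3cb90d2596ac32a84349 ∷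
  0x48c35dff295959d6b15689f2 ∷ 0x5705dfb12463d41f924f27b9 ∷ 0x5c62e07652506d973e54522 ∷ 0xe69b0c236971f2c7a19870a ∷
  0x203a6ff37d3c2636199e68dd ∷ 0x27a38edad651d7ec6be8b2dc ∷ 0x25e374b8c250176da7208d01 ∷ 0x2372238bd6481a81bab4f0bb ∷
  0x515dd15acb3e2d5fb6ed7965 ∷ 0x778f150fcdc5732807f176b ∷ 0x5294f73083f03aafb290a019 ∷ 0x125483303e8b5be5c603474c ∷
  0x6949e9585ac61a2018999e57 ∷ 0x2ac0f736922410228e9e03c1 ∷ 0x64280af40332c0c00072367b ∷ 0x6fedc784e3c2fc1afa65f3b9 ∷
  0x51d186fe8560072eb56b0f15 ∷ 0x384d42a7af2867785240d315 ∷ 0x2b69db87694a64cff11875e1 ∷ 0x41112b7b3aa9d69c9478a3aa ∷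
  0x53250cf97728665b677d7d0 ∷ 0x48551e42bc69a46d277d2a3e ∷ 0x590611f3ec23c474199327d2 ∷ 0x66ad912a4e14ea24dd665802 ∷
  0x2f790472f3a509d5f37e356f ∷ 0x5f00230d540e1152095d756f ∷ 0x6b292c84b9a3de6d5349d9d7 ∷ 0x6d4c2daaac24c815aad5e4a3 ∷
  0x57545cd81a032f0b9b23b7e6 ∷ 0x4610d48bbff7c7c5706bda29 ∷ 0x45602995fb43557061aeb8e6 ∷ 0x127d0cc559ba9ce7c7ffae5e ∷
  0xa7b572ce9b79d6b183d0071 ∷ 0x2ab519accca098713532a3d ∷ 0x15123b22cccd45cae662a5f3 ∷ 0x240bb2c9289a6185ece999cb ∷
  0x533fa915fd4dcb1b56c3a79d ∷ 0x49f38d9095c72dcbfe3ff48c ∷ 0x223c6215c4b869c151cf2353 ∷ 0x79a73ef9fb7db407966d2c70 ∷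
  0x6471ea7a68638623c16f97b7 ∷ 0x45a9075e0fc54adefad9fd78 ∷ 0x5260f0a86d7e1cf7484da147 ∷ 0x73c7cef5be6aa476d8b0bb0d ∷
  0x50e75d67139893666f260330 ∷ 0x137e9c45606a5990fb26771e ∷ 0x70b7aa2d9d450f26988d47ba ∷ 0x3de6b9acaebf3299b9d9e000 ∷
  0x2cd4373fc1a114779ff671c5 ∷ 0x5e8eda60d21f5cf63922212f ∷ 0x77b14872fbb1b9e0bc7db92a ∷ 0x338e28efbe12ad47c673b123 ∷
  0x53c17b7f6c5b3f4cf6e25e55 ∷ 0x18e668ae0fa635390ccf4140 ∷ 0x5ea3170a6258674f1497d62d ∷ 0x7a198903e330972b4121ffdd ∷
  0x34f395b58372761f6524c8a8 ∷ 0x4e46a5fd69b645c5abf225b7 ∷ 0x587a2787ece70bcb721cbb7c ∷ 0x631685b6686a248bd5d9ae07 ∷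
  0x531decc2aa35da6ac5942105 ∷ 0x8d5f41e53b920feac18d745 ∷ 0x246670f12f1f1c95c73a5219 ∷ 0x19f067c30d85cccdd9810e66 ∷
  0x38e3f9266ab5d6331743b7bb ∷ 0x210603f561025398b720cca ∷ 0x42a9616303243eb86b69f92b ∷ 0x5dd383cd34280f9083d812fb ∷
  0x27f2d8407dd512cdb4ddd919 ∷ 0x382ec7eff3eb763e4d3d9d07 ∷ 0x14cc062d60d07476e6c37209 ∷ 0x274f96a765ae8ad9481f1312 ∷
  0x342b46a280eb2000c93644f4 ∷ 0x48f7b2d6b08b53e4092db577 ∷ 0x460cdef9300400d8bda4ae1 ∷ 0x63fe434690d4e4f57c22ad2b ∷
  0x7053a07900df2192f04bd467 ∷ 0x46ebdc265c0ef6a23d1c1dd6 ∷ 0x1700908bad6ee713d91f2f5d ∷ 0x2021f5dd6311ba4ea01a2a01 ∷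
  0x4e19828a82946c59ce41ddaa ∷ 0x289a319c72e797ad70098115 ∷ 0xbd15ba582b2abebc7a9212 ∷ 0x40a36bef1e9307744ab3cd94 ∷
  0xc8725867e3ba745044fbe7f ∷ 0x5d9acd454ddad198c00c368c ∷ 0x32a5c95b8ec7212af036ae43 ∷ 0x6cf7c65bf4fa3e508d8c118c ∷
  0x79a3358ded87fd06a3cf9e0a ∷ 0x69e5b2b73bdbe40bae25c60e ∷ 0x4f9c25fb2d3f281c0153b025 ∷ 0x7cf5ae19ea23e1ef8a7337b1 ∷
  0x377630c25ef7da6da9d13464 ∷ 0x1c1328bf3a26802891cc661a ∷ 0x446b355ef0d26a5eb417490 ∷ 0x7afa57963b01cc72c8c151a7 ∷
  0x4f34cbe02749878ab882fe49 ∷ 0x42dafaf595b45c49ca4e8c3 ∷ 0x2f013381ebfc8552194c9e8d ∷ 0x34faeebcb73c29e010afd560 ∷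
  0x7f3744f839dead64e0368fc9 ∷ 0x31632de7858231935bf2846a ∷ 0x54def6de8b2faf7da171c8e1 ∷ 0x3c3f0fca693917bdd4823493 ∷
  0x344eccee3e6a09fd48dc214b ∷ 0x50e8bafc1441ffdf682c7be8 ∷ 0x52896890abc0169e51c394cb ∷ 0x89c38a4b5018064e6db8d10 ∷
  0x105a7a94b19c0d1094882178 ∷ 0x4868bda61f112d54e90272b ∷ 0x76f7b28da1501ecff6a25d27 ∷ 0x2d50b61a4bcb5f1b7cd6e18b ∷
  0x6635746593e877762bda3515 ∷ 0x452838d2c7a371a87ea6b617 ∷ 0x4726f8731dc1a7ddcec25a9c ∷ 0x690e7d441b1a0be09f37eada ∷
  0x7049e26de6789d2be0e85935 ∷ 0x65296668c838ac3e6151c3ff ∷ 0xbb3d4e3ce12599a015c1816 ∷ 0x546c3ee5a620a868e4bd6a56 ∷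
  0x21682f7dbe8c3292dcf4bc26 ∷ 0x3619b5b22ef8125ee96ded43 ∷ 0x48184b2321f280ebf24fd0 ∷ 0x7288b0ce31a63719b7857489 ∷
  0x602da9defc5c872ede5d4f64 ∷ 0x16b7eb96a951dedce20ea7e6 ∷ 0x5631c2f76ec7d936a35d8aee ∷ 0x68a7120320b0d808e007e788 ∷
  0x10bb6779e70af98b53555650 ∷ 0x4cf6964a3f089fa0ad864460 ∷ 0x57a598d714a45cf69240c049 ∷ 0x28b66188d2d68422ebc04058 ∷
  0x4ec62a9f6eb6762b7be18298 ∷ 0xd17a7902dd603b86c98b764 ∷ 0x61952cf990b9b590592eaa0f ∷ 0x3caa364ff8d3effc529a6308 ∷
  0x1a2ac1d438349f493097ecf7 ∷ 0x700fc2bb9a30c11ff9045f5f ∷ 0x73d0f189fb8f089ca9fc8164 ∷ 0x2104f1626f5de73e3fed8e84 ∷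
  0x20d864948721dc30c0a8b95c ∷ 0x54410c16c31808d1e5c6cb8d ∷ 0x75fca91078722bd82da4055a ∷ 0x4e67ca3f5a49e8b0068d01a ∷
  0x3679bd5c9e155c62b9c03ddf ∷ 0x6ab051f49f4e2b344d24c946 ∷ 0x680f0ff9710e2593d8251e64 ∷ 0x79b3bdc920989589dddd3ca2 ∷
  0x1d6ec8782ab51cc64b4d40d4 ∷ 0x6521e5ed218318a337773419 ∷ 0x4f2ad1e12749dd5ccfc4ea6e ∷ 0x2091f6f191068d5ca795a4ad ∷
  0x6c4c0d7eadf84804d803c251 ∷ 0x45bf5a79cff37b39c34f6386 ∷ 0x38b00aa68150dc84ed5d6c8a ∷ 0x3ba8c27e70483e35811d6735 ∷
  0xc5dad65ca25291d9056c7f5 ∷ 0x36cc9b0d83960dd6f8bc59c9 ∷ 0x3710cf5ef92e7c808dd9651d ∷ 0x6277839f4379d94f34e083ba ∷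
  0x2069c7fca29aa66f3e6072b9 ∷ 0x7543642073d9a1f57a0976b6 ∷ 0x609a040a8528efc0310b6449 ∷ 0x3d271165f5a87a47fa2bce06 ∷
  0x3fa3bc59f37cfbe9b14e578b ∷ 0x1fab756931b2b8437e8d821e ∷ 0x6f7803910b1d1588534601ee ∷ 0x45054df840c3540f0edb3fa8 ∷
  0x6d080c3b340a14fdfd68aea1 ∷ 0x27f09895d8f97d5afb3147e5 ∷ 0x423464a8e346423a86aa748b ∷ 0x2e92df08f6e15e4706357b92 ∷
  0x7f5d1b20ad2bdfebb689637f ∷ 0xc2cdd2b07da75c404ff96a ∷ 0x598883e4793ecaa768519467 ∷ 0x5517310594e87b881c1b92fa ∷
  0x4a8478929cd88bf11f98f81b ∷ 0x4b2c2f9d5bc5723a109d5441 ∷ 0x6867e953ea8106c118ad8c25 ∷ 0x26d947a1453b5b1aeb4dd361 ∷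
  0x14896a1554f0bc30cc73b58e ∷ 0x3a3b3b1bbdaf70c390dfe476 ∷ 0x6b1ebc12a3e864621cc557a4 ∷ 0x5de625bbdeaf2c8358e54e97 ∷
  0x49334100b3a363280ca51c53 ∷ 0x7d75f1d1cf369a56034a8961 ∷ 0xa9e68e9770b19c870ceaf68 ∷ 0x25c72a92b758181c359bc37d ∷
  0x1aef422896752252f40451cd ∷ 0x5fc51783c7322b559e6274db ∷ 0x6d0c97ab826b3e0f378713d4 ∷ 0x2ed8a63f73d8214940ffa341 ∷
  0x7b0c6592a0c8745aa5e35230 ∷ 0x221f47c56bc048f51960019b ∷ 0xb1bd1856dda599a08255b8f ∷ 0x46070b39a1a3e7fbed02c1b2 ∷
  0x3c5e20cf082cc82eb38513e3 ∷ 0x278daea09e2de06cca4fba86 ∷ 0x2c2df1b1fa6b0e96ec269c48 ∷ 0xa725e6b7c7166a22ad2c13b ∷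
  0x279b67f7b1720d6a060816bb ∷ 0x6d97dbe6429a00ecb61b034d ∷ 0x328720b5af2926fe313b67d4 ∷ 0x138c7710f5a65e0f8d207455 ∷
  0x325fbe26cb59a8857096d99f ∷ 0x1d958db3be4601bfeaa1026 ∷ 0xe28b66684a42fdf244bd455 ∷ 0x17e012a713d28bca42963584 ∷
  0x47e5334bd46e47200d158d96 ∷ 0x51c94a67acdc20d10db0e16d ∷ 0x31dcce5ecaa370c11c41d6b ∷ 0x3ada5bb8eb3e532ff622970b ∷
  0x31ad46c9bf6dd8800f4aba53 ∷ 0x3412c487dbc89414a0490034 ∷ 0x5a1fec6d06701e18fa17cc81 ∷ 0xe13618cfd1cf9d36cad6c12 ∷
  0x6f52277c119efe022e6a6394 ∷ 0x7dabca685a2784cb1f868f63 ∷ 0x60a07cff61341f8780be55f8 ∷ 0x393012474d17c9df21e73dd8 ∷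
  0x2375c8821c4a15f649ec59ad ∷ 0x52b5e3f1472687802dbcc14a ∷ 0x50b0ad47e938f7a501312fca ∷ 0x7b7147dd927c582171d33022 ∷
  0x1778eea1ac5c30410697f70d ∷ 0x321f0d3460ad6b2e85540c04 ∷ 0x152949866eea886b58142437 ∷ 0x1bd02f1ee6718a580e275deb ∷
  0x779f193f50b3f79aa0129a9a ∷ 0x44267180f79a082a08418f80 ∷ 0x71ac87001e64e88c49d74a35 ∷ 0x29fdb0ae827a3d25f14cb2c7 ∷
  0x2c7af82514f4921bff6e1feb ∷ 0x69124a3e6d56b67e9addb0e0 ∷ 0x62626bc3888d886404e998e ∷ 0x63baa5eb661470f3da58156f ∷
  0x764bdca3855ab8d79bc11571 ∷ 0x128357d7230a56e6d15129c ∷ 0x11534ad100dffb1f8d490933 ∷ 0x788dd6ea0b7f9946a9a7cfc1 ∷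
  0x450f1c27e31685a16854b062 ∷ 0x23cc335e669a6e7e8ebe867a ∷ 0x71f8aec33f1df81412be7ab2 ∷ 0x7b5ca26fea1b5b3b3a60302b ∷
  0x131790addd150aa4aec5f8f4 ∷ 0x1e22e3a0b4fbd761f482ee23 ∷ 0x121c07ba6e8f03c53fc71fe6 ∷ 0x4a0f1065ce86b90f724f08d8 ∷
  0x3d84b3d514aa587d4ab5d903 ∷ 0xed176730dfdd88c668e12d9 ∷ 0x1331222aed7920041234df76 ∷ 0x47444bd58b95bb44d50ced01 ∷
  0x1e59d5af4606c814f6c0647a ∷ 0x78610980548617ecea76ddfc ∷ 0xc4600bfdd4c0db7e4456078 ∷ 0x186fff367a0731a1ee991801 ∷
  0x6e84e19132b70553c7029b46 ∷ 0x1e5e7ba6e0c21d8a716b9ad1 ∷ 0x75d0d60b19748ecee28f8f2 ∷ 0x4036a2a801689f1f18a9055b ∷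
  0x3ab186bbd905e466fd438a42 ∷ 0x8ede3125d92deb4bd87c722 ∷ 0x51c14b009148f4dd16aafe36 ∷ 0x5e2a60ccfa915f3ca3cfea65 ∷
  0x10ef147445ef0afa743e150 ∷ 0x6bd53b2167f5120cb0e00f05 ∷ 0x13c38073625ecfe2cd13a072 ∷ 0x384606ae7fbfd6390081a868 ∷
  0x6fb1a5f5f8dbfb6f2d448a8 ∷ 0x3ce1f9b2f069e886405777d4 ∷ 0x37386595e18d306140edfd95 ∷ 0x515836e8f97de34a191e9527 ∷
  0x6d6919455b107c4e2e4b6a20 ∷ 0x2c706d1875d730d6714f3f3f ∷ 0x20bbbe1823743ce490daa771 ∷ 0xd7a8a78fe24787c4025f524 ∷
  0x79f4ca336cb457f630358b85 ∷ 0x3065b18e951d5b4ca12a39cd ∷ 0x1c32ae5f6aae7b4f549b89d2 ∷ 0x3e09107ab215104dd408e1bc ∷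
  0x4501e382cfcb2b2b6f9a8fc1 ∷ 0x68306d4f7123e79e0afe054e ∷ 0x2e73ac08da342d0073f15b2c ∷ 0x508ac875fdbbfa5310608e8c ∷
  0x87451b02a66c2ee3ee9866 ∷ 0xcd1af15167d90e0e7c51a1f ∷ 0x73f49551f547c0d297eae879 ∷ 0x42c47a7b6ea1df617a34cc47 ∷
  0x47d3ea028de82090827b5be0 ∷ 0x244cabeae7e0dc22e39407f1 ∷ 0x15c0a4a70a1653e98b21fb18 ∷ 0x62c9f7cdf62056c16c56b79 ∷
  0x6ff80574096b012e4a73248b ∷ 0xd40d3b1fd8b8ad65be105d8 ∷ 0x451b37d3fd7b844bbc41cd99 ∷ 0x14a7e0b220aa00f02f6b7e02 ∷
  0x2c163dc56c46ebb0826286da ∷ 0x4337f2c16c3ddaa9c90ec161 ∷ 0x71370dcec5a19c75dee3acba ∷ 0x6aedd66ecfeb4dcf94d0204a ∷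
  0x4e117e7465a9f6ba0746fd3d ∷ 0x762a885d9548a1ab7a4e7e3d ∷ 0x6e54f629f9ccb329c28b55c8 ∷ 0xd7be27640dca2810ed2f8d7 ∷
  0x6163d321b4a55af97e317bfe ∷ 0x2d5d103a48da363226d31126 ∷ 0x70dc81bcef9713ea8f8827c9 ∷ 0x62a32046726a77b632e61be3 ∷
  0x1f34e83bc40e97f6202b10e7 ∷ 0x14af51f6bf9360aa9cab7928 ∷ 0x2afcedaa72f786b17d1ba7ac ∷ 0x4005fb5b1c81b635ac45b981 ∷
  0x12f8cff0f668c1cc0bec647 ∷ 0x37aa6bf62856288c363f59e7 ∷ 0x66beaf1c2773c89e505bfac1 ∷ 0x569efa901cb2a0d356ff10b2 ∷
  0x27902999d1001d91e8fe5cdc ∷ 0x2261f135e48b7174ff5bdba3 ∷ 0x273edec038f86c643095c11 ∷ 0x2252e2888b8d24ef5f028c13 ∷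
  0x44387ca413e8cc62f60917b8 ∷ 0x49352afab1147bdf7caa06d0 ∷ 0x44731b538ff90531afdd332d ∷ 0x403da3af541bb033cfb651ba ∷
  0x24a4b98129ad070c64279c88 ∷ 0x57e6f62b869c0a5d956bed5 ∷ 0x1db7390bfc5f32c4914d43c1 ∷ 0x17544234a96a1dc6f0363910 ∷
  0x3cb5d66b21f1f658d0c764fc ∷ 0x7eb68aa7136ab05c383709c5 ∷ 0x985ad5d1f38bb5b8e360d29 ∷ 0x5d59941a4410276b2bfc0430 ∷
  0x6167dfd5d6f2544b208a656 ∷ 0x59f02736f26fbd305fb2ae27 ∷ 0x304020c0ea536990d586f432 ∷ 0x38f718a56e413385be367a48 ∷
  0x185631d2d447e59fedbfd1f9 ∷ 0x347b4f1dc8d33f74f39bbf4 ∷ 0x3fc115949fe855fc45499028 ∷ 0x7598be9a08aecc2273e66146 ∷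
  0x11224f9a5ab958067d68b9b7 ∷ 0x28354fcf87aa43b5a1083e36 ∷ 0x339fdbc916aef3a2ede82e5d ∷ 0x4ed931b75aa4806f55b085bc ∷
  0x45871c3f078ab0ea9640f302 ∷ 0xd8fa1039f0315b97522deaa ∷ 0x1b194f24f49252dbe54639ed ∷ 0x783aaefe83eb0eac86de03d0 ∷
  0x172c24445af8687eddbf0bdb ∷ 0x2b75eaa4586581d94d967e4e ∷ 0x590377c15c87db169ff89f1f ∷ 0x20244a2c365255a956657e5e ∷
  0x345f54d9dd3329275698155f ∷ 0x594a5462a3f32c18d02db486 ∷ 0x3a9ad2f3f64603d883f2b64f ∷ 0x2b0a2765d89102b9f0fc7c71 ∷
  0x6d3b84c901305db80bbd8440 ∷ 0x5069a89fb3ce2fa6379fad59 ∷ 0x37c5ca8cd976ddda84455232 ∷ 0x4c44a5b63af894d10bf38c ∷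
  0x6a8c8f3532928911d13c2f1f ∷ 0x10cd44bc4db258028a33267e ∷ 0x72d60b6b089847431c3e6ac3 ∷ 0x56582ade59eb0c07d86d42a0 ∷
  0x604e4eae82a3e8bf270feba7 ∷ 0x20c5d5f1fa3e2d89c531cc7f ∷ 0x4b85db4ff84b6ff92353c213 ∷ 0x5f1069844d013e77feecd970 ∷
  0x610c535ca5503fb4f42796b5 ∷ 0x58219a5870da800cdeb71174 ∷ 0x5cc2e732ac20f6c6b86e097d ∷ 0x62e2151069249f773137e123 ∷
  0x76bd865a78edf9aaa8f236c1 ∷ 0x1db915ed8ee348dd4e4c206d ∷ 0x2449b85c0ad453f21e556fbf ∷ 0xddfaa952fc34eb1b92e4100 ∷
  0x6aa3ea8b2f0f3748140c47f0 ∷ 0x42167d5cac3b28b72586be51 ∷ 0x46999ab4ebc5a4944e556557 ∷ 0x6cf771688afd19e42b5b2822 ∷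
  0x9d2fd323e5b420e89747228 ∷ 0x372f2c6c72791c4c5e8eca50 ∷ 0x7c63994d8935ef8e0bd4c35b ∷ 0x294d81e2d23e98c69fae5cfc ∷
  0x2d1da8e0193365a8bf8215f0 ∷ 0x5dcc475e59d2ac0befa899dd ∷ 0x3c875f844c7b2e5b79234e77 ∷ 0x25a3c78e10cfca34251ec5c8 ∷
  0x6efbe80a6871082f9e8e2580 ∷ 0x642c2cfa6498f8bf02c6cdb0 ∷ 0x40456630d71fad1a144f9442 ∷ 0x2a9a6ea82d5d0299457f89d0 ∷
  0x412518875d04e69432fdae8c ∷ 0x39beb87fbdf61c228926df68 ∷ 0x2fb3dba3ddfb9d7a8018bebb ∷ 0x68e15e845cf765d1ebcfb736 ∷
  0x7b5b9634ad270be1570b0f73 ∷ 0x2d32cd042eddaae88bf495ea ∷ 0x1748f370ab627c0ce48ae1df ∷ 0x2b12167e4a70c1a254eb69e3 ∷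
  0x31c263754324ce43623a7dde ∷ 0xf261883a667f6018776907d ∷ 0x60bcc3bba29206d1d0108eab ∷ 0xafb68053a1da08d5cd177b ∷
  0x49c154d766c922fec328e93e ∷ 0x567207a73399b1d3cee66a38 ∷ 0x212adc649a749777c0483d58 ∷ 0x548c8ffd147e88673338d197 ∷
  0x24301234f86f8e1807686fac ∷ 0x766698aabf9aa28075f9c158 ∷ 0x133bfa83927eb072cfa16dc6 ∷ 0x41d00a02ee7e7503fca6d367 ∷
  0x165e5b62af08769911bf69fb ∷ 0x3752000d59dc914ffef25969 ∷ 0xc4cbc20a88d2d39a84624fb ∷ 0x4dd4f7317f157561292b6305 ∷
  0x234e0670ae0830a779e5bda ∷ 0xf82640eb8f6cde0de37b298 ∷ 0x768cbcb7b17b98443467c7ad ∷ 0x4267005db272d75237e9aa3a ∷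
  0x6aa92f31225a3d26d3964fd3 ∷ 0x3367365ae40ee34a4787b066 ∷ 0x3914c3f0ccc955b1c8f8338b ∷ 0x34062acd631b0ba0797a4e7b ∷
  0x732c79d64fd8be79142f452f ∷ 0x8c0f58a4301d0807b197079 ∷ 0x6cadeab33170d1f49ea3ffbc ∷ 0x475ff376cae018535d7fbca9 ∷
  0x7df75997a15c169b5b8db9bd ∷ 0x102a5c755b713779023c80c ∷ 0x1e309cbc8436cda8d16a9f24 ∷ 0x7628f80023c7913fff1563c3 ∷
  0x14fb522c77447b26faabee35 ∷ 0x1b6dd66df21eb0fc6804b12f ∷ 0x268ef0091490150d161ef729 ∷ 0x46ea84ff91464032a71da183 ∷
  0x65e0e9d749b14363e0648c1a ∷ 0x3587679dc1cd015298b2e0c1 ∷ 0x2bd780219932405c95c1d629 ∷ 0x7176bab7555c22c4b57b7b7c ∷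
  0x4236c08ac7a3a9bd04e2a0ee ∷ 0x24833a4219037c9a75a7c105 ∷ 0x4b43df8ea7fa31824629d9ca ∷ 0x6351017d7d8fece210be4e1f ∷
  0x3e8e4a638bf5a0eddddf7969 ∷ 0x1cd9ac65dd3a0388d4743fd5 ∷ 0x1ab73e3ba99c2bcd5fcf8bcd ∷ 0x652daa503a29fdfba129e85a ∷
  0x598506ba714350847e4f1830 ∷ 0x51fb0634b34f1d50d8d94eb6 ∷ 0x35eb44e0d5755a2f8ab5dc0 ∷ 0x430ab566701d007ad7a0a020 ∷
  0x231ebb5e5e91d8ff5cf4411c ∷ 0x2e3f4157d73089f87ba02b06 ∷ 0x2a168b051738f936afc61ab6 ∷ 0x76f4c334864d79621d14267a ∷
  0x3c267c795335e982de9eaa75 ∷ 0x2d897165e2ac15b3fc35b793 ∷ 0x45c3c1e346080eb88d172444 ∷ 0x66f487a81e63da35387696f8 ∷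
  0x1a7fb0e7241520c6e2f3a01b ∷ 0x70aad6a57358e909cfd3dc93 ∷ 0x75db6aab1bcd6e1d777db1e ∷ 0x76364603d59252f8b507f920 ∷
  0x585cd0b1d51bf908c73f0515 ∷ 0x1675eb11b3655219e6568b27 ∷ 0x4e83429259f83325136e8ec2 ∷ 0x5adb9ed6fa982f2601f93fdf ∷
  0x7109d4ae7495e36684871951 ∷ 0x178c12f5b51a7aff701181ef ∷ 0x399ff18980b317c584524649 ∷ 0x59f99ab97718d878aa6a0d19 ∷
  0x1be3e964af5fbc2bd753dd60 ∷ 0x28d559a449dc6c71c902033f ∷ 0x45d13a930b5b734190bb795c ∷ 0x30f4ed19fdde6594b6d5d5e2 ∷
  0x508f4065998a0587e01b4cae ∷ 0x3b4fd1b391cbca32893c7cd1 ∷ 0x6a577f68bd96479deb393d9f ∷ 0x3bd150468704329cbda7c650 ∷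
  0x5fb0c5ab6500cdfe294c8cd3 ∷ 0x650b3d7dd35a895215d60f08 ∷ 0x654113aa652e6a4c2342452d ∷ 0x461a49a639fd45bdd095de39 ∷
  0xf7c55463df4e4de162383c1 ∷ 0x28731ab4792618b87787c590 ∷ 0x5a035ad44fc4a7123d0e518c ∷ 0x3e06b6c97b4c70e8e08fa572 ∷
  0x2b25be23b12eb52c56a94da9 ∷ 0x5166a443f629d3dde8fad1b0 ∷ 0x298e8a442c6765fa1941278e ∷ 0x778338575ce459a8e4919882 ∷
  0x3f709ad0f3b4551b1d94dd23 ∷ 0x73db5a8b6933b31361ba2d83 ∷ 0x462fdef06581af698554d334 ∷ 0x6a6e20890ce3eb18f93e1e10 ∷
  0x5ef9ad55525e202078d3363b ∷ 0x3a94e52b771724070fb5b738 ∷ 0x4b28704346a11b54b22fb747 ∷ 0x3cc24eed84ecc612c3cb28c7 ∷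
  0x10ada6652291995ded9d8744 ∷ 0x14be10622e6c0d09e8bfac48 ∷ 0x273d75da6b50a6d44823c941 ∷ 0x6673cfe343c5a5046b8217b6 ∷
  0x719f862c8897a95fa344282b ∷ 0x2a118701de54ea5f49f0687b ∷ 0x1b21dc59bea2c8f3df8b5b03 ∷ 0x5e32f15184c70a8b9c711549 ∷
  0x629c704f4a4c388b2b1808be ∷ 0x6ded9459b2acc674dc2f3e8f ∷ 0x4d95bd730114f68c61fcc4d4 ∷ 0xdb93680406f84257cf4c3af ∷
  0x421691b6551a8c99b10fc1d ∷ 0xa6ef70eca9fda454a5b7e3d ∷ 0x6339bc0306317f260b7ad05a ∷ 0x4c0c3cf4f7520d1a286725a1 ∷
  0x556b8f0d60ce2764de385677 ∷ 0x3ddf96ab1081d36cb7c862e0 ∷ 0x33c07414cae9683555a08a88 ∷ 0x5c7929732a8cf56cf5f956d7 ∷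
  0x165418a3db68fc124f08a655 ∷ 0x1de2ec3ca988582f80f1b451 ∷ 0x249b71d35900f66d6ce745f2 ∷ 0x70e6d3658b4e92086dbcfb0c ∷
  0x31a06eb61ebcea71a4c75205 ∷ 0x2ba4af7aa267f1b8783ea33f ∷ 0x235d316cbc6c07bfc02c4ac6 ∷ 0x75ba60d0111bf53b5336d1a2 ∷
  0x28c46986a77826c58393a6f8 ∷ 0x72ca94fa753cf848f7f71cbd ∷ 0x6596ffd85acfe12f817aa515 ∷ 0x3605303d5f8753b87ef6cf9e ∷
  0x600cdf3fe62dae4a516a0e1d ∷ 0x6fe3a56946f07b2d058af9de ∷ 0x3673ed94855aa724f943f39 ∷ 0x68659dc6d62071ad0d23eaa0 ∷
  0x26f4999a4b09d41465f6d0cb ∷ 0x696d22d2f8358d2762dc134a ∷ 0x5c401224dd4c43a4c479d73b ∷ 0x32b65b893608cd9ca00807a2 ∷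
  0x26c472ab4c79ae0bc55fe7f6 ∷ 0x25d3798482d3badfab634fbe ∷ 0x3750ee7e266f7a2292208257 ∷ 0xc9d2d3ce1eb0154a5b71aa ∷
  0x144005bdd162fe0ed28c530d ∷ 0x42df12f8143a1161e165f66d ∷ 0x3d39e300cd3bc7b4e425688 ∷ 0x3ead4e1e37e979fc3a2f70fa ∷
  0xb4a756b79d2e38eab5e8e45 ∷ 0x61957122df830c42d2cd3d7b ∷ 0x58645e8743fe17d7bab62596 ∷ 0x50c5b07960b6063abe76e691 ∷
  0x201bb441f6acf9742894671f ∷ 0x5a33286e7f97ceb5ae99e797 ∷ 0x6cb1f2c2fed99a328f398b24 ∷ 0x5fac095f1df4f85b77ae0ddb ∷
  0x36ba7e45142e904780c4af1e ∷ 0x1ae71a3efe76a855f11ac7a3 ∷ 0x119710c9463ac7e6acd84e4d ∷ 0x7238458eb22010a018d6ea3b ∷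
  0x4c7a30a30a3d1fb4049e6b47 ∷ 0x36d7a813ef6404879676f691 ∷ 0x6e7c567cc0863f7aefb3f9fd ∷ 0x587febfade2ad3696dba12d9 ∷
  0x4b0a13b323b0a4fca5de5805 ∷ 0x6b376ade0c3ffafe6cac6580 ∷ 0x500ef7ca72ee0351e29fba9f ∷ 0x6f48fa8aaee3c387975bae6c ∷
  0x1860dc122774f5ddab1c4960 ∷ 0x26f5809c661fcedf69f9df6 ∷ 0x422c7a9edb172019516cf151 ∷ 0x5c1876c7e642fbf60d51370f ∷
  0x2c9ed7693673c3f53ac03f2b ∷ 0x3867be48dab0f39fa3e0da5c ∷ 0xcd2f4944d5aeb18b2f10e98 ∷ 0x7bdb392350fe16433485a4f7 ∷
  0x34d81dc7fe779017888bd6c4 ∷ 0x6d317810d19703437c18e02f ∷ 0x1d44f86b0f2762db08a1ac39 ∷ 0x254bcf70fce61b98923fb1d8 ∷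
  0x5c998a0571efab255dae0ff8 ∷ 0x2db853634ae6bdd15e63fa43 ∷ 0x45f5723681d804640bfeb2fc ∷ 0x14e7b66ec7f70583de3dede6 ∷
  0x4f497cb8eacf9f836d9dcba0 ∷ 0x1f1fb1f59d31f42121eaf42e ∷ 0x208246f85237cec378b2bc4e ∷ 0x6901fa070fb5911926812948 ∷
  0x5d89d6ea47958cd581680d39 ∷ 0x2de064598e00a945b055a43a ∷ 0x6f0f788c04ad491843b05ff1 ∷ 0x4c831305b57805a683ec908f ∷
  0x79f110b3af5253e07ad20b6 ∷ 0x499b60d22f1e00a1eda36ebe ∷ 0x6814de139ad70f6b9049d84b ∷ 0x63334f0895365410ee00cadb ∷
  0x2f0d83a5d60f1b6fd9ec7b2e ∷ 0x2c292e6410337c5fe35c68bb ∷ 0x643f8eff84edddefcf430d1a ∷ 0x657fd7f086b6ca0fd22f44da ∷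
  0x26527924a8ff79ccb13f2428 ∷ 0x324119386e5fe643b4590c24 ∷ 0xfaa4fd0c79c6dcb779f02d7 ∷ 0x496c083f37f939a50bc36a89 ∷
  0x1f06bdf458f698a1c92849bf ∷ 0x5dea1ac87e0d980e5d5ca508 ∷ 0x2ca5c5206900606326f7e057 ∷ 0x5e3512be11102bfb42aa9b6b ∷
  0xd6359852d8ea2d0e98e9590 ∷ 0x31ec9cbf1d49a9879de77027 ∷ 0x4ca34deeb1597311d868f784 ∷ 0x35e88f83766455d5dddc141a ∷
  0x23f6c5654026e5c4889f2388 ∷ 0x500ab258d970caba47596f06 ∷ 0x633448a70c9dca6d1fb3fc51 ∷ 0x4beee4b8c03e3c9234d45c7f ∷
  0x684d067149b7af3c22f0b87e ∷ 0x1cd1d3598650a740867bf7d2 ∷ 0x2a6ae95ac8225da75d4dd128 ∷ 0x3a1c8dfbc0852cbfccbd5373 ∷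
  0x1c788d1655258baf72167c15 ∷ 0xc88b244b1185ab578944e2a ∷ 0xfa3e9da70947260584b4883 ∷ 0x1c7dc4c2bf85f69d5e92521a ∷
  0x2390941385fdd78815508115 ∷ 0x49b08cfbb6cf32cc0eeafbd1 ∷ 0x5804fc0c5fcc0d7b19a682b3 ∷ 0xdc1a987c15224389cafc572 ∷
  0x7ac1dd1d04190ffc9e17173c ∷ 0x7e1525cda87e3a24857ba6c8 ∷ 0x1c531f15e72070b0b65fcead ∷ 0x6d67f02208731b77986ec9fc ∷
  0x4ae198cac86d4793d6f90e5d ∷ 0x49daeca0658e45b9096ebfa9 ∷ 0x17cc562dd43eb10342a2a126 ∷ 0xbb7e6cd0cf1468b0e5fdc7 ∷
  0x4d417478d5841652c48d7c7c ∷ 0x431d7864e3cce79a6ba5d802 ∷ 0x4088bd29214e39cfead85655 ∷ 0x26ef1b64293fbd986b9013e5 ∷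
  0xb478c121848d78eead18ece ∷ 0x176716c2fa132c225458ecbd ∷ 0x3fdf70f86a337e5ee3881b3b ∷ 0x6e9c558a95ba3f10b39db81d ∷
  0x1cd233554521499ca1c561df ∷ 0x633b92ce80ace7222327fa6a ∷ 0x4e695553d1047a4c418f98d5 ∷ 0x300a6b393d7e422f44859aa ∷
  0x53817fd221ac87e1dd78ee99 ∷ 0x6e669b01f033b6783adb6bd5 ∷ 0x4b10977fbdd0e24a4fb05531 ∷ 0x3b9e194bfbf5384a9e06305 ∷
  0x576e1c54ee27cba8ae9fc8f1 ∷ 0x7b5677f501b0e8ca05715e62 ∷ 0x49fc8ad97b8f565b3cde43eb ∷ 0x5bb73ea7c96555b4d16cfedf ∷
  0x50a38fa6d9418746b240f7b8 ∷ 0x4b68d84b77672d703af11e31 ∷ 0x61c86d2f811002e5e2283a3c ∷ 0x5349a0847f3505b822b4afb8 ∷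
  0x675c438a598228f625178cfe ∷ 0x5e5839a1b9ecf160e2b9e9de ∷ 0x3e3140c4e46826b826f96c6 ∷ 0x4ef8100cbea0f125f949d6f9 ∷
  0x1ee036940075ab04cc43d376 ∷ 0x2c2ecb669bd9d450edc0306 ∷ 0x1e799ce05ea75f049a9b2315 ∷ 0x7ca6c237d39543f654cb28c0 ∷
  0x768021851965e073535e776 ∷ 0x7935c884405e38226614a35a ∷ 0x2f584d9e008cbd5e6dc8091c ∷ 0x523178420d11c0cf58d48ce3 ∷
  0x36128568123657b2fd382526 ∷ 0x4e94a21e7cde9689e6d9bcad ∷ 0x195a055d00b0f28c64892fe4 ∷ 0x53d6897718b892d0e4b1625a ∷
  0x4539ece42b0f98f42330b50b ∷ 0x1b070dfd2ae8607ca3622aad ∷ 0x31626b1a309b3da94f6eedc ∷ 0x5a8311e5d8f4a1faff4a3987 ∷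
  0x41107d2e9b732af733938385 ∷ 0x154322ad4618a565ca6a90fd ∷ 0x6ac06c21200f582327b73aea ∷ 0x363e3eff354448fa8c4f365 ∷
  0x23b4243291c62dece6be29a5 ∷ 0x61d14b98cede8e06dc47ec27 ∷ 0x2d68ffd874a0dfbae38fdd06 ∷ 0x52e96a2b5e43d4d04e56d1b ∷
  0x157bcd3e903688913b61f6b5 ∷ 0xe9815aae99bdc400450bdd0 ∷ 0x14b71e1ab3d25809559744b4 ∷ 0x4cfa7d0e0e4bd8e73f07f414 ∷
  0x4ba0d3ebe502a22b6557c661 ∷ 0x6f6d942ef778cbfe94c4c23 ∷ 0x7c75cbb94d7f33b1c18eb76b ∷ 0x4d23ae78a3738e94f01b64c ∷
  0x31d5c9b48c0c0b44a0818e62 ∷ 0x1eedea98ebe9d7f6d3ecdb8d ∷ 0x321b0c328850352c43de10f3 ∷ 0x5a9864a022f2b77721469b1 ∷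
  0x5e91b9ec127c9ed570dd6ff5 ∷ 0xc1a9a1e0446e2a10b1a2a32 ∷ 0x2b760dc6939dc9cb23b4bfea ∷ 0x71d86546c9f8b4ef2a3347b7 ∷
  0x31547f359e7f05946d0c00ec ∷ 0x36fd04b7c6919784e2f736 ∷ 0x7a9db0465b127d9ae681e21b ∷ 0x7606bf93f7c42db899486d23 ∷
  0x368490ca0964f557b55809df ∷ 0x1b30534c0f090760d4c52f9 ∷ 0x302a3f9248423ad19aad8976 ∷ 0x4db2b8f0c605eabe706f504 ∷
  0x2141c76ae01e2bc662974e54 ∷ 0x226ba124962f91c0003bee21 ∷ 0x4db67d5d30346f62a77cc007 ∷ 0x6bec1faa03a137e2a34cf9a3 ∷
  0xf6729d78d0e7e0b6d2bc2ee ∷ 0x17132460cdbb818ec20aa782 ∷ 0x662d5d6ebe69014c310cf256 ∷ 0x2e27b113bacd253e4dc2028f ∷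
  0x7e87ba8264f68adc9e692962 ∷ 0x62b48f18ecbf5e34a49474db ∷ 0x58c5dd27166a2533e315f408 ∷ 0x9699ae9ed60e9a1f5ca413c ∷
  0x303c6dec9fb433d5c28f99f6 ∷ 0x412a9463bbd7d92a79e5415d ∷ 0x35c29c5c30f7e6bb6bb3c6ec ∷ 0xeb5f5bb3443f01a3f2c4bcf ∷
  0x558ce609ba9bf1b5e3782b0 ∷ 0x4f665645ffa9db76c4ed6dc1 ∷ 0x6a148a23114f67399f6ee03c ∷ 0x66e5cb7c7b4639941ab5be66 ∷
  0x1401903d84ae5095f9870e2a ∷ 0xef65b67bb5eb49cecaf7614 ∷ 0x5e436538a46e5e2e1dfdaf82 ∷ 0x38a2b120f9f61c88666f1d2e ∷
  0x1d9b77a874e91f8ed2dc03ea ∷ 0x2c5a44b47b31bb3afde7adb ∷ 0x609acc12d50122ab811c648 ∷ 0x89e148ca759960931649c71 ∷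
  0x7b8018897871618f4360076a ∷ 0x1d1cd541a3abb8acabfef6d7 ∷ 0x5517238ba47320ea03b0e5ca ∷ 0x1a182584860d0c28a326b4f4 ∷
  0x3b7a597125d757bdf98cb3d5 ∷ 0x1488db9275f6a251d92dd8f5 ∷ 0x1fc3b8bafed968eae8f50ca9 ∷ 0x15337fd997afcc24a6b481e ∷
  0x36c9495aac51f49648c9fa95 ∷ 0x7234319489503af4d4a6c4dc ∷ 0x2a083262c7f33f7fc0cf359f ∷ 0x512983c4257870d91dc0db47 ∷
  0x4aa13baecb46d04831a13845 ∷ 0x5a5d8e009ca0fccb2d32a00f ∷ 0x51a8325cab46de12869eea52 ∷ 0x267b31333e3f4d1a6c9b8da9 ∷
  0x7ecdc540c2a4d6aec5f8d8d ∷ 0x4450f9fea917990dd2eddc78 ∷ 0x43911226c0b376d14d692bdc ∷ 0x60589f5c2f2bfd89ee95af94 ∷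
  0x71b97019c1beb27369f70fab ∷ 0x208fbe583f46371e4c675ba4 ∷ 0x3937da035acb8355ad932eea ∷ 0xf4ddce33942bbdf249f0ef5 ∷
  0x59e02c61647881aa0b161b1a ∷ 0x316dbbd0a2978bb6d10648f ∷ 0x720fc9bf0da041379fc9ecd8 ∷ 0x38f83151d7cfb047b5cb9f93 ∷
  0xd173816a93bf202d72f511c ∷ 0x7b483c2c75bb7927caebefd7 ∷ 0xbe232f1782e7caf19415ae ∷ 0x217ff39bc9bb7217b2b5b653 ∷
  0x5c5d9d14b5b17cfd85e4ad98 ∷ 0x6ea9a40c1a3c4529375d3885 ∷ 0x5797a7168b8816ac7eaffe41 ∷ 0xadea167ebcde4638c47a17f ∷
  0x57c22fc25a72b0b9d0ca5276 ∷ 0x20a46a7080ae4afcb2e6f1d2 ∷ 0x7854216e823ab10480a7d174 ∷ 0x61d39643d396d2b8a99dd20b ∷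
  0x3962759acb6dfb26e23ed1ab ∷ 0x5692b04b6984da6074010975 ∷ 0x2de2e769ea23b5a8d0303652 ∷ 0x285a1ae8e0c7d7b87891ef20 ∷
  0x62f21626fd9b8a17966c5430 ∷ 0x1de4ccbfdb1be3b90772e01e ∷ 0x67695caf31a422a4aaf23579 ∷ 0x126c090e00a31b71415f91ea ∷
  0x745a57e2ebd5a5b1cbf1c42f ∷ 0x4c748d3518bab562d39b3de4 ∷ 0x1c32e1b4c8dd9c1091f9387a ∷ 0xaca458cc01df73a7fa7d6d8 ∷
  0x6416a63c906c795be9104109 ∷ 0x1fd8d83205d0e0a29b937b3f ∷ 0x25d5ccf394167b6dd6a841ea ∷ 0xfcccab2e4a914316c6d9393 ∷
  0x6dcd481c599a086d5257b2e7 ∷ 0x111452aa95298091f7801eb2 ∷ 0xa1edaee70bb6a0c97b84ef9 ∷ 0xce6fd93cac0171dc17001c8 ∷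
  0xa7f38fad5b8dd39bc674624 ∷ 0x81640d48eb9f0d9ca46406e ∷ 0x230af4c3377e86d21a0e9f86 ∷ 0x6ca6767d7bcd3b0d7e28afff ∷
  0x4b5c67bdf94c35f3293dc00f ∷ 0x1279b778d8098824b90ef06c ∷ 0x1ead7b1258cab7261842eec0 ∷ 0x40dc3ed96500cb4d69f2a83e ∷
  0xa1d9799aa21dc1fcc7c9a2c ∷ 0x3cb7a6c70bcf33fac44ea46d ∷ 0x12477a8a26dc0f8014faa90a ∷ 0x20e89503e72207392e16b66e ∷
  0x5b99bca97d22b82cde856595 ∷ 0x1c8202407cce4f4604e41c40 ∷ 0x6c36578bcba35be8db7b3777 ∷ 0x65893b5b3a0660ff69073b45 ∷
  0xef763fa06daf7efa7915408 ∷ 0x586c7b8ac41313665471f88d ∷ 0x6c12838153152f46f7503786 ∷ 0x69c277b087090e731a4d6b41 ∷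
  0x660e26554b7e50c01b92d3fa ∷ 0x33ac9ff87e2557277b7bbc39 ∷ 0x701c873d8e09a7d328aec6b2 ∷ 0x7ad434ffdf02a9c4e21aa5a ∷
  0x2b91cfba7af7ea5f1ce93019 ∷ 0x549b051b8ed152ea6a904ae5 ∷ 0x7c580790dd69c064fc11cfc8 ∷ 0x71f6e06f1defe3f5229567b6 ∷
  0x7cf47e3f36afd7546e7818ad ∷ 0x7154878ce36dc98ebbdb2144 ∷ 0x12c4ddc7e315a1107fc9dd93 ∷ 0x6c811d62a6d4aae284971274 ∷
  0x715d82870f58fb98e15d7f5e ∷ 0x51365381871ed3a4a92d3e5b ∷ 0x9c7c7f3213626c30e87dd54 ∷ 0x26876f1965f7483c57d6be0e ∷
  0x72ca78bc14f669c5ce0af6eb ∷ 0x7271cc3a8a67b528e9320466 ∷ 0x6101556d56aaef022c90a41d ∷ 0xe5ed40b12b445b8cf2042bf ∷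
  0x25b2d5bddc8820ab8336a685 ∷ 0x1b7b0c9136e2a44bd4d7d9db ∷ 0x7bf5df149080c64ce82c8bb4 ∷ 0x24e9424432942d3db5af38ed ∷
  0x2d9360c2e0e9441b5bb53085 ∷ 0x7514395dab77c39b8a6a7389 ∷ 0x7b80d32958ceb33c54df86fb ∷ 0x7bbf6e5dc5e553822f1be62e ∷
  0x3c2d6f056d12fb819a4c6760 ∷ 0x6407f268c291ecd60697a0e1 ∷ 0x7b92f5ea52a34ae7d84e4edc ∷ 0x3f5bb93ea3926d92a37256fc ∷
  0x1ae079946fe0f98302d1d9b3 ∷ 0x5f2a097629b06c13615f1500 ∷ 0x78f782d39a425ad52524467e ∷ 0x6f1c2f120478bd1dcbefbdc2 ∷
  0x2e1b8ab3b49c6d6d2d4920a5 ∷ 0x76ab5e44de41493420fc9423 ∷ 0x6678146b45fdd449494050ed ∷ 0x21db8f492431b3c82b078218 ∷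
  0x155e10f9788df038cca4d62d ∷ 0x35237f7255eb23153cb6e583 ∷ 0x1b6acb45228ca38938025868 ∷ 0x19963bb3c204b02b7ab1f5cf ∷
  0x511766e76b084463c7c50cfb ∷ 0x14ca7935947de02472f193bf ∷ 0x75000a48f74f7d47fa86c7aa ∷ 0x105c0ecee07355e09a065335 ∷
  0x166987960353c741b85fb885 ∷ 0x2468e6790eb7ca97542e759e ∷ 0x3f286e29a4907f6cb838419b ∷ 0x25e975c795ae7fc2387b1459 ∷
  0x47147841c0fd85f5d36e10d7 ∷ 0x6c5e82f27f11cbe4d13055e1 ∷ 0x4fab8eca71fb52a7ad39692a ∷ 0x20c44a6f69597202e9d69d36 ∷
  0x7f9e676e390e33f6d9082c5d ∷ 0x72e71022c79adf4c51260b3a ∷ 0x4a20d29201edcc5907e93c66 ∷ 0x3b1aa1c27f0580703e2dc8ac ∷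
  0x2bfb476540c8c0b96f90153b ∷ 0x415e289a36311b956ac7a789 ∷ 0x24fefcef69c8d8956cec897a ∷ 0x1dc8e6b808e77893e3a2acc1 ∷
  0x295365323d7aa22d71ed92cd ∷ 0x7b4e7d7a4a8a53dd9bf063b2 ∷ 0x3eabcbacbcfc7bc6942dff5d ∷ 0x30188644d6421a56d3f911b1 ∷
  0x64c946899619ba9669fde551 ∷ 0x4878bb2dcc3267afedc63d01 ∷ 0xbf7954d93c953d7e10977fb ∷ 0x30ef89f567c8b4793824e705 ∷
  0x160c9e910f7412061fc246d8 ∷ 0x80cfd13f597c6dc80ebd337 ∷ 0x6db7d658863d2b7231dad0fe ∷ 0x3bccfc63c1dd5fc1c34aad9 ∷
  0x7c826f3b445fbb247002ede9 ∷ 0x403124a1d041c451a79feb93 ∷ 0x2aa5f30d7297c0abe8d3df6f ∷ 0x4900945fb421abc2941dc615 ∷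
  0x57a5fdb0e8833c8757c9ef92 ∷ 0x1318a1701911fee2f59182b ∷ 0x1244b6146f191cc882b785f ∷ 0x6c1e8e7cde75af2a16dbfc92 ∷
  0x214885d96d35efc90de56816 ∷ 0x64ffff54aa07c0994a9bbaae ∷ 0x5b0978fb0807fd79ef382c20 ∷ 0x1fda67ea511d76b90300cd2c ∷
  0x7f3005290a994dc8e3095de ∷ 0x27cc0d5d80ddc1d03537d6e5 ∷ 0x435584312e922848f9c79307 ∷ 0x1c60a09825c448bc4a860a7f ∷
  0x62ce60ad6953e43b6c949bf3 ∷ 0x5fb0ac6ae5d2670d91ccde47 ∷ 0x22d420f659118f1fec3e8bb2 ∷ 0x7655b2f9c0603a1a0670af07 ∷
  0x5cbc4db52bf8a5c04e38824d ∷ 0x1936ee07b88d2f58d1f4a568 ∷ 0x681f1a654587be04b1e25751 ∷ 0x35d77c0ffc630569913686e8 ∷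
  0x3315d7115518f7d9b6b1e3c0 ∷ 0x47c0e65f8da3bc09f58b40f5 ∷ 0x64f8de1ae4b848bd5dbe76c9 ∷ 0x4fc126684627922678b6a3f1 ∷
  0x2bfd3ea2e6f9370f7d6a1fc1 ∷ 0x7d2172b8662a9524861056ac ∷ 0x2674cde9f45252ac2404f51d ∷ 0x704afc12e3914fdc4bc79077 ∷
  0x781be679ffed8512bcc92067 ∷ 0x505dd7eca6b993819f9df8ac ∷ 0x77899c2de54b7e2069c78e9f ∷ 0x18bb859908df0de9c1ebd59f ∷
  0x46b8e54753a1747edfcc1e14 ∷ 0x289aa0bab953c1ec3154f726 ∷ 0x430e536379e546cb4a47562f ∷ 0x1356fe4af0d8ec8bb5c5c99 ∷
  0x62d2318148a806952b6d3a67 ∷ 0x31a5ff8bf6e3c8b8f3caeb55 ∷ 0x34f8204bd47bfc4f6c0b93d0 ∷ 0x1d181bb319adb4da35ef8d80 ∷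
  0x319849663dd62c0e319e0e1c ∷ 0x59a5d6737bf48f8c7a22c176 ∷ 0x6fa0736710b76651da6b4697 ∷ 0x6635f0373b555c513961b928 ∷
  0x2fc7b0ed409596e9aa1e13eb ∷ 0x55ad616f5456a2baa99f3d1a ∷ 0x2e7ecb552c4016530e47698c ∷ 0x5ce9ca3724698b9b22e4a968 ∷
  0x2d73a87aa98d3d629b22e42f ∷ 0x7e7b6360ae94ba6c7b819302 ∷ 0x6aa0549138a702457b1e82ce ∷ 0xe9c2bfc484d6183ee78c285 ∷
  0x67ba905c1919af2be5f48b07 ∷ 0x5599afce2142fbbfbb8f1bf8 ∷ 0x6a901cbb63d2fae50b0998bb ∷ 0x21f33aabbbdab9d846d2c5f5 ∷
  0x2645b34909ba971f9f5883bd ∷ 0x555cd8e963f38300ac1b41f8 ∷ 0x6ace5a6a19952930e8c60e6c ∷ 0x18bf9882598a658a4135714 ∷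
  0x1b44c0ab9a9319aa3065c1b0 ∷ 0x5fe8b73a04612325b36c20a9 ∷ 0x2961ccea85da124f1718944 ∷ 0x30fdf7a17d7b9ae03582f3b0 ∷
  0x6aee14cbce671838bf400034 ∷ 0x48c0e7cc1ecc8f9aba8d6fe1 ∷ 0x5102a323e6d1b09a55ad76b0 ∷ 0x66e63244b63bb5aef219cf37 ∷
  0xb25d89f1aa4693fe15927b1 ∷ 0x2b51a3d3b3445feb9607cb18 ∷ 0x4fbd96ec9a3e888a7a41b6f4 ∷ 0x625f252e7120bf45e50119d4 ∷
  0x28211f41b7b056752fa50075 ∷ 0x1d7f276ddaffdc215dfd3616 ∷ 0x64927b292af2182951f9fcf ∷ 0x477297fdc8b193c03afd2fbd ∷
  0xb72bc8f5d098df9515c30b8 ∷ 0x3769acc2add5e9008d410f63 ∷ 0x2fca800d9bfe7315d11387cb ∷ 0x34968cdeb93a192a84fdae75 ∷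
  0x18bdb12f7ee994917953e393 ∷ 0x44c1014fdad9545d4691d3cd ∷ 0x58b506d08c3e1a0a2ee4be61 ∷ 0x1ac88fae58e7ad1f3c41876 ∷
  0x2fa72e6d6e5fb00a8cd1fe31 ∷ 0x3d417c78b9f23b49aac437c4 ∷ 0x7764a95899e6a982efbb2b57 ∷ 0x386acbd8c2bda01be357c265 ∷
  0x2fee5e2ced86751588be9730 ∷ 0x2062688bec8bfdc8ff85c48a ∷ 0x4b0f5b4083da15c7b621087f ∷ 0xee6ad45bed9ddc23076d0eb ∷
  0x53d0dbf5505e61069589d643 ∷ 0x47e319e37e4df29f30918471 ∷ 0x7a5aca5b0082802adda145e7 ∷ 0x28d72e29ec8306d0a7273d23 ∷
  0x2510fc9eb6ed2b343f13f3ed ∷ 0x6a9cf4eab355ec2767d25a7f ∷ 0x3e0c38ebfb3c163d685df448 ∷ 0x60ddcac2995f734e9f49d9cf ∷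
  0x6559e0ab68ec290aa72ae843 ∷ 0x77d1e975e35f917aea3e4312 ∷ 0x3862b93401015c8640d2e796 ∷ 0x7e602c37bd534aa94d8a88d1 ∷
  0x121013ed4ee1f89bc178bb81 ∷ 0x69c33072e430085eafe26410 ∷ 0x3699c0a2dc35a8776cc937e9 ∷ 0x4c3918bf20c0f63a5829aab7 ∷
  0x14cb796e8f707b19ff4b87f2 ∷ 0x69054c8fb0fe1a4015a6c9bf ∷ 0x6a99c8472da4870f52e8fa7b ∷ 0x33afe097f2aa4c4920a08a30 ∷
  0x68661f735d6164534348e67a ∷ 0x4f836137453537398e5fc727 ∷ 0x5f9b6915963a4080c508799d ∷ 0x6e4419ac77d4f5250a0ad4bc ∷
  0x217c2b16dfb5b33ae6d0ed12 ∷ 0x1c9e70b805c5a6aa83a0bcc6 ∷ 0x267ab32fbd62aa95675bddb8 ∷ 0x7c1971ab199fdfc9b45d9f55 ∷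
  0x79c471609de2a415de963885 ∷ 0x14a4e4e073e35eff1fb9428f ∷ 0x5f75037441c33ab70dca6af1 ∷ 0x77d20800f359cf0f76ff262b ∷
  0x1117796af5739b9d97bfd27e ∷ 0x5014b5e6f68bb6e45dc4c399 ∷ 0x1b65b9c06db28dde3444cf1a ∷ 0x3b9db00f77f37b8c23b083c0 ∷
  0x3b13b7ee1050dd3d9258cf6f ∷ 0x3c6164693a96f43b3c5ec6f8 ∷ 0x6dfe2c28f9b8f0b7eeaa357 ∷ 0x24f5dda265e754598ca978ed ∷
  0x62fe2273a8b74704a8f341c ∷ 0x21f19363143b249756fc729b ∷ 0x20f28e34bd45f4344d132a3b ∷ 0x22d13116208bc30ce83ce4a6 ∷
  0x508a85727a66a1156b6156ef ∷ 0x48436b00f3d67098ec8336de ∷ 0x79b173526b54bcb545874b9c ∷ 0x785b0e96e66651c896ff8234 ∷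
  0x26d9800c7a7da889c2813175 ∷ 0x5d39ee8b1085c29ffc8ae7ef ∷ 0x6ad8628bfdcb65ebce349ec4 ∷ 0x2c7be3131043f842dce6e9f1 ∷
  0x3cd2f335623d21e7fe3a628d ∷ 0x27114aaa004e57c7183a33a8 ∷ 0x43b0dd571bc7f0356be1f49a ∷ 0x70479e37d8d88848c10c970f ∷
  0x7632d7e47d919c83a2478a2e ∷ 0x6e7e334c9f6af1ccd7186539 ∷ 0x4fd79d1768b81623107db421 ∷ 0x3c353603022357b12858f462 ∷
  0xdab3450e895483a77e15fc1 ∷ 0x75c9b0a1b9819c50bab78bc6 ∷ 0x350ce238acdaecf1a614b15b ∷ 0x7d8c731abe20b18bc4ce23be ∷
  0xf21ada2da19b456df7120f4 ∷ 0x1bff4bb3b6749d7899d9215c ∷ 0x4fcc847372a46fb264f86270 ∷ 0xf6e95ffd3598df39d634e04 ∷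
  0x56b0902074636dd345ad83de ∷ 0x3d21ee0ed1877b351ba4a331 ∷ 0x71d18ec1f5e5a8f3953aa94 ∷ 0x56ca7fecdd16083c5778edc1 ∷
  0x353f33cbed933c10ffb3377c ∷ 0x2fd4e0e9f185ec5e9239f62a ∷ 0x74cd724eb41526ed2e3bfda5 ∷ 0x79e55bc97bd1da7d0394893d ∷
  0x30e518ccf9e2956d291aeea4 ∷ 0x6136362cd045a976fbf9a830 ∷ 0x4f83f77d3e40906f406254fe ∷ 0x521f7149c19d2e135764fd13 ∷
  0x3b09a772386a8a7586d486e0 ∷ 0x302eab4b52b48d1edf2bdcde ∷ 0x18de87eb2e3723b39f5ede33 ∷ 0x32037da275f9fc4760cb1e3a ∷
  0x642ee726ad753a4eb7e27a ∷ 0x32d835a013b65869fc7034d6 ∷ 0x209b97bf373013f5e90509c6 ∷ 0x58f4ceb749b7f7a0b720c625 ∷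
  0x2cf3577737c34cb224cbccb8 ∷ 0x1622e192a1f02429192a6eb5 ∷ 0x6952e3c7b58446c0ba87887 ∷ 0x604d432fa317ac2db1b3fa44 ∷
  0x44beb5db9113f736026133ec ∷ 0x285cb01c1c8ac646f4ccb65b ∷ 0x30e20d7383316879b4171aa ∷ 0x15b7e6531657463e1abd618 ∷
  0x3faa89618e79aeb921c8dda0 ∷ 0x14bbb530b1c515b6d609fe6 ∷ 0x6f83d8a0c5d00a9caf4c219f ∷ 0x1b2e5be773ef9223a9724a0a ∷
  0x352bc9ae8f39720ffc3a08b ∷ 0x44f0049461a16c397c5edd7a ∷ 0x3d6e000db25336d3dbeb9285 ∷ 0x62cd5b55f1a0b5c49b712609 ∷
  0x3b05613208fc1f9721f19f75 ∷ 0x6935676184c09d461778a6fd ∷ 0x4e1adc3a04565e1e796e0178 ∷ 0x6c96637b8a8a1d7d04d4e743 ∷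
  0x2c6fcddc1717797b050fcc70 ∷ 0x6017f5d7ebbead72e81d1df9 ∷ 0xc5005c3f5c44076f7a70ba7 ∷ 0x72332253c6fa462c0800618c ∷
  0x4866f922b6080b66ae9afb13 ∷ 0x14427811b5615b0e9c549db7 ∷ 0x72abed561c5aa7f0b2a792f0 ∷ 0x7a41d167e5dc13872a6a1217 ∷
  0x7dacdb3c2a1619de481339ca ∷ 0x141d33f93aa16ba59e201858 ∷ 0x3d30c1c60fa5f312bd39cb9 ∷ 0x1e1e54cb57b17ef0d78b4138 ∷
  0x1726b156735cc6ac299349bb ∷ 0x45ebaf350a1bdbfbc50c15f2 ∷ 0x6e343c7542b97b5921cbe253 ∷ 0x1fda7fe68c3438493347d79c ∷
  0x91080a2209a7eed5efc10fd ∷ 0x2c6d882e960cd70323e1788e ∷ 0x5799d75ce8b20fec9e9acef9 ∷ 0x49eaa883f69617e1fe9ee684 ∷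
  0x6e0ba005e73281a5c4df7580 ∷ 0x4b9a7b1ea1532951a7ad9023 ∷ 0xd1aaf540ecd01c1535d93e9 ∷ 0x3df35a98fafb60510834d024 ∷
  0x147abcc58e99e2d87cc31a20 ∷ 0x727217cd3bef04b89ac4e5ec ∷ 0x4fe41ee35e14970e2b45a761 ∷ 0x1a9201927f087730f09836a ∷
  0x4d3c1fc89ad485c3a0551307 ∷ 0x4df21793b2d462177078161a ∷ 0x61136642065c2a510a6930b1 ∷ 0x679476b8753c332a8e64ef2e ∷
  0x31ef107571d11634712fa78e ∷ 0x2e8ad29412eb9b216b7615ec ∷ 0x37a6d937cf6e09625aff6001 ∷ 0x6c2491463fc4090164916ae2 ∷
  0x79dd6b6e20aa0b400b1ae3fe ∷ 0x4512ff3c8c40c9bda65c56df ∷ 0x56d5b6a6c0cbb08e420ea786 ∷ 0xafaed29cfaf4dd0d52af872 ∷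
  0x59a791a785a25a2a831bf297 ∷ 0x758bd3b1990fbe6175019a1e ∷ 0x42b2124d20d02e1dde90cf15 ∷ 0x65df10cf7a4ba0975c9d4185 ∷
  0xec7e46515b32531d5ad954c ∷ 0x4c43f706517ddbb061e7a24e ∷ 0x4a4790d402905459f89bbbea ∷ 0x39c68001f52df9c9e25e6b3f ∷
  0x7b6bfda6e6ba38d78af8e0c1 ∷ 0x7bea5cd76c5edf8b7aaf669a ∷ 0x3c61dc651d38b6b4b21224b7 ∷ 0x59112ed6dd458a178140166d ∷
  0x45b54ef991bdc6f9de4de6fe ∷ 0x203535c9360996c9e7977973 ∷ 0x1566203ce898e58dbd19ddc1 ∷ 0x5e20c09667432ad01946b30f ∷
  0x65304b294f55e376c976a0bf ∷ 0x5c91b7bec48f9ce3b8d47bf9 ∷ 0x7a1502177ba683be5b67961a ∷ 0x59fb0102d66418f4985a8d2f ∷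
  0x23b15d5e33913127fe2765a2 ∷ 0x3e6641dd2274bed5d2d8e6ce ∷ 0x19fc23082269fb58be94520 ∷ 0x4f06cbd0eaf00219cfce5f6d ∷
  0x3ab6fd6f454e7a8670e3e5c2 ∷ 0x77221df2afd5e587ebbecbe6 ∷ 0x8d9f917cb5ced0d79018186 ∷ 0x5684ce804fa88691e988b58a ∷
  0x197768fcc5a142a10c25fb35 ∷ 0x1a7a4f693a8a89a827f933de ∷ 0x5dfc6149fc93bb27aa516176 ∷ 0x474f9af6f71283f51e1c61cb ∷
  0xb20cc32756c30acca41067 ∷ 0x2a67d7ef24668438ceae61a4 ∷ 0x438fe8836111c49efe73534c ∷ 0x35b1c0d41258d8131087689b ∷
  0x7a26f44d2e8784ea4f7a3b1 ∷ 0x760d1a253ba5d27a1b7a43e4 ∷ 0x5268f0ccb96694b8872eb1fe ∷ 0x68a44004702705b21cf73f95 ∷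
  0x48fbabb180f766a813d6bbde ∷ 0x7bec655f8391642df849ae60 ∷ 0x3fd35ac8a7848e3f59154ba0 ∷ 0x7e92678806d70ef2560c7c2a ∷
  0x45a1ba9be364fd4d77281640 ∷ 0x78d75aa1f9669830b3d4b16f ∷ 0x37ecfa1aad3f218286a7ddee ∷ 0x4e942fb6b49d458f7d96f6e1 ∷
  0x5edbe1ea17db23923030d271 ∷ 0x6f6e77e87fc9ee12f7db4430 ∷ 0x622ac8eaabec543e50a6037e ∷ 0x3ab5df4ec0a1262e8110b016 ∷
  0x535017df0c519ea72e6f8f2a ∷ 0x707986c37bc0a8c4c1ec040c ∷ 0x6f3f9c83c05529be30b64016 ∷ 0x43c767b429ed08cf5cc9169a ∷
  0x551be3949dee79996da93347 ∷ 0x5d40284a55dd4ae4872cb37 ∷ 0x1c50797cbaa0c5c38f9a6ed7 ∷ 0x6b65d5f74901c10be435b42d ∷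
  0x16aed7c3f0be0862f6d1ebc5 ∷ 0x3f71b9569fb5c26bca65ea8a ∷ 0x682d0b14338be9b590c124f2 ∷ 0x41024e54c7f996ab67041236 ∷
  0x67d81890407f793303cedb1e ∷ 0x71ba836fcc49332e67ea2654 ∷ 0x741ec550a4e2d742ba49e602 ∷ 0x52c750411d5ac93b95005135 ∷
  0x2da7f0ddb8d1d685f7e22116 ∷ 0x164689699d0765f389debad4 ∷ 0x90b8b005bcde57033b36b4c ∷ 0x16dfd861b7a56ae9be433257 ∷
  0x70105f2e584b9416410c8b3d ∷ 0x622838c291917236d6176ce8 ∷ 0xe0613dfc5ea9f8f9529baed ∷ 0x3aea720d53ed7ebedabcbd9c ∷
  0x537ec620fc7bd1e88beeeafb ∷ 0x79c58859c5c38898c81349c3 ∷ 0x4e360332454b167fbd6ea30b ∷ 0x64e3897c33dfef4fa11c8f5e ∷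
  0x287e4b4ba37785c91bae29ae ∷ 0x1b5dc6de44165adb9c6e2df4 ∷ 0x2e08f9c74a63dc0b0bc4763b ∷ 0x5d44c8b5de861e0089c8912c ∷
  0x1ea74ccfad4f78d6cfb53ed7 ∷ 0x21d375ba1a2cffd757822df ∷ 0x2c3e323e2b9643a881d8228 ∷ 0x1abaee24161b59e74007be3c ∷
  0x70bbe0239a6bedbab480c258 ∷ 0x6c64fe5fe046fb0d7579e5d5 ∷ 0x4df1a194791b4e33a60f51b5 ∷ 0x4bb80dc031a4b2abb765a1e9 ∷
  0x52db972d15768b0170c8055b ∷ 0x4ca41bf6bd8bec0abc040932 ∷ 0x791ff584f8c40ed70b53a256 ∷ 0x6fe475786e60f2cb5d15d753 ∷
  0x1a5b844df044cde1cbda677 ∷ 0x315d29ff37b2708d6b73e6de ∷ 0x3b5225888400cc150cb6a872 ∷ 0x40f6d94b1d00949e90519d54 ∷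
  0x3553a55ae98a66aae3328d83 ∷ 0x2b9b9cda14c58bd1bf73dc85 ∷ 0x6eb35a906c215b152c219d6c ∷ 0x20bc00ebac9869aa50c3c8f8 ∷
  0x1384c93e0f2de9da4e22765d ∷ 0x4ce0878de4b5b365a00b9fe0 ∷ 0x73ab4196f6ec1a711575a5a7 ∷ 0x1b9f1298e12f5e786dea88e5 ∷
  0x1905d1e84740549169c1b3b6 ∷ 0x48a237b693b693345e34e936 ∷ 0x81487505bfdcf392309ef0d ∷ 0x14e0a6279eddd64f7e2adb78 ∷
  0x6609be1859249ef9baaedee7 ∷ 0x173bbbae0b54ac6bb0fe36d0 ∷ 0x5edad8523a728b900d59cfff ∷ 0x4453a69d301f5164cd971231 ∷
  0x1286f7eb581aea35b0c7fcf5 ∷ 0x313bc5fcc3f5b260518b96ea ∷ 0x1b77ecffb90f76092483b7b9 ∷ 0x4c3af9e581340763549a75e6 ∷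
  0x19ade331988c55ede01a24d8 ∷ 0x425093b6fe9b0c3d7205c46e ∷ 0x35e9b3cd12f63c6828342de7 ∷ 0x2b7d48227301a120bad4bf4 ∷
  0x3d67c3cac47c2a37e894645 ∷ 0x2921aba2e28154b842346709 ∷ 0x4959df3764dbbe603967a695 ∷ 0x2145f492199eb9d93937e7e3 ∷
  0x19bbc5085dd51ca3f37629ef ∷ 0x58ead03ec17da297ec7359d7 ∷ 0x4719d37bfaee1f0feca47a88 ∷ 0x34b1cfe3fdd4eea8c67fc0a5 ∷
  0x39a00672af34299250f20817 ∷ 0x335d104f9fc7211c0633ebff ∷ 0x1ba6e2841881147f43f81da2 ∷ 0x10aa655c2ccc754da64707fa ∷
  0x154af3eee3ba449c77c05fe1 ∷ 0x7ff316e0460a958b0d6c1e93 ∷ 0x11e39047a4056da44215c42b ∷ 0x135dcbd9ddb9dd697418f63 ∷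
  0x7d2c88f514fe99bf0c6a42ff ∷ 0x7483462170615ded1569964b ∷ 0x2f7a4bb3ce7322dae830e84f ∷ 0x1bd4dded48d5377aac579af5 ∷
  0x2ad6b7383a90a6018297085a ∷ 0x64a62624be7a8f0a2ef3e402 ∷ 0x6550627e114508d6597cfe10 ∷ 0x274305a579f5dcad55b90764 ∷
  0x362ef27327e461fb0ac31d38 ∷ 0x1841172206e673a0aca4f01c ∷ 0x46a9e8cd7b430f52d310a20a ∷ 0x769f01ee5d896ecf54d59b9f ∷
  0x5fa9b460fa982981a590f314 ∷ 0x44cd69f658a8c8d63fd8671e ∷ 0x3b8e286f2c02e649e690d81f ∷ 0x9d26315d5abb73acac51e58 ∷
  0x7f379b9e262b2187b842be0 ∷
  []

-- The fields with 2⁷, 2¹³ and 2¹⁹ elements.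

mul-spec₇ : ∀ u v → GF._*_ 7 r7 u v ≡ Field.horner 2 r7 u v
mul-spec₇ (c₀ ∷ c₁ ∷ c₂ ∷ c₃ ∷ c₄ ∷ c₅ ∷ c₆ ∷ []) v =
  cong (GF._+_ 7 r7 (c₀ · v)) (c₁ ⟫ c₂ ⟫ c₃ ⟫ c₄ ⟫ c₅ ⟫ c₆ ⟫ refl)

-- The values 2, 5 and 8 of `h` come from 7 = 3 + 2·2, 13 = 3 + 5·2 and 19 = 3 + 8·2.
module I₇ = Instance 2 r7 (by-lookup (λ v → GF.mulX 7 r7 v ≡ Field.timesX 2 r7 v) (λ _ → refl)) mul-spec₇ codes₇

design₇ : GF.BalancedInvariantDesignExists 7 r7
-- Each `refl` is a computation: five decide the field checks, and the other three decide validity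
-- of the base triangles, distinctness of the keys and the count.
design₇ = I₇.design (I₇.fieldChecks refl refl refl refl refl) (I₇.certificateChecks refl refl refl)

mul-spec₁₃ : ∀ u v → GF._*_ 13 r13 u v ≡ Field.horner 5 r13 u v
mul-spec₁₃ (c₀ ∷ c₁ ∷ c₂ ∷ c₃ ∷ c₄ ∷ c₅ ∷ c₆ ∷ c₇ ∷ c₈ ∷ c₉ ∷ c₁₀ ∷ c₁₁ ∷ c₁₂ ∷ []) v =
  cong (GF._+_ 13 r13 (c₀ · v)) (c₁ ⟫ c₂ ⟫ c₃ ⟫ c₄ ⟫ c₅ ⟫ c₆ ⟫ c₇ ⟫ c₈ ⟫ c₉ ⟫ c₁₀ ⟫ c₁₁ ⟫ c₁₂ ⟫ refl)

module I₁₃ = Instance 5 r13 (by-lookup (λ v → GF.mulX 13 r13 v ≡ Field.timesX 5 r13 v) (λ _ → refl)) mul-spec₁₃ codes₁₃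

design₁₃ : GF.BalancedInvariantDesignExists 13 r13
design₁₃ = I₁₃.design (I₁₃.fieldChecks refl refl refl refl refl) (I₁₃.certificateChecks refl refl refl)

mul-spec₁₉ : ∀ u v → GF._*_ 19 r19 u v ≡ Field.horner 8 r19 u v
mul-spec₁₉ (c₀ ∷ c₁ ∷ c₂ ∷ c₃ ∷ c₄ ∷ c₅ ∷ c₆ ∷ c₇ ∷ c₈ ∷ c₉ ∷ c₁₀ ∷ c₁₁ ∷ c₁₂ ∷ c₁₃ ∷ c₁₄ ∷ c₁₅ ∷ c₁₆ ∷ c₁₇ ∷ c₁₈ ∷ []) v =
  cong (GF._+_ 19 r19 (c₀ · v)) (c₁ ⟫ c₂ ⟫ c₃ ⟫ c₄ ⟫ c₅ ⟫ c₆ ⟫ c₇ ⟫ c₈ ⟫ c₉ ⟫ c₁₀ ⟫ c₁₁ ⟫ c₁₂ ⟫ c₁₃ ⟫ c₁₄ ⟫ c₁₅ ⟫ c₁₆ ⟫ c₁₇ ⟫ c₁₈ ⟫ refl)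

module I₁₉ = Instance 8 r19 (by-lookup (λ v → GF.mulX 19 r19 v ≡ Field.timesX 8 r19 v) (λ _ → refl)) mul-spec₁₉ codes₁₉

design₁₉ : GF.BalancedInvariantDesignExists 19 r19
design₁₉ = I₁₉.design (I₁₉.fieldChecks refl refl refl refl refl) (I₁₉.certificateChecks refl refl refl)

theorem5 : GF.BalancedInvariantDesignExists 7 r7
    × GF.BalancedInvariantDesignExists 13 r13
    × GF.BalancedInvariantDesignExists 19 r19
theorem5 = design₇ , design₁₃ , design₁₉
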